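{- For any positive integers $\alpha,\beta,m,n,r$, we have $$\sum_{k=0}^{n-1}\left[(k)_{\beta}(k+\beta+1)_{\beta}\right]^r\,[2(k+\beta)]\,q^{(n-2\beta-k)(2\beta\alpha m+1)}\prod_{i=0}^{2\beta-1}\left(w_{k+i}^{(\alpha)}(x;q)\right)^m\equiv 0\pmod{[n]},$$ where the congruence is in the ring $\mathbb{Z}[q,q^{ -1}][x]$.
   Context: Here $q$ and $x$ are indeterminates. $(y)_0=1$ and $(y)_N=y(y+1)\cdots(y+N-1)$ for $N\ge1$ is the rising factorial. For an integer $N$, $[N]=\frac{1-q^N}{1-q}$ is the $q$-integer, an element of $\mathbb{Z}[q,q^{ -1}]$; in particular $[(k)_{\beta}(k+\beta+1)_{\beta}]$ is the $q$-integer of the number $(k)_\beta(k+\beta+1)_\beta$. For nonnegative integers $N$ and integers $k$, $\left[\begin{matrix} N \\ k \end{matrix}\right]=\frac{\prod_{1\le j\le k}[N-j+1]}{\prod_{1\le j\le k}[j]}$ is the $q$-binomial coefficient, equal to $1$ if $k=0$ and to $0$ if $k<0$ or $k>N$. For a nonnegative integer $k$ and a positive integer $\alpha$, $$w_k^{(\alpha)}(x;q)=\sum_{j=1}^{k}q^{\alpha\left(\binom{j+1}{2}-(k+1)(j-1)\right)}\left(\left[\begin{matrix} k-1 \\ j-1 \end{matrix}\right]\left[\begin{matrix} k+j \\ j \end{matrix}\right]-\left[\begin{matrix} k \\ j \end{matrix}\right]\left[\begin{matrix} k+j \\ j-1 \end{matrix}\right]\right)^{\alpha}x^{j-1}\in\mathbb{Z}[q,q^{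 -1}][x],$$ with $w_0^{(\alpha)}(x;q)=0$ (empty sum). A congruence $A\equiv 0\pmod{P(q)}$ means that $P(q)$ divides $A$ in $\mathbb{Z}[q,q^{ -1}][x]$. -}

module Defs where

open import Algebra.Bundles using (CommutativeMonoid; CommutativeRing; Semiring)
open import Algebra.Structures using (IsCommutativeMonoid)
open import Data.Bool.Base using (if_then_else_; true; false)
open import Data.Fin.Base using (Fin; toℕ; fromℕ; inject₁)
open import Data.Fin.Properties using (toℕ-inject₁; toℕ-fromℕ)
open import Data.Integer.Base as ℤ using (ℤ; +_; -[1+_])
import Data.Integer.Properties as ℤ
open import Data.List.Base using (List; []; _∷_; _++_; map; cartesianProductWith; deduplicate)
open import Data.List.Membership.Propositional using (_∈_)
open import Data.List.Membership.Propositional.Properties using (∈-++⁺ˡ; ∈-++⁺ʳ; ∈-deduplicate⁺)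
open import Data.List.Relation.Unary.All as All using (All; []; _∷_)
open import Data.List.Relation.Unary.AllPairs using ([]; _∷_)
open import Data.List.Relation.Unary.Any using (here; there)
open import Data.List.Relation.Unary.Unique.Propositional using (Unique)
open import Data.List.Relation.Unary.Unique.DecPropositional.Properties using (deduplicate-!)
open import Data.Nat.Base as ℕ using (ℕ; zero; suc)
open import Data.Nat.Combinatorics using (_C_)
import Data.Nat.Properties as ℕ
open import Data.Product.Base using (_×_; _,_; proj₂)
open import Function.Base using (_∘_)
open import Level using (0ℓ)
open import Relation.Binary.Definitions using (DecidableEquality)
open import Relation.Binary.PropositionalEquality as ≡ using (_≡_; _≢_)
open import Relation.Nullary using (yes; no; does)
open import Relation.Nullary.Negation using (contradiction)

-- The algebra R[A] of a commutative monoid A: Laurent polynomials over R for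
-- A = ℤ, polynomials over R for A = ℕ.  An element is a formal sum of terms
-- c·g, possibly with repeated or vanishing terms, and two formal sums are
-- equal when every g has the same total coefficient in both.
module MonoidAlgebra
  (R : CommutativeRing 0ℓ 0ℓ)
  {A : Set} (_≟_ : DecidableEquality A)
  {_∙_ : A → A → A} {ε : A} (isCM : IsCommutativeMonoid _≡_ _∙_ ε)
  where

  private
    module R = CommutativeRing R
    module A = IsCommutativeMonoid isCM
  open import Relation.Binary.Reasoning.Setoid R.setoid
  open import Algebra.Properties.Ring R.ring using (-‿distribˡ-*; -‿+-comm; -0#≈0#)
  open import Algebra.Properties.CommutativeSemigroup
    (CommutativeMonoid.commutativeSemigroup R.+-commutativeMonoid) using (interchange; x∙yz≈y∙xz)
  open import Algebra.Properties.CommutativeSemigroup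
    (CommutativeMonoid.commutativeSemigroup R.*-commutativeMonoid)
    using () renaming (x∙yz≈y∙xz to *-swap)

  infix  4 _≈_
  infixl 6 _+_
  infixl 7 _*_
  infix  8 -_

  Carrier : Set
  Carrier = List (R.Carrier × A)

  monomial : R.Carrier → A → Carrier
  monomial c g = (c , g) ∷ []

  _+_ : Carrier → Carrier → Carrier
  _+_ = _++_

  -_ : Carrier → Carrier
  -_ = map λ (c , g) → R.- c , g

  _*_ : Carrier → Carrier → Carrier
  _*_ = cartesianProductWith λ (c , g) (d , h) → c R.* d , g ∙ h

  0# 1# : Carrier
  0# = []
  1# = monomial R.1# ε

  coeff : Carrier → A → R.Carrier
  coeff []            h = R.0#
  coeff ((c , g) ∷ p) h = (if does (g ≟ h) then c else R.0#) R.+ coeff p h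

  record _≈_ (p q : Carrier) : Set where
    constructor coeffs
    field coeff-≈ : ∀ h → coeff p h R.≈ coeff q h
  open _≈_ public

  -- The R-linear extension of f : A → R to R[A].
  eval : Carrier → (A → R.Carrier) → R.Carrier
  eval []            f = R.0#
  eval ((c , g) ∷ p) f = c R.* f g R.+ eval p f

  private
    δ : A → A → R.Carrier
    δ h g = if does (g ≟ h) then R.1# else R.0#

    *δ : ∀ c g h → c R.* δ h g R.≈ (if does (g ≟ h) then c else R.0#)
    *δ c g h with does (g ≟ h)
    ... | true  = R.*-identityʳ c
    ... | false = R.zeroʳ c

    coeff-eval : ∀ p h → coeff p h R.≈ eval p (δ h)
    coeff-eval []            h = R.refl
    coeff-eval ((c , g) ∷ p) h = R.+-cong (R.sym (*δ c g h)) (coeff-eval p h)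

    exponents : Carrier → List A
    exponents = map proj₂

    combine : List A → (A → R.Carrier) → (A → R.Carrier) → R.Carrier
    combine []      a f = R.0#
    combine (s ∷ S) a f = a s R.* f s R.+ combine S a f

    combine-cong : ∀ S {a b} f → (∀ s → a s R.≈ b s) → combine S a f R.≈ combine S b f
    combine-cong []      f e = R.refl
    combine-cong (s ∷ S) f e = R.+-cong (R.*-congʳ (e s)) (combine-cong S f e)

    combine-0 : ∀ S f → combine S (λ _ → R.0#) f R.≈ R.0#
    combine-0 []      f = R.refl
    combine-0 (s ∷ S) f =
      R.trans (R.+-cong (R.zeroˡ _) (combine-0 S f)) (R.+-identityˡ _)

    combine-+ : ∀ S a b f →
      combine S (λ s → a s R.+ b s) f R.≈ combine S a f R.+ combine S b f
    combine-+ []      a b f = R.sym (R.+-identityˡ _)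
    combine-+ (s ∷ S) a b f =
      R.trans (R.+-cong (R.distribʳ _ _ _) (combine-+ S a b f)) (interchange _ _ _ _)

    combine-∉ : ∀ S c g f → All (g ≢_) S →
      combine S (λ s → if does (g ≟ s) then c else R.0#) f R.≈ R.0#
    combine-∉ []      c g f []       = R.refl
    combine-∉ (s ∷ S) c g f (n ∷ ns) with g ≟ s
    ... | yes e = contradiction e n
    ... | no  _ = R.trans (R.+-cong (R.zeroˡ _) (combine-∉ S c g f ns)) (R.+-identityˡ _)

    combine-∈ : ∀ S c g f → Unique S → g ∈ S →
      combine S (λ s → if does (g ≟ s) then c else R.0#) f R.≈ c R.* f g
    combine-∈ (s ∷ S) c g f (s∉ ∷ u) g∈ with g ≟ s | g∈
    ... | yes ≡.refl | _         =
      R.trans (R.+-congˡ (combine-∉ S c g f s∉)) (R.+-identityʳ _)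
    ... | no n       | here e    = contradiction e n
    ... | no n       | there g∈S =
      R.trans (R.+-cong (R.zeroˡ _) (combine-∈ S c g f u g∈S)) (R.+-identityˡ _)

    eval-combine : ∀ S f → Unique S → ∀ p → (∀ {g} → g ∈ exponents p → g ∈ S) →
      eval p f R.≈ combine S (coeff p) f
    eval-combine S f u []            ⊆S = R.sym (combine-0 S f)
    eval-combine S f u ((c , g) ∷ p) ⊆S = R.sym (begin
      combine S (coeff ((c , g) ∷ p)) f                   ≈⟨ combine-+ S _ _ f ⟩
      combine S (λ s → if does (g ≟ s) then c else R.0#) f
        R.+ combine S (coeff p) f                         ≈⟨ R.+-cong
          (combine-∈ S c g f u (⊆S (here ≡.refl)))
          (R.sym (eval-combine S f u p (⊆S ∘ there))) ⟩
      c R.* f g R.+ eval p f                              ∎)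

  ≈-eval : ∀ {p q} → p ≈ q → ∀ f → eval p f R.≈ eval q f
  ≈-eval {p} {q} p≈q f = begin
    eval p f              ≈⟨ eval-combine S f S! p (∈S ∘ ∈-++⁺ˡ) ⟩
    combine S (coeff p) f ≈⟨ combine-cong S f (coeff-≈ p≈q) ⟩
    combine S (coeff q) f ≈⟨ eval-combine S f S! q (∈S ∘ ∈-++⁺ʳ (exponents p)) ⟨
    eval q f              ∎
    where
    S  = deduplicate _≟_ (exponents p ++ exponents q)
    S! = deduplicate-! _≟_ (exponents p ++ exponents q)
    ∈S : ∀ {g} → g ∈ exponents p ++ exponents q → g ∈ S
    ∈S = ∈-deduplicate⁺ _≟_

  eval-≈ : ∀ {p q} → (∀ f → eval p f R.≈ eval q f) → p ≈ q
  eval-≈ {p} {q} e = coeffs λ h → begin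
    coeff p h    ≈⟨ coeff-eval p h ⟩
    eval p (δ h) ≈⟨ e (δ h) ⟩
    eval q (δ h) ≈⟨ coeff-eval q h ⟨
    coeff q h    ∎

  eval-cong : ∀ p {f f′} → (∀ g → f g R.≈ f′ g) → eval p f R.≈ eval p f′
  eval-cong []            e = R.refl
  eval-cong ((c , g) ∷ p) e = R.+-cong (R.*-congˡ (e g)) (eval-cong p e)

  eval-+ : ∀ p q f → eval (p + q) f R.≈ eval p f R.+ eval q f
  eval-+ []            q f = R.sym (R.+-identityˡ _)
  eval-+ ((c , g) ∷ p) q f = R.trans (R.+-congˡ (eval-+ p q f)) (R.sym (R.+-assoc _ _ _))

  eval-neg : ∀ p f → eval (- p) f R.≈ R.- eval p f
  eval-neg []            f = R.sym -0#≈0#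
  eval-neg ((c , g) ∷ p) f = R.trans
    (R.+-cong (R.sym (-‿distribˡ-* c (f g))) (eval-neg p f)) (-‿+-comm _ _)

  private
    eval-fun-0 : ∀ p → eval p (λ _ → R.0#) R.≈ R.0#
    eval-fun-0 []            = R.refl
    eval-fun-0 ((c , g) ∷ p) =
      R.trans (R.+-cong (R.zeroʳ c) (eval-fun-0 p)) (R.+-identityˡ _)

    eval-fun-+ : ∀ p f f′ → eval p (λ g → f g R.+ f′ g) R.≈ eval p f R.+ eval p f′
    eval-fun-+ []            f f′ = R.sym (R.+-identityˡ _)
    eval-fun-+ ((c , g) ∷ p) f f′ =
      R.trans (R.+-cong (R.distribˡ _ _ _) (eval-fun-+ p f f′)) (interchange _ _ _ _)

    eval-fun-* : ∀ p c f → eval p (λ g → c R.* f g) R.≈ c R.* eval p f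
    eval-fun-* []            c f = R.sym (R.zeroʳ c)
    eval-fun-* ((d , g) ∷ p) c f =
      R.trans (R.+-cong (*-swap d c (f g)) (eval-fun-* p c f)) (R.sym (R.distribˡ c _ _))

    eval-swap : ∀ p q (f : A → A → R.Carrier) →
      eval p (λ g → eval q (f g)) R.≈ eval q (λ h → eval p (λ g → f g h))
    eval-swap []            q f = R.sym (eval-fun-0 q)
    eval-swap ((c , g) ∷ p) q f = R.sym (R.trans (eval-fun-+ q _ _)
      (R.+-cong (eval-fun-* q c (f g)) (R.sym (eval-swap p q f))))

    eval-term : ∀ c g q f →
      eval (map (λ (d , h) → c R.* d , g ∙ h) q) f R.≈ c R.* eval q (λ h → f (g ∙ h))
    eval-term c g []            f = R.sym (R.zeroʳ c)
    eval-term c g ((d , h) ∷ q) f =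
      R.trans (R.+-cong (R.*-assoc _ _ _) (eval-term c g q f)) (R.sym (R.distribˡ c _ _))

  eval-* : ∀ p q f → eval (p * q) f R.≈ eval p (λ g → eval q (λ h → f (g ∙ h)))
  eval-* []            q f = R.refl
  eval-* ((c , g) ∷ p) q f =
    R.trans (eval-+ (map (λ (d , h) → c R.* d , g ∙ h) q) (p * q) f)
            (R.+-cong (eval-term c g q f) (eval-* p q f))

  eval-monomial : ∀ c g f → eval (monomial c g) f R.≈ c R.* f g
  eval-monomial c g f = R.+-identityʳ _

  private
    ≡⇒≈ : ∀ (f : A → R.Carrier) {g h} → g ≡ h → f g R.≈ f h
    ≡⇒≈ f ≡.refl = R.refl

    eval-1 : ∀ f → eval 1# f R.≈ f ε
    eval-1 f = R.trans (R.+-identityʳ _) (R.*-identityˡ _)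

    *-comm : ∀ p q → p * q ≈ q * p
    *-comm p q = eval-≈ λ f → begin
      eval (p * q) f                          ≈⟨ eval-* p q f ⟩
      eval p (λ g → eval q (λ h → f (g ∙ h))) ≈⟨ eval-swap p q _ ⟩
      eval q (λ h → eval p (λ g → f (g ∙ h))) ≈⟨ eval-cong q (λ h → eval-cong p λ g →
                                                    ≡⇒≈ f (A.comm g h)) ⟩
      eval q (λ h → eval p (λ g → f (h ∙ g))) ≈⟨ eval-* q p f ⟨
      eval (q * p) f                          ∎

    *-assoc : ∀ p q r → (p * q) * r ≈ p * (q * r)
    *-assoc p q r = eval-≈ λ f → begin
      eval ((p * q) * r) f
        ≈⟨ eval-* (p * q) r f ⟩
      eval (p * q) (λ g → eval r (λ k → f (g ∙ k)))
        ≈⟨ eval-* p q _ ⟩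
      eval p (λ g → eval q (λ h → eval r (λ k → f ((g ∙ h) ∙ k))))
        ≈⟨ eval-cong p (λ g → eval-cong q λ h → eval-cong r λ k → ≡⇒≈ f (A.assoc g h k)) ⟩
      eval p (λ g → eval q (λ h → eval r (λ k → f (g ∙ (h ∙ k)))))
        ≈⟨ eval-cong p (λ g → eval-* q r _) ⟨
      eval p (λ g → eval (q * r) (λ h → f (g ∙ h)))
        ≈⟨ eval-* p (q * r) f ⟨
      eval (p * (q * r)) f ∎

    *-cong : ∀ {p p′ q q′} → p ≈ p′ → q ≈ q′ → p * q ≈ p′ * q′
    *-cong {p} {p′} {q} {q′} e e′ = eval-≈ λ f → begin
      eval (p * q) f                            ≈⟨ eval-* p q f ⟩
      eval p (λ g → eval q (λ h → f (g ∙ h)))   ≈⟨ eval-cong p (λ g → ≈-eval e′ _) ⟩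
      eval p (λ g → eval q′ (λ h → f (g ∙ h)))  ≈⟨ ≈-eval e _ ⟩
      eval p′ (λ g → eval q′ (λ h → f (g ∙ h))) ≈⟨ eval-* p′ q′ f ⟨
      eval (p′ * q′) f                          ∎

    *-identityˡ : ∀ p → 1# * p ≈ p
    *-identityˡ p = eval-≈ λ f → begin
      eval (1# * p) f                          ≈⟨ eval-* 1# p f ⟩
      eval 1# (λ g → eval p (λ h → f (g ∙ h))) ≈⟨ eval-1 (λ g → eval p (λ h → f (g ∙ h))) ⟩
      eval p (λ h → f (ε ∙ h))                 ≈⟨ eval-cong p (λ h → ≡⇒≈ f (A.identityˡ h)) ⟩
      eval p f                                 ∎

    distribʳ : ∀ r p q → (p + q) * r ≈ p * r + q * r
    distribʳ r p q = eval-≈ λ f → begin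
      eval ((p + q) * r) f ≈⟨ eval-* (p + q) r f ⟩
      eval (p + q) _       ≈⟨ eval-+ p q _ ⟩
      eval p _ R.+ eval q _ ≈⟨ R.+-cong (eval-* p r f) (eval-* q r f) ⟨
      eval (p * r) f R.+ eval (q * r) f ≈⟨ eval-+ (p * r) (q * r) f ⟨
      eval (p * r + q * r) f ∎

    ≈-refl : ∀ {p} → p ≈ p
    ≈-refl = coeffs λ _ → R.refl

    ≈-sym : ∀ {p q} → p ≈ q → q ≈ p
    ≈-sym (coeffs e) = coeffs λ h → R.sym (e h)

    ≈-trans : ∀ {p q r} → p ≈ q → q ≈ r → p ≈ r
    ≈-trans (coeffs e) (coeffs e′) = coeffs λ h → R.trans (e h) (e′ h)

    +-cong : ∀ {p p′ q q′} → p ≈ p′ → q ≈ q′ → p + q ≈ p′ + q′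
    +-cong {p} {p′} {q} {q′} e e′ = eval-≈ λ f → begin
      eval (p + q) f            ≈⟨ eval-+ p q f ⟩
      eval p f R.+ eval q f     ≈⟨ R.+-cong (≈-eval e f) (≈-eval e′ f) ⟩
      eval p′ f R.+ eval q′ f   ≈⟨ eval-+ p′ q′ f ⟨
      eval (p′ + q′) f          ∎

    +-comm : ∀ p q → p + q ≈ q + p
    +-comm p q = eval-≈ λ f → begin
      eval (p + q) f        ≈⟨ eval-+ p q f ⟩
      eval p f R.+ eval q f ≈⟨ R.+-comm _ _ ⟩
      eval q f R.+ eval p f ≈⟨ eval-+ q p f ⟨
      eval (q + p) f        ∎

    +-assoc : ∀ p q r → (p + q) + r ≈ p + (q + r)
    +-assoc p q r = eval-≈ λ f → begin
      eval ((p + q) + r) f                    ≈⟨ eval-+ (p + q) r f ⟩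
      eval (p + q) f R.+ eval r f             ≈⟨ R.+-congʳ (eval-+ p q f) ⟩
      (eval p f R.+ eval q f) R.+ eval r f    ≈⟨ R.+-assoc _ _ _ ⟩
      eval p f R.+ (eval q f R.+ eval r f)    ≈⟨ R.+-congˡ (eval-+ q r f) ⟨
      eval p f R.+ eval (q + r) f             ≈⟨ eval-+ p (q + r) f ⟨
      eval (p + (q + r)) f                    ∎

    neg-cong : ∀ {p q} → p ≈ q → - p ≈ - q
    neg-cong {p} {q} e = eval-≈ λ f → begin
      eval (- p) f    ≈⟨ eval-neg p f ⟩
      R.- eval p f    ≈⟨ R.-‿cong (≈-eval e f) ⟩
      R.- eval q f    ≈⟨ eval-neg q f ⟨
      eval (- q) f    ∎

    neg-inverseˡ : ∀ p → - p + p ≈ 0#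
    neg-inverseˡ p = eval-≈ λ f → begin
      eval (- p + p) f             ≈⟨ eval-+ (- p) p f ⟩
      eval (- p) f R.+ eval p f    ≈⟨ R.+-congʳ (eval-neg p f) ⟩
      R.- eval p f R.+ eval p f    ≈⟨ R.-‿inverseˡ _ ⟩
      R.0#                         ∎

  commutativeRing : CommutativeRing 0ℓ 0ℓ
  commutativeRing = record
    { Carrier = Carrier ; _≈_ = _≈_ ; _+_ = _+_ ; _*_ = _*_ ; -_ = -_ ; 0# = 0# ; 1# = 1#
    ; isCommutativeRing = record
      { isRing = record
        { +-isAbelianGroup = record
          { isGroup = record
            { isMonoid = record
              { isSemigroup = record
                { isMagma = record
                  { isEquivalence = record { refl = ≈-refl ; sym = ≈-sym ; trans = ≈-trans }
                  ; ∙-cong = +-cong }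
                ; assoc = +-assoc }
              ; identity = (λ p → ≈-refl) , λ p → +-comm p 0# }
            ; inverse = neg-inverseˡ , λ p → ≈-trans (+-comm p (- p)) (neg-inverseˡ p)
            ; ⁻¹-cong = neg-cong }
          ; comm = +-comm }
        ; *-cong = *-cong
        ; *-assoc = *-assoc
        ; *-identity = *-identityˡ , λ p → ≈-trans (*-comm p 1#) (*-identityˡ p)
        ; distrib = (λ r p q → ≈-trans (*-comm r (p + q))
                      (≈-trans (distribʳ r p q) (+-cong (*-comm p r) (*-comm q r))))
                  , distribʳ }
      ; *-comm = *-comm } }

module RangeOperators (R : CommutativeRing 0ℓ 0ℓ) where

  open CommutativeRing R
  open import Algebra.Definitions.RawSemiring (Semiring.rawSemiring semiring)
    using (sum; product)

  infixr 5 ∑-syntax ∑₁-syntax ∏-syntax ∏₁-syntax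

  ∑-syntax ∏-syntax ∑₁-syntax ∏₁-syntax : ℕ → (ℕ → Carrier) → Carrier
  ∑-syntax  n f = sum {n} (f ∘ toℕ)
  ∏-syntax  n f = product {n} (f ∘ toℕ)
  ∑₁-syntax n f = ∑-syntax n (f ∘ suc)
  ∏₁-syntax n f = ∏-syntax n (f ∘ suc)

  syntax ∑-syntax  n (λ i → e) = ∑[ i < n ] e
  syntax ∏-syntax  n (λ i → e) = ∏[ i < n ] e
  syntax ∑₁-syntax n (λ i → e) = ∑[1≤ i ≤ n ] e
  syntax ∏₁-syntax n (λ i → e) = ∏[1≤ i ≤ n ] e

rising : ℕ → ℕ → ℕ
rising y zero    = 1
rising y (suc N) = rising y N ℕ.* (y ℕ.+ N)

module IntegerLemmas where

  open ≡.≡-Reasoning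

  i-suc+1 : ∀ i k → i ℤ.- + suc k ℤ.+ + 1 ≡ i ℤ.- + k
  i-suc+1 i k = ≡.trans (ℤ.+-assoc i (ℤ.- + suc k) (+ 1)) (≡.cong (ℤ._+_ i) (lem k))
    where
    lem : ∀ k → ℤ.- + suc k ℤ.+ + 1 ≡ ℤ.- + k
    lem zero    = ≡.refl
    lem (suc k) = ≡.refl

  suc-suc : ∀ N j → + suc N ℤ.- + suc j ≡ + N ℤ.- + j
  suc-suc N j = begin
    + suc N ℤ.- + suc j ≡⟨ ℤ.[+m]-[+n]≡m⊖n (suc N) (suc j) ⟩
    suc N ℤ.⊖ suc j     ≡⟨ ℤ.[1+m]⊖[1+n]≡m⊖n N j ⟩
    N ℤ.⊖ j             ≡⟨ ℤ.[+m]-[+n]≡m⊖n N j ⟨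
    + N ℤ.- + j         ∎

  suc-rearrange : ∀ N k → + suc k ℤ.+ (+ N ℤ.- + k) ≡ + suc N
  suc-rearrange N k = begin
    + suc k ℤ.+ (+ N ℤ.- + k)        ≡⟨ ≡.cong (ℤ._+_ (+ suc k)) (suc-suc N k) ⟨
    + suc k ℤ.+ (+ suc N ℤ.- + suc k) ≡⟨ ℤ.+-comm (+ suc k) (+ suc N ℤ.- + suc k) ⟩
    + suc N ℤ.- + suc k ℤ.+ + suc k  ≡⟨ ℤ.+-assoc (+ suc N) (ℤ.- + suc k) (+ suc k) ⟩
    + suc N ℤ.+ (ℤ.- + suc k ℤ.+ + suc k) ≡⟨ ≡.cong (ℤ._+_ (+ suc N)) (ℤ.+-inverseˡ (+ suc k)) ⟩
    + suc N ℤ.+ + 0                  ≡⟨ ℤ.+-identityʳ (+ suc N) ⟩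
    + suc N                          ∎

  shift-bound : ∀ k i e s → + k ℤ.+ e ≡ i → ℤ.∣ i ∣ ℕ.+ (ℤ.∣ e ∣ ℕ.+ s) ℕ.< k → k ℕ.< k
  shift-bound k i e s eq h = ℕ.≤-<-trans
    (ℕ.≤-trans (ℕ.≤-reflexive (≡.cong ℤ.∣_∣ k≡i-e))
      (ℕ.≤-trans (ℤ.∣i-j∣≤∣i∣+∣j∣ i e) (ℕ.+-monoʳ-≤ ℤ.∣ i ∣ (ℕ.m≤m+n ℤ.∣ e ∣ s)))) h
    where
    k≡i-e : + k ≡ i ℤ.- e
    k≡i-e = begin
      + k                 ≡⟨ ℤ.+-identityʳ (+ k) ⟨
      + k ℤ.+ + 0         ≡⟨ ≡.cong (ℤ._+_ (+ k)) (ℤ.+-inverseʳ e) ⟨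
      + k ℤ.+ (e ℤ.- e)   ≡⟨ ℤ.+-assoc (+ k) e (ℤ.- e) ⟨
      + k ℤ.+ e ℤ.- e     ≡⟨ ≡.cong (ℤ._- e) eq ⟩
      i ℤ.- e             ∎

-- The powers of an invertible element q of R such that no 1 - qˢ with s > 0 is a
-- zero divisor, so that quotients by q-integers are unique.
record IsGenericPower (R : CommutativeRing 0ℓ 0ℓ) (q^ : ℤ → CommutativeRing.Carrier R) : Set where
  open CommutativeRing R
  field
    q^0         : q^ (+ 0) ≈ 1#
    q^-+        : ∀ i j → q^ i * q^ j ≈ q^ (i ℤ.+ j)
    1-q^-cancel : ∀ s c → c * (1# - q^ (+ suc s)) ≈ 0# → c ≈ 0#

module QAnalogues
  (R : CommutativeRing 0ℓ 0ℓ) (q^ : ℤ → CommutativeRing.Carrier R) (generic : IsGenericPower R q^)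
  where

  open IntegerLemmas
  open IsGenericPower generic
  open CommutativeRing R
  open RangeOperators R
  open import Algebra.Definitions.RawSemiring (Semiring.rawSemiring semiring) using (product)
  open import Algebra.Definitions.RawMagma *-rawMagma using (_∣_; _∣ʳ_; _,_)
  open import Algebra.Properties.Ring ring
    using (-‿distribˡ-*; x[y-z]≈xy-xz; [y-z]x≈yx-zx; ⁻¹-anti-homo-//; x≈y⇒x∙y⁻¹≈ε; x∙y⁻¹≈ε⇒x≈y)
  open import Algebra.Properties.Monoid.Sum *-monoid
    using () renaming (sum-init-last to product-init-last; sum-cong-≋ to product-cong)
  open import Algebra.Properties.CommutativeSemigroup
    (CommutativeMonoid.commutativeSemigroup *-commutativeMonoid)
    using (x∙yz≈y∙xz)
  open import Relation.Binary.Reasoning.Setoid setoid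

  quotient : ∀ {a b} → a ∣ b → Carrier
  quotient = _∣ʳ_.quotient

  quotient-* : ∀ {a b} (a∣b : a ∣ b) → quotient a∣b * a ≈ b
  quotient-* = _∣ʳ_.equality

  private
    telescope : ∀ a b c → (a - b) + (b - c) ≈ a - c
    telescope a b c = begin
      (a - b) + (b - c)     ≈⟨ +-assoc a (- b) (b - c) ⟩
      a + (- b + (b - c))   ≈⟨ +-congˡ (+-assoc (- b) b (- c)) ⟨
      a + ((- b + b) - c)   ≈⟨ +-congˡ (+-congʳ (-‿inverseˡ b)) ⟩
      a + (0# - c)          ≈⟨ +-congˡ (+-identityˡ (- c)) ⟩
      a - c                 ∎

    1-q*split : ∀ i j → (1# - q^ i) + q^ i * (1# - q^ j) ≈ 1# - q^ (i ℤ.+ j)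
    1-q*split i j = begin
      (1# - q^ i) + q^ i * (1# - q^ j)        ≈⟨ +-congˡ (x[y-z]≈xy-xz (q^ i) 1# (q^ j)) ⟩
      (1# - q^ i) + (q^ i * 1# - q^ i * q^ j) ≈⟨ +-congˡ (+-cong (*-identityʳ (q^ i)) (-‿cong (q^-+ i j))) ⟩
      (1# - q^ i) + (q^ i - q^ (i ℤ.+ j))     ≈⟨ telescope 1# (q^ i) (q^ (i ℤ.+ j)) ⟩
      1# - q^ (i ℤ.+ j)                       ∎

    1-q∣1-q^n : ∀ n → 1# - q^ (+ 1) ∣ 1# - q^ (+ n)
    1-q∣1-q^n zero    = 0# , trans (zeroˡ _) (sym (trans (+-congˡ (-‿cong q^0)) (-‿inverseʳ 1#)))
    1-q∣1-q^n (suc n) = 1# + q^ (+ 1) * c , (begin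
      (1# + q^ (+ 1) * c) * d            ≈⟨ distribʳ d 1# (q^ (+ 1) * c) ⟩
      1# * d + q^ (+ 1) * c * d          ≈⟨ +-cong (*-identityˡ d) (*-assoc (q^ (+ 1)) c d) ⟩
      d + q^ (+ 1) * (c * d)             ≈⟨ +-congˡ (*-congˡ (quotient-* (1-q∣1-q^n n))) ⟩
      d + q^ (+ 1) * (1# - q^ (+ n))     ≈⟨ 1-q*split (+ 1) (+ n) ⟩
      1# - q^ (+ suc n)                  ∎)
      where
      c = quotient (1-q∣1-q^n n)
      d = 1# - q^ (+ 1)

  1-q∣1-q^ : ∀ N → 1# - q^ (+ 1) ∣ 1# - q^ N
  1-q∣1-q^ (+ n)    = 1-q∣1-q^n n
  1-q∣1-q^ -[1+ n ] = - (u * c) , (begin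
    - (u * c) * d              ≈⟨ -‿distribˡ-* (u * c) d ⟨
    - (u * c * d)              ≈⟨ -‿cong (*-assoc u c d) ⟩
    - (u * (c * d))            ≈⟨ -‿cong (*-congˡ (quotient-* (1-q∣1-q^n (suc n)))) ⟩
    - (u * (1# - q^ (+ suc n))) ≈⟨ -‿cong (x[y-z]≈xy-xz u 1# (q^ (+ suc n))) ⟩
    - (u * 1# - u * q^ (+ suc n))
      ≈⟨ -‿cong (+-cong (*-identityʳ u) (-‿cong (trans (q^-+ -[1+ n ] (+ suc n))
           (trans (reflexive (≡.cong q^ (ℤ.+-inverseˡ (+ suc n)))) q^0)))) ⟩
    - (u - 1#)                 ≈⟨ ⁻¹-anti-homo-// u 1# ⟩
    1# - u                     ∎)
    where
    u = q^ -[1+ n ]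
    c = quotient (1-q∣1-q^n (suc n))
    d = 1# - q^ (+ 1)

  [_] : ℤ → Carrier
  [ N ] = quotient (1-q∣1-q^ N)

  private
    cancel : ∀ d → (∀ c → c * d ≈ 0# → c ≈ 0#) → ∀ a b → a * d ≈ b * d → a ≈ b
    cancel d z a b e = x∙y⁻¹≈ε⇒x≈y a b (z (a - b)
      (trans ([y-z]x≈yx-zx d a b) (x≈y⇒x∙y⁻¹≈ε e)))

  1-q-cancel : ∀ a b → a * (1# - q^ (+ 1)) ≈ b * (1# - q^ (+ 1)) → a ≈ b
  1-q-cancel = cancel (1# - q^ (+ 1)) (1-q^-cancel 0)

  []-cancel : ∀ s c → c * [ + suc s ] ≈ 0# → c ≈ 0#
  []-cancel s c e = 1-q^-cancel s c (begin
    c * (1# - q^ (+ suc s))               ≈⟨ *-congˡ (quotient-* (1-q∣1-q^ (+ suc s))) ⟨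
    c * ([ + suc s ] * (1# - q^ (+ 1)))   ≈⟨ *-assoc c [ + suc s ] (1# - q^ (+ 1)) ⟨
    c * [ + suc s ] * (1# - q^ (+ 1))     ≈⟨ *-congʳ e ⟩
    0# * (1# - q^ (+ 1))                  ≈⟨ zeroˡ (1# - q^ (+ 1)) ⟩
    0#                                    ∎)

  []-+ : ∀ i j → [ i ] + q^ i * [ j ] ≈ [ i ℤ.+ j ]
  []-+ i j = 1-q-cancel _ _ (begin
    ([ i ] + q^ i * [ j ]) * d          ≈⟨ distribʳ d [ i ] (q^ i * [ j ]) ⟩
    [ i ] * d + q^ i * [ j ] * d        ≈⟨ +-cong (quotient-* (1-q∣1-q^ i)) (*-assoc (q^ i) [ j ] d) ⟩
    (1# - q^ i) + q^ i * ([ j ] * d)    ≈⟨ +-congˡ (*-congˡ (quotient-* (1-q∣1-q^ j))) ⟩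
    (1# - q^ i) + q^ i * (1# - q^ j)    ≈⟨ 1-q*split i j ⟩
    1# - q^ (i ℤ.+ j)                   ≈⟨ quotient-* (1-q∣1-q^ (i ℤ.+ j)) ⟨
    [ i ℤ.+ j ] * d                     ∎)
    where d = 1# - q^ (+ 1)

  numerator : ℕ → ℕ → Carrier
  numerator N k = ∏[1≤ j ≤ k ] [ + N ℤ.- + j ℤ.+ + 1 ]

  denominator : ℕ → Carrier
  denominator k = ∏[1≤ j ≤ k ] [ + j ]

  private
    pascal : ℕ → ℕ → Carrier
    pascal N       zero    = 1#
    pascal zero    (suc k) = 0#
    pascal (suc N) (suc k) = pascal N k + q^ (+ suc k) * pascal N (suc k)

    ∏-last : ∀ (f : ℕ → Carrier) k → ∏[ i < suc k ] f i ≈ (∏[ i < k ] f i) * f k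
    ∏-last f k = begin
      (∏[ i < suc k ] f i)  ≈⟨ product-init-last {k} (f ∘ toℕ) ⟩
      product-init * f (toℕ (fromℕ k))
        ≈⟨ *-cong (product-cong {k} (λ i → reflexive (≡.cong f (toℕ-inject₁ i))))
                  (reflexive (≡.cong f (toℕ-fromℕ k))) ⟩
      (∏[ i < k ] f i) * f k  ∎
      where
      product-init = product {k} (f ∘ toℕ ∘ inject₁)

    numerator-last : ∀ N k → numerator N (suc k) ≈ numerator N k * [ + N ℤ.- + k ]
    numerator-last N k = trans (∏-last (λ j → [ + N ℤ.- + suc j ℤ.+ + 1 ]) k)
      (*-congˡ (reflexive (≡.cong [_] (i-suc+1 (+ N) k))))

    denominator-last : ∀ k → denominator (suc k) ≈ denominator k * [ + suc k ]
    denominator-last = ∏-last (λ j → [ + suc j ])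

    numerator-first : ∀ N k → numerator (suc N) (suc k) ≈ [ + suc N ] * numerator N k
    numerator-first N k = *-cong
      (reflexive (≡.cong [_] (≡.cong +_ (ℕ.+-comm N 1))))
      (product-cong {k} λ i → reflexive (≡.cong (λ z → [ z ℤ.+ + 1 ]) (suc-suc N (suc (toℕ i)))))

    pascal-* : ∀ N k → pascal N k * denominator k ≈ numerator N k
    pascal-* N       zero    = *-identityˡ 1#
    pascal-* zero    (suc k) = trans (zeroˡ (denominator (suc k))) (sym (zeroˡ _))
    pascal-* (suc N) (suc k) = begin
      (P + Q * P′) * D′                     ≈⟨ distribʳ D′ P (Q * P′) ⟩
      P * D′ + Q * P′ * D′                  ≈⟨ +-cong (*-congˡ (denominator-last k)) (*-assoc Q P′ D′) ⟩
      P * (D * [ + suc k ]) + Q * (P′ * D′) ≈⟨ +-congʳ (*-assoc P D [ + suc k ]) ⟨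
      P * D * [ + suc k ] + Q * (P′ * D′)   ≈⟨ +-cong (*-congʳ (pascal-* N k)) (*-congˡ (pascal-* N (suc k))) ⟩
      M * [ + suc k ] + Q * numerator N (suc k) ≈⟨ +-congˡ (*-congˡ (numerator-last N k)) ⟩
      M * [ + suc k ] + Q * (M * [ + N ℤ.- + k ]) ≈⟨ +-congˡ (x∙yz≈y∙xz Q M [ + N ℤ.- + k ]) ⟩
      M * [ + suc k ] + M * (Q * [ + N ℤ.- + k ]) ≈⟨ distribˡ M [ + suc k ] (Q * [ + N ℤ.- + k ]) ⟨
      M * ([ + suc k ] + Q * [ + N ℤ.- + k ])     ≈⟨ *-congˡ ([]-+ (+ suc k) (+ N ℤ.- + k)) ⟩
      M * [ + suc k ℤ.+ (+ N ℤ.- + k) ]     ≈⟨ *-congˡ (reflexive (≡.cong [_] (suc-rearrange N k))) ⟩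
      M * [ + suc N ]                       ≈⟨ *-comm M [ + suc N ] ⟩
      [ + suc N ] * M                       ≈⟨ numerator-first N k ⟨
      numerator (suc N) (suc k)             ∎
      where
      P  = pascal N k
      P′ = pascal N (suc k)
      Q  = q^ (+ suc k)
      D  = denominator k
      D′ = denominator (suc k)
      M  = numerator N k

  denominator∣numerator : ∀ N k → denominator k ∣ numerator N k
  denominator∣numerator N k = pascal N k , pascal-* N k

  denominator-cancel : ∀ k a b → a * denominator k ≈ b * denominator k → a ≈ b
  denominator-cancel k = cancel (denominator k) (nzd k)
    where
    nzd : ∀ k c → c * denominator k ≈ 0# → c ≈ 0#
    nzd zero    c e = trans (sym (*-identityʳ c)) e
    nzd (suc k) c e = nzd k c ([]-cancel k (c * denominator k) (begin
      c * denominator k * [ + suc k ]    ≈⟨ *-assoc c (denominator k) [ + suc k ] ⟩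
      c * (denominator k * [ + suc k ])  ≈⟨ *-congˡ (denominator-last k) ⟨
      c * denominator (suc k)            ≈⟨ e ⟩
      0#                                 ∎))

  [_choose_] : ℕ → ℤ → Carrier
  [ N choose + k ]      = quotient (denominator∣numerator N k)
  [ N choose -[1+ _ ] ] = 0#

  -- For k > N the numerator contains the factor [0].
  choose-> : ∀ N k → N ℕ.< k → [ N choose + k ] ≈ 0#
  choose-> zero    (suc k) _           = refl
  choose-> (suc N) (suc k) (ℕ.s≤s N<k) = begin
    [ N choose + k ] + q^ (+ suc k) * [ N choose + suc k ]
      ≈⟨ +-cong (choose-> N k N<k) (*-congˡ (choose-> N (suc k) (ℕ.m<n⇒m<1+n N<k))) ⟩
    0# + q^ (+ suc k) * 0#  ≈⟨ +-identityˡ _ ⟩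
    q^ (+ suc k) * 0#       ≈⟨ zeroʳ (q^ (+ suc k)) ⟩
    0#                      ∎

c[1-u]≈0⇒c≈uc : (R : CommutativeRing 0ℓ 0ℓ) → let open CommutativeRing R in
  ∀ c u → c * (1# - u) ≈ 0# → c ≈ u * c
c[1-u]≈0⇒c≈uc R c u e = x∙y⁻¹≈ε⇒x≈y c (u * c) (begin
  c - u * c        ≈⟨ +-cong (*-identityʳ c) (-‿cong (*-comm c u)) ⟨
  c * 1# - c * u   ≈⟨ x[y-z]≈xy-xz c 1# u ⟨
  c * (1# - u)     ≈⟨ e ⟩
  0#               ∎)
  where
  open CommutativeRing R
  open import Algebra.Properties.Ring ring using (x[y-z]≈xy-xz; x∙y⁻¹≈ε⇒x≈y)
  open import Relation.Binary.Reasoning.Setoid setoid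

module Laurent where

  open MonoidAlgebra ℤ.+-*-commutativeRing ℤ._≟_ ℤ.+-0-isCommutativeMonoid public
    using ( monomial; coeff; coeffs; coeff-≈; eval; ≈-eval; eval-≈; eval-cong
          ; eval-+; eval-neg; eval-*; eval-monomial)
    renaming (commutativeRing to ℤ[q,q⁻¹])
  open CommutativeRing ℤ[q,q⁻¹] public
  open RangeOperators ℤ[q,q⁻¹] public
  open import Algebra.Definitions.RawSemiring (Semiring.rawSemiring semiring) public
    using (_^_)
  open import Algebra.Definitions.RawMagma *-rawMagma public
    using (_∣_)

  q^ : ℤ → Carrier
  q^ = monomial (+ 1)

  private
    size : Carrier → ℕ
    size []            = 0
    size ((_ , e) ∷ p) = ℤ.∣ e ∣ ℕ.+ size p

    far : ∀ p i k → ℤ.∣ i ∣ ℕ.+ size p ℕ.< k → coeff (q^ (+ k) * p) i ≡ + 0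
    far []            i k h = ≡.refl
    far ((c , e) ∷ p) i k h with (+ k ℤ.+ e) ℤ.≟ i
    ... | yes eq = contradiction (IntegerLemmas.shift-bound k i e (size p) eq h) (ℕ.n≮n k)
    ... | no _   = ≡.trans (ℤ.+-identityˡ _) (far p i k (ℕ.≤-<-trans
      (ℕ.+-monoʳ-≤ ℤ.∣ i ∣ (ℕ.m≤n+m (size p) ℤ.∣ e ∣)) h))

    periodic : ∀ s c → c ≈ q^ (+ s) * c → ∀ k → c ≈ q^ (+ (k ℕ.* s)) * c
    periodic s c e zero    = sym {1# * c} {c} (*-identityˡ c)
    periodic s c e (suc k) = trans {c} {q^ (+ s) * c} {q^ (+ (suc k ℕ.* s)) * c} e
      (trans {q^ (+ s) * c} {q^ (+ s) * (u * c)} {q^ (+ s) * u * c}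
        (*-congˡ {q^ (+ s)} {c} {u * c} (periodic s c e k))
        (sym {q^ (+ s) * u * c} {q^ (+ s) * (u * c)} (*-assoc (q^ (+ s)) u c)))
      where u = q^ (+ (k ℕ.* s))

    -- (1 - qˢ) c = 0 gives c = qᵏˢ c for all k, but the exponents on the right
    -- tend to infinity.
    cancel : ∀ s c → c * (1# - q^ (+ suc s)) ≈ 0# → c ≈ 0#
    cancel s c e = coeffs λ i →
      let k = suc (ℤ.∣ i ∣ ℕ.+ size c) in
      ≡.trans (coeff-≈ (periodic (suc s) c (c[1-u]≈0⇒c≈uc ℤ[q,q⁻¹] c (q^ (+ suc s)) e) k) i)
              (far c i (k ℕ.* suc s) (ℕ.m≤m*n k (suc s)))

  generic : IsGenericPower ℤ[q,q⁻¹] q^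
  generic = record { q^0 = refl {1#} ; q^-+ = λ i j → refl {q^ (i ℤ.+ j)} ; 1-q^-cancel = cancel }

  open QAnalogues ℤ[q,q⁻¹] q^ generic public

module Polynomial where

  open Laurent using (ℤ[q,q⁻¹])

  open MonoidAlgebra ℤ[q,q⁻¹] ℕ._≟_ ℕ.+-0-isCommutativeMonoid public
    using ( monomial; coeff; coeffs; coeff-≈; eval; ≈-eval; eval-≈; eval-cong
          ; eval-+; eval-neg; eval-*; eval-monomial)
    renaming (commutativeRing to ℤ[q,q⁻¹][x])
  open CommutativeRing ℤ[q,q⁻¹][x] public
  open RangeOperators ℤ[q,q⁻¹][x] public
  open import Algebra.Definitions.RawSemiring (Semiring.rawSemiring semiring) public
    using (_^_)
  open import Algebra.Definitions.RawMagma *-rawMagma public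
    using (_∣_)

  const : Laurent.Carrier → Carrier
  const c = monomial c 0

  x : Carrier
  x = monomial Laurent.1# 1

  -- Here 1 ≤ j ≤ k, so no ∸ truncates.
  w : (α k : ℕ) → Carrier
  w α k = ∑[1≤ j ≤ k ] const (coefficient j) * x ^ (j ℕ.∸ 1)
    where
    open Laurent using (q^; [_choose_])
    coefficient : ℕ → Laurent.Carrier
    coefficient j =
      q^ (+ α ℤ.* (+ (suc j C 2) ℤ.- + (suc k ℕ.* (j ℕ.∸ 1))))
      Laurent.*
      ( [ k ℕ.∸ 1 choose + (j ℕ.∸ 1) ] Laurent.* [ k ℕ.+ j choose + j ]
        Laurent.-
        [ k choose + j ] Laurent.* [ k ℕ.+ j choose + (j ℕ.∸ 1) ]
      ) Laurent.^ α

open Laurent public using (q^; [_])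
open Polynomial public using (_*_; _^_; _∣_; ∑-syntax; ∏-syntax; const; w)

{-# OPTIONS --safe #-}
module Submission where

open import Defs using
  (module RangeOperators; module IntegerLemmas; IsGenericPower; module Laurent; module Polynomial; rising)
open import Algebra.Bundles using (CommutativeMonoid; CommutativeRing; Semiring)
open import Data.Bool.Base using (true; false; if_then_else_)
open import Data.Fin.Base using (toℕ)
open import Data.Fin.Permutation using (reverse)
open import Data.Fin.Properties using (opposite-prop; toℕ<n)
open import Data.Integer.Base as ℤ using (ℤ; +_; -[1+_])
open import Data.Integer.DivMod using (_%ℕ_; _/ℕ_; a≡a%ℕn+[a/ℕn]*n; n%ℕd<d)
import Data.Integer.Properties as ℤ
open import Data.Integer.Tactic.RingSolver using (solve-∀)
open import Data.List.Base using ([]; _∷_; map)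
open import Data.List.Properties using (map-++; ++-assoc)
open import Data.Nat.Base as ℕ using (ℕ; zero; suc; _>_; _<_; _≤_; z≤n; s≤s)
open import Data.Nat.Combinatorics using (_C_)
open import Data.Nat.Divisibility using (divides; ∣⇒≤) renaming (_∣_ to _∣ℕ_; ∣-trans to ∣ℕ-trans)
open import Data.Nat.DivMod using (_/_; _%_; m≡m%n+[m/n]*n; m%n<n)
open import Data.Nat.GCD
  using (gcd; gcd[m,n]∣m; gcd[m,n]∣n; gcd-GCD; gcd[m,n]≡0⇒m≡0; module Bézout)
open import Data.Nat.Induction using (<-rec)
import Data.Nat.Properties as ℕ
import Data.Nat.Tactic.RingSolver as ℕ-Solver
open import Data.Product.Base using (∃; _,_; proj₁; proj₂)
open import Data.Sum.Base using (inj₁; inj₂)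
open import Function.Base using (_∘_)
open import Level using (0ℓ)
open import Relation.Binary.Definitions using (tri<; tri≈; tri>)
open import Relation.Binary.PropositionalEquality as ≡ using (_≡_)
open import Relation.Nullary using (does)
open import Relation.Nullary.Negation using (contradiction)

-- Let d > 1 divide n and let q be a primitive d-th root of unity.  The q-Lucas
-- theorem makes w_{ad+l} periodic in a up to factors attached to each coefficient,
-- and the product formula for its coefficients is invariant under l ↦ d - 1 - l,
-- so w_{ad+d-1-l} = q^{-α(2l+1)} w_{ad+l} for 0 < l < d - 1.  The factors
-- [(k)_β (k+β+1)_β] and [2(k+β)] kill every k for which d divides one of
-- k, ..., k + 2β.  On each block of d indices the remaining terms cancel in pairs
-- under k ↦ -2β - k modulo d.
--
-- A sum that vanishes at the primitive d-th roots of unity for all d > 1 dividing n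
-- is divisible by [n]: by induction along the divisors, multiplying it by 1 - q
-- gives a multiple of 1 - qᵈ for all of them, because ℤ[q,q⁻¹][x] / (1 - qᵈ) is
-- torsion-free.

-- The exponents in the statement are forced by the two reflections. By the product formula, the
-- `narayana` factor at `-1 - k` is q^(-(2k+1)j) times the one at `k`, while `twist` grows by
-- (2k+1)(j-1). The ratio is q^(-(2k+1)) for every j, so the reflection holds for whole polynomials
-- in x. Under k ↦ -2β - k the product of weights then gains q^(-2βαm(2k+2β)), and `[2(k+β)]` gains
-- -q^(-(2k+2β)). The explicit power of q has slope -(2βαm+1) in k, which undoes both and leaves
-- only the sign.
--
-- No root of unity is adjoined. A primitive d-th root is the class of q modulo the elements that
-- some product of factors 1 - qˢ, 0 < s < d, carries into the multiples of 1 - qᵈ. This makes the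
-- `[s]` with 0 < s < d cancellable by construction, without cyclotomic polynomials; that 2 is
-- cancellable comes from torsion-freeness. Since `[d]` becomes 0 there, nothing may be divided by a
-- general q-factorial: binomials are given by recursion and the product formula is cleared of
-- denominators.

-- q-integers, q-binomial coefficients and weights over an arbitrary commutative ring

record IsQNumbers
  (R : CommutativeRing 0ℓ 0ℓ) (q^ [_] : ℤ → CommutativeRing.Carrier R) : Set where
  open CommutativeRing R
  field
    q^0  : q^ (+ 0) ≈ 1#
    q^-+ : ∀ i j → q^ i * q^ j ≈ q^ (i ℤ.+ j)
    []-+ : ∀ i j → [ i ] + q^ i * [ j ] ≈ [ i ℤ.+ j ]

twist : ℕ → ℕ → ℤ
twist k j = + (suc j C 2) ℤ.- + (suc k ℕ.* (j ℕ.∸ 1))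

module QBinomials
  (R : CommutativeRing 0ℓ 0ℓ) (q^ [_] : ℤ → CommutativeRing.Carrier R)
  where

  open CommutativeRing R
  open RangeOperators R
  open import Algebra.Definitions.RawSemiring (Semiring.rawSemiring semiring) using (_^_)

  -- Pascal's recursion instead of a quotient of products, because at a root of unity of order d the
  -- denominator vanishes from k = d on.
  binomial : ℕ → ℕ → Carrier
  binomial N       zero    = 1#
  binomial zero    (suc k) = 0#
  binomial (suc N) (suc k) = binomial N k + q^ (+ suc k) * binomial N (suc k)

  -- The difference of products in the coefficient of x^(j-1) in w; for q = 1
  -- it is C(k-1, j-1) C(k+j, j-1) / j.
  narayana : ℕ → ℕ → Carrier
  narayana k j =
    binomial (k ℕ.∸ 1) (j ℕ.∸ 1) * binomial (k ℕ.+ j) j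
    - binomial k j * binomial (k ℕ.+ j) (j ℕ.∸ 1)

  module _ (x : Carrier) where

    weight : (α k : ℕ) → Carrier
    weight α k = ∑[1≤ j ≤ k ] (q^ (+ α ℤ.* twist k j) * narayana k j ^ α) * x ^ (j ℕ.∸ 1)

    summand : (α β m n r : ℕ) → ℕ → Carrier
    summand α β m n r k =
      [ + (rising k β ℕ.* rising (k ℕ.+ β ℕ.+ 1) β) ] ^ r
      * [ + (2 ℕ.* (k ℕ.+ β)) ]
      * q^ ((+ n ℤ.- + (2 ℕ.* β) ℤ.- + k) ℤ.* + (2 ℕ.* β ℕ.* α ℕ.* m ℕ.+ 1))
      * (∏[ i < 2 ℕ.* β ] weight α (k ℕ.+ i) ^ m)

module QNumberProperties
  (R : CommutativeRing 0ℓ 0ℓ) (q^ [_] : ℤ → CommutativeRing.Carrier R)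
  (isQNumbers : IsQNumbers R q^ [_])
  where

  open CommutativeRing R hiding (zero)
  open IsQNumbers isQNumbers public
  open QBinomials R q^ [_]
  open import Algebra.Definitions.RawSemiring (Semiring.rawSemiring semiring) using (_^_)
  open import Algebra.Properties.Ring ring
    using (-‿distribˡ-*; -‿distribʳ-*; x[y-z]≈xy-xz; [y-z]x≈yx-zx
          ; +-identityʳ-unique; +-inverseˡ-unique; -‿involutive)
  open import Algebra.Properties.CommutativeSemiring.Exp commutativeSemiring using (^-congˡ)
  open import Algebra.Solver.Ring.NaturalCoefficients.Default commutativeSemiring
    using (solve; _:+_; _:*_; _:=_; con)
  open import Relation.Binary.Reasoning.Setoid setoid

  q^-≡ : ∀ {i j} → i ≡ j → q^ i ≈ q^ j
  q^-≡ e = reflexive (≡.cong q^ e)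

  []-≡ : ∀ {i j} → i ≡ j → [ i ] ≈ [ j ]
  []-≡ e = reflexive (≡.cong [_] e)

  [0] : [ + 0 ] ≈ 0#
  [0] = +-identityʳ-unique [ + 0 ] [ + 0 ] (begin
    [ + 0 ] + [ + 0 ]              ≈⟨ +-congˡ (*-identityˡ _) ⟨
    [ + 0 ] + 1# * [ + 0 ]         ≈⟨ +-congˡ (*-congʳ q^0) ⟨
    [ + 0 ] + q^ (+ 0) * [ + 0 ]   ≈⟨ []-+ (+ 0) (+ 0) ⟩
    [ + 0 ]                        ∎)

  q^-inverse : ∀ i → q^ (ℤ.- i) * q^ i ≈ 1#
  q^-inverse i = trans (q^-+ (ℤ.- i) i) (trans (q^-≡ (ℤ.+-inverseˡ i)) q^0)

  []-neg : ∀ i → [ ℤ.- i ] ≈ - (q^ (ℤ.- i) * [ i ])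
  []-neg i = +-inverseˡ-unique _ _
    (trans ([]-+ (ℤ.- i) i) (trans ([]-≡ (ℤ.+-inverseˡ i)) [0]))

  q^-^ : ∀ i n → q^ i ^ n ≈ q^ (+ n ℤ.* i)
  q^-^ i zero    = sym (trans (q^-≡ (ℤ.*-zeroˡ i)) q^0)
  q^-^ i (suc n) = trans (*-congˡ (q^-^ i n))
    (trans (q^-+ i (+ n ℤ.* i)) (q^-≡ (≡.sym (ℤ.suc-* (+ n) i))))

  1^ : ∀ n → 1# ^ n ≈ 1#
  1^ zero    = refl
  1^ (suc n) = trans (*-identityˡ _) (1^ n)

  q^-*≈1 : ∀ {i} → q^ i ≈ 1# → ∀ t → q^ (t ℤ.* i) ≈ 1#
  q^-*≈1 {i} e (+ n)    = begin
    q^ (+ n ℤ.* i)  ≈⟨ q^-^ i n ⟨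
    q^ i ^ n        ≈⟨ ^-congˡ n e ⟩
    1# ^ n          ≈⟨ 1^ n ⟩
    1#              ∎
  q^-*≈1 {i} e -[1+ n ] = begin
    q^ (-[1+ n ] ℤ.* i)    ≈⟨ q^-≡ (ℤ.neg-distribˡ-* (+ suc n) i) ⟨
    q^ (ℤ.- j)             ≈⟨ *-identityʳ _ ⟨
    q^ (ℤ.- j) * 1#        ≈⟨ *-congˡ (q^-*≈1 e (+ suc n)) ⟨
    q^ (ℤ.- j) * q^ j      ≈⟨ q^-inverse j ⟩
    1#                     ∎
    where j = + suc n ℤ.* i

  neg*neg : ∀ a b → (- a) * (- b) ≈ a * b
  neg*neg a b = begin
    - a * - b     ≈⟨ -‿distribˡ-* a (- b) ⟨
    - (a * - b)   ≈⟨ -‿cong (-‿distribʳ-* a b) ⟨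
    - - (a * b)   ≈⟨ -‿involutive (a * b) ⟩
    a * b         ∎

  binomial-> : ∀ {N k} → N < k → binomial N k ≈ 0#
  binomial-> {zero}  (s≤s _)         = refl
  binomial-> {suc N} {suc k} (s≤s N<k) = begin
    binomial N k + q^ (+ suc k) * binomial N (suc k)
      ≈⟨ +-cong (binomial-> N<k) (*-congˡ (binomial-> (ℕ.m<n⇒m<1+n N<k))) ⟩
    0# + q^ (+ suc k) * 0#  ≈⟨ +-identityˡ _ ⟩
    q^ (+ suc k) * 0#       ≈⟨ zeroʳ _ ⟩
    0#                      ∎

  binomial-diagonal : ∀ N → binomial N N ≈ 1#
  binomial-diagonal zero    = refl
  binomial-diagonal (suc N) = begin
    binomial N N + q^ (+ suc N) * binomial N (suc N)
      ≈⟨ +-cong (binomial-diagonal N) (*-congˡ (binomial-> (ℕ.n<1+n N))) ⟩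
    1# + q^ (+ suc N) * 0#  ≈⟨ +-congˡ (zeroʳ _) ⟩
    1# + 0#                 ≈⟨ +-identityʳ _ ⟩
    1#                      ∎

  -- These absorption identities take the place of division and are proved by mutual induction on
  -- `N`. The difference `N - k` is an integer, so the first also covers k ≥ N, where both sides
  -- vanish.
  binomial-sucʳ : ∀ N k → binomial N (suc k) * [ + suc k ] ≈ binomial N k * [ + N ℤ.- + k ]
  binomial-sucˡʳ : ∀ N k → binomial (suc N) (suc k) * [ + suc k ] ≈ binomial N k * [ + suc N ]

  binomial-sucʳ zero    zero    = trans (zeroˡ _) (sym (trans (*-identityˡ _) [0]))
  binomial-sucʳ zero    (suc k) = trans (zeroˡ _) (sym (zeroˡ _))
  binomial-sucʳ (suc N) zero    = begin
    binomial (suc N) 1 * [ + 1 ]    ≈⟨ binomial-sucˡʳ N 0 ⟩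
    1# * [ + suc N ]                ≈⟨ *-congˡ ([]-≡ (≡.sym (ℤ.+-identityʳ (+ suc N)))) ⟩
    1# * [ + suc N ℤ.- + 0 ]        ∎
  binomial-sucʳ (suc N) (suc k) = begin
    binomial (suc N) (2 ℕ.+ k) * [ + (2 ℕ.+ k) ]  ≈⟨ binomial-sucˡʳ N (suc k) ⟩
    B * [ + suc N ]
      ≈⟨ *-congˡ ([]-≡ (IntegerLemmas.suc-rearrange N k)) ⟨
    B * [ + suc k ℤ.+ (+ N ℤ.- + k) ]
      ≈⟨ *-congˡ ([]-+ (+ suc k) (+ N ℤ.- + k)) ⟨
    B * ([ + suc k ] + Q * [ + N ℤ.- + k ])
      ≈⟨ solve 4 (λ b s q t → b :* (s :+ q :* t) := b :* s :+ q :* b :* t) refl B [ + suc k ] Q [ + N ℤ.- + k ] ⟩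
    B * [ + suc k ] + Q * B * [ + N ℤ.- + k ]
      ≈⟨ +-congʳ (binomial-sucʳ N k) ⟩
    binomial N k * [ + N ℤ.- + k ] + Q * B * [ + N ℤ.- + k ]
      ≈⟨ distribʳ _ _ _ ⟨
    binomial (suc N) (suc k) * [ + N ℤ.- + k ]
      ≈⟨ *-congˡ ([]-≡ (IntegerLemmas.suc-suc N k)) ⟨
    binomial (suc N) (suc k) * [ + suc N ℤ.- + suc k ] ∎
    where
    B = binomial N (suc k)
    Q = q^ (+ suc k)

  binomial-sucˡʳ N k = begin
    (b + Q * B) * [ + suc k ]
      ≈⟨ solve 4 (λ b q b′ s → (b :+ q :* b′) :* s := b :* s :+ q :* (b′ :* s)) refl b Q B [ + suc k ] ⟩
    b * [ + suc k ] + Q * (B * [ + suc k ])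
      ≈⟨ +-congˡ (*-congˡ (binomial-sucʳ N k)) ⟩
    b * [ + suc k ] + Q * (b * [ + N ℤ.- + k ])
      ≈⟨ solve 4 (λ b q s t → b :* s :+ q :* (b :* t) := b :* (s :+ q :* t)) refl b Q [ + suc k ] [ + N ℤ.- + k ] ⟩
    b * ([ + suc k ] + Q * [ + N ℤ.- + k ])
      ≈⟨ *-congˡ ([]-+ (+ suc k) (+ N ℤ.- + k)) ⟩
    b * [ + suc k ℤ.+ (+ N ℤ.- + k) ]
      ≈⟨ *-congˡ ([]-≡ (IntegerLemmas.suc-rearrange N k)) ⟩
    b * [ + suc N ] ∎
    where
    b = binomial N k
    B = binomial N (suc k)
    Q = q^ (+ suc k)

  factorial : ℕ → Carrier
  factorial zero    = 1#
  factorial (suc k) = factorial k * [ + suc k ]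

  -- pairs k c is the product of [k-i][k+1+i] over 1 ≤ i ≤ c, whose factors are
  -- exchanged, up to units, by k ↦ -1 - k.
  pairs : ℤ → ℕ → Carrier
  pairs κ zero    = 1#
  pairs κ (suc c) = pairs κ c * ([ κ ℤ.- + suc c ] * [ κ ℤ.+ + (2 ℕ.+ c) ])

  -- One absorption step in each binomial multiplies by `[k-c]` and `[k+c+3]`, which is the next
  -- pair of `pairs (+ suc k)`. The denominators are collected in the square of `factorial c`, which
  -- does not depend on k.
  binomial²-factorial² : ∀ k c →
    binomial k c * binomial (2 ℕ.+ k ℕ.+ c) c * (factorial c * factorial c) ≈ pairs (+ suc k) c
  binomial²-factorial² k zero    =
    solve 0 (con 1 :* con 1 :* (con 1 :* con 1) := con 1) refl
  binomial²-factorial² k (suc c) = begin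
    B′ * binomial (2 ℕ.+ k ℕ.+ suc c) (suc c) * (f * s * (f * s))
      ≡⟨ ≡.cong (λ z → B′ * binomial z (suc c) * (f * s * (f * s))) (ℕ.+-suc (2 ℕ.+ k) c) ⟩
    B′ * A′ * (f * s * (f * s))
      ≈⟨ solve 4 (λ b a f s → b :* a :* (f :* s :* (f :* s)) := (b :* s) :* (a :* s) :* (f :* f)) refl B′ A′ f s ⟩
    (B′ * s) * (A′ * s) * (f * f)
      ≈⟨ *-congʳ (*-cong (binomial-sucʳ k c) (binomial-sucˡʳ (2 ℕ.+ k ℕ.+ c) c)) ⟩
    (B * t) * (A * u) * (f * f)
      ≈⟨ solve 5 (λ b t a u f → (b :* t) :* (a :* u) :* (f :* f) := b :* a :* (f :* f) :* (t :* u)) refl B t A u f ⟩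
    B * A * (f * f) * (t * u)
      ≈⟨ *-cong (binomial²-factorial² k c) (*-cong ([]-≡ (≡.sym (IntegerLemmas.suc-suc k c))) ([]-≡ (≡.cong +_ (lem k c)))) ⟩
    pairs (+ suc k) (suc c) ∎
    where
    B  = binomial k c
    B′ = binomial k (suc c)
    A  = binomial (2 ℕ.+ k ℕ.+ c) c
    A′ = binomial (3 ℕ.+ k ℕ.+ c) (suc c)
    f  = factorial c
    s  = [ + suc c ]
    t  = [ + k ℤ.- + c ]
    u  = [ + (3 ℕ.+ k ℕ.+ c) ]
    lem : ∀ k c → 3 ℕ.+ k ℕ.+ c ≡ suc k ℕ.+ (2 ℕ.+ c)
    lem k c = ≡.cong suc (≡.sym (≡.trans (ℕ.+-suc k (suc c)) (≡.cong suc (ℕ.+-suc k c))))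

  -- After multiplication by `[c+1]`, both products in `narayana` are the same pair of binomials
  -- times a q-integer: `[k+2]` in the first and `[k+1]` in the second. Their difference is q^(k+1)
  -- `[1]`. The factor `[1]` stays, since `IsQNumbers` does not determine its value.
  narayana-pairs : ∀ k c →
    narayana (suc k) (suc c) * ([ + suc c ] * (factorial c * factorial c))
      ≈ q^ (+ suc k) * [ + 1 ] * pairs (+ suc k) c
  narayana-pairs k c = begin
    (B * A′ - B′ * A) * (s * f²)           ≈⟨ *-assoc _ s f² ⟨
    (B * A′ - B′ * A) * s * f²             ≈⟨ *-congʳ ([y-z]x≈yx-zx s (B * A′) (B′ * A)) ⟩
    (B * A′ * s - B′ * A * s) * f²         ≈⟨ *-congʳ (+-cong e₁ (-‿cong e₂)) ⟩
    (B * A * (k₁ + Q * [ + 1 ]) - B * A * k₁) * f²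
      ≈⟨ *-congʳ (x[y-z]≈xy-xz (B * A) (k₁ + Q * [ + 1 ]) k₁) ⟨
    B * A * (k₁ + Q * [ + 1 ] - k₁) * f²   ≈⟨ *-congʳ (*-congˡ cancel) ⟩
    B * A * (Q * [ + 1 ]) * f²
      ≈⟨ solve 4 (λ b a q f → b :* a :* q :* f := q :* (b :* a :* f)) refl B A (Q * [ + 1 ]) f² ⟩
    Q * [ + 1 ] * (B * A * f²)             ≈⟨ *-congˡ (trans (*-congʳ (*-congˡ A≈)) (binomial²-factorial² k c)) ⟩
    Q * [ + 1 ] * pairs (+ suc k) c        ∎
    where
    B  = binomial k c
    B′ = binomial (suc k) (suc c)
    A  = binomial (suc k ℕ.+ suc c) c
    A′ = binomial (suc k ℕ.+ suc c) (suc c)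
    s  = [ + suc c ]
    f² = factorial c * factorial c
    Q  = q^ (+ suc k)
    k₁ = [ + suc k ]
    A≈ : A ≈ binomial (2 ℕ.+ k ℕ.+ c) c
    A≈ = reflexive (≡.cong (λ z → binomial (suc z) c) (ℕ.+-suc k c))
    lem : ∀ k c → (+ 1 ℤ.+ k ℤ.+ (+ 1 ℤ.+ c)) ℤ.- c ≡ (+ 1 ℤ.+ k) ℤ.+ + 1
    lem = solve-∀
    e₁ : B * A′ * s ≈ B * A * (k₁ + Q * [ + 1 ])
    e₁ = begin
      B * A′ * s                ≈⟨ *-assoc B A′ s ⟩
      B * (A′ * s)              ≈⟨ *-congˡ (binomial-sucʳ (suc k ℕ.+ suc c) c) ⟩
      B * (A * [ + (suc k ℕ.+ suc c) ℤ.- + c ]) ≈⟨ *-assoc B A _ ⟨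
      B * A * [ + (suc k ℕ.+ suc c) ℤ.- + c ]
        ≈⟨ *-congˡ ([]-≡ (lem (+ k) (+ c))) ⟩
      B * A * [ + suc k ℤ.+ + 1 ] ≈⟨ *-congˡ ([]-+ (+ suc k) (+ 1)) ⟨
      B * A * (k₁ + Q * [ + 1 ]) ∎
    e₂ : B′ * A * s ≈ B * A * k₁
    e₂ = begin
      B′ * A * s    ≈⟨ solve 3 (λ b a s → b :* a :* s := (b :* s) :* a) refl B′ A s ⟩
      B′ * s * A    ≈⟨ *-congʳ (binomial-sucˡʳ k c) ⟩
      B * k₁ * A    ≈⟨ solve 3 (λ b a s → (b :* s) :* a := b :* a :* s) refl B A k₁ ⟩
      B * A * k₁    ∎
    cancel : k₁ + Q * [ + 1 ] - k₁ ≈ Q * [ + 1 ]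
    cancel = begin
      k₁ + Q * [ + 1 ] - k₁    ≈⟨ +-congʳ (+-comm k₁ _) ⟩
      Q * [ + 1 ] + k₁ - k₁    ≈⟨ +-assoc _ k₁ (- k₁) ⟩
      Q * [ + 1 ] + (k₁ - k₁)  ≈⟨ +-congˡ (-‿inverseʳ k₁) ⟩
      Q * [ + 1 ] + 0#         ≈⟨ +-identityʳ _ ⟩
      Q * [ + 1 ]              ∎

  -- Under κ ↦ -1 - κ the factor `[κ-i]` becomes `[-(κ+1+i)]`, and `[κ+1+i]` becomes `[-(κ-i)]`. The
  -- two signs cancel, and each pair yields the unit q^(-(2κ+1)), independent of i.
  pairs-reflect : ∀ κ c →
    pairs (ℤ.- (+ 1 ℤ.+ κ)) c ≈ q^ (ℤ.- ((+ 2 ℤ.* κ ℤ.+ + 1) ℤ.* + c)) * pairs κ c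
  pairs-reflect κ zero    = sym (begin
    q^ (ℤ.- ((+ 2 ℤ.* κ ℤ.+ + 1) ℤ.* + 0)) * 1# ≈⟨ *-identityʳ _ ⟩
    q^ (ℤ.- ((+ 2 ℤ.* κ ℤ.+ + 1) ℤ.* + 0))      ≈⟨ q^-≡ (≡.cong ℤ.-_ (ℤ.*-zeroʳ (+ 2 ℤ.* κ ℤ.+ + 1))) ⟩
    q^ (+ 0)                                    ≈⟨ q^0 ⟩
    1#                                          ∎)
  pairs-reflect κ (suc c) = begin
    pairs (ℤ.- (+ 1 ℤ.+ κ)) c * ([ ℤ.- (+ 1 ℤ.+ κ) ℤ.- + suc c ] * [ ℤ.- (+ 1 ℤ.+ κ) ℤ.+ + (2 ℕ.+ c) ])
      ≈⟨ *-cong (pairs-reflect κ c) (*-cong ([]-≡ (e₁ κ (+ c))) ([]-≡ (e₂ κ (+ c)))) ⟩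
    Q * p * ([ ℤ.- u ] * [ ℤ.- t ])
      ≈⟨ *-congˡ (*-cong ([]-neg u) ([]-neg t)) ⟩
    Q * p * (- (q^ (ℤ.- u) * [ u ]) * - (q^ (ℤ.- t) * [ t ]))
      ≈⟨ *-congˡ (neg*neg _ _) ⟩
    Q * p * ((q^ (ℤ.- u) * [ u ]) * (q^ (ℤ.- t) * [ t ]))
      ≈⟨ solve 6 (λ Q p a u b t → Q :* p :* ((a :* u) :* (b :* t)) := Q :* (a :* b) :* (p :* (t :* u)))
           refl Q p (q^ (ℤ.- u)) [ u ] (q^ (ℤ.- t)) [ t ] ⟩
    Q * (q^ (ℤ.- u) * q^ (ℤ.- t)) * (p * ([ t ] * [ u ]))
      ≈⟨ *-congʳ (trans (*-congˡ (q^-+ (ℤ.- u) (ℤ.- t))) (trans (q^-+ _ _) (q^-≡ (e₃ κ (+ c))))) ⟩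
    q^ (ℤ.- ((+ 2 ℤ.* κ ℤ.+ + 1) ℤ.* + suc c)) * pairs κ (suc c) ∎
    where
    Q = q^ (ℤ.- ((+ 2 ℤ.* κ ℤ.+ + 1) ℤ.* + c))
    p = pairs κ c
    t = κ ℤ.- + suc c
    u = κ ℤ.+ + (2 ℕ.+ c)
    e₁ : ∀ κ c → ℤ.- (+ 1 ℤ.+ κ) ℤ.- (+ 1 ℤ.+ c) ≡ ℤ.- (κ ℤ.+ (+ 2 ℤ.+ c))
    e₁ = solve-∀
    e₂ : ∀ κ c → ℤ.- (+ 1 ℤ.+ κ) ℤ.+ (+ 2 ℤ.+ c) ≡ ℤ.- (κ ℤ.- (+ 1 ℤ.+ c))
    e₂ = solve-∀
    e₃ : ∀ κ c → ℤ.- ((+ 2 ℤ.* κ ℤ.+ + 1) ℤ.* c) ℤ.+ (ℤ.- (κ ℤ.+ (+ 2 ℤ.+ c)) ℤ.+ ℤ.- (κ ℤ.- (+ 1 ℤ.+ c)))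
       ≡ ℤ.- ((+ 2 ℤ.* κ ℤ.+ + 1) ℤ.* (+ 1 ℤ.+ c))
    e₃ = solve-∀

-- Finite sums and products over initial segments

module RangeProperties (M : CommutativeMonoid 0ℓ 0ℓ) where

  open CommutativeMonoid M
  open import Algebra.Properties.CommutativeMonoid.Sum M
    using (sum; sum-cong-≋; sum-replicate-zero; sum-permute) renaming (∑-distrib-+ to sum-∙)

  -- Over a commutative monoid, so that `∑[ i < n ]` and `∏[ i < n ]` are both instances by
  -- unfolding.
  range : ℕ → (ℕ → Carrier) → Carrier
  range n f = sum {n} (f ∘ toℕ)

  range-cong : ∀ n {f g} → (∀ {i} → i < n → f i ≈ g i) → range n f ≈ range n g
  range-cong n e = sum-cong-≋ {n} λ i → e (toℕ<n i)

  range-ε : ∀ n {f} → (∀ {i} → i < n → f i ≈ ε) → range n f ≈ ε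
  range-ε n e = trans (range-cong n e) (sum-replicate-zero n)

  range-∙ : ∀ n f g → range n (λ i → f i ∙ g i) ≈ range n f ∙ range n g
  range-∙ n f g = sum-∙ {n} (f ∘ toℕ) (g ∘ toℕ)

  range-+ : ∀ m n f → range (m ℕ.+ n) f ≈ range m f ∙ range n (λ i → f (m ℕ.+ i))
  range-+ zero    n f = sym (identityˡ _)
  range-+ (suc m) n f = trans (∙-congˡ (range-+ m n (f ∘ suc))) (sym (assoc _ _ _))

  range-reverse : ∀ n f → range n f ≈ range n (λ i → f (n ℕ.∸ suc i))
  range-reverse n f = trans (sum-permute {n} {n} (f ∘ toℕ) reverse)
    (sum-cong-≋ {n} λ i → reflexive (≡.cong f (opposite-prop i)))

  range-blocks : ∀ A d f → (∀ a → range d (λ i → f (i ℕ.+ a ℕ.* d)) ≈ ε) → range (A ℕ.* d) f ≈ ε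
  range-blocks zero    d f e = refl
  range-blocks (suc A) d f e = trans (range-+ d (A ℕ.* d) f)
    (trans (∙-cong
      (trans (range-cong d λ {i} _ → reflexive (≡.cong f (≡.sym (ℕ.+-identityʳ i)))) (e 0))
      (range-blocks A d (λ i → f (d ℕ.+ i)) λ a →
        trans (range-cong d λ {i} _ → reflexive (≡.cong f (lem i a))) (e (suc a))))
    (identityˡ ε))
    where
    lem : ∀ i a → d ℕ.+ (i ℕ.+ a ℕ.* d) ≡ i ℕ.+ (d ℕ.+ a ℕ.* d)
    lem i a = ≡.trans (≡.sym (ℕ.+-assoc d i (a ℕ.* d)))
      (≡.trans (≡.cong (ℕ._+ a ℕ.* d) (ℕ.+-comm d i)) (ℕ.+-assoc i d (a ℕ.* d)))

-- Rising factorials modulo d and the balance of exponents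

rising-sucˡ : ∀ y N → rising y (suc N) ≡ y ℕ.* rising (suc y) N
rising-sucˡ y zero    =
  ≡.trans (ℕ.*-identityˡ _) (≡.trans (ℕ.+-identityʳ y) (≡.sym (ℕ.*-identityʳ y)))
rising-sucˡ y (suc N) = ≡.trans (≡.cong₂ ℕ._*_ (rising-sucˡ y N) (ℕ.+-suc y N)) (ℕ.*-assoc y _ _)

rising-factor : ∀ y N {i} → i < N → ∃ λ c → rising y N ≡ c ℕ.* (y ℕ.+ i)
rising-factor y (suc N) {i} (s≤s i≤N) with ℕ.m≤n⇒m<n∨m≡n i≤N
... | inj₂ ≡.refl = rising y N , ≡.refl
... | inj₁ i<N    with rising-factor y N i<N
...   | c , e = (y ℕ.+ N) ℕ.* c , ≡.trans (≡.cong (ℕ._* (y ℕ.+ N)) e) (lem c (y ℕ.+ i) (y ℕ.+ N))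
  where
  lem : ∀ c a b → c ℕ.* a ℕ.* b ≡ b ℕ.* c ℕ.* a
  lem = ℕ-Solver.solve-∀

sign : ℕ → ℤ
sign N = (ℤ.- + 1) ℤ.^ N

sign² : ∀ N → sign N ℤ.* sign N ≡ + 1
sign² zero    = ≡.refl
sign² (suc N) = ≡.trans (lem (sign N)) (sign² N)
  where
  lem : ∀ s → (ℤ.- + 1) ℤ.* s ℤ.* ((ℤ.- + 1) ℤ.* s) ≡ s ℤ.* s
  lem = solve-∀

-- Modulo d the hypothesis reads y + i ≡ -(z + (N-1-i)): the factors of one rising factorial are the
-- negatives of those of the other, in reverse order. The induction therefore matches the last
-- factor on the side of `y` with the first on the side of `z`.
rising-reflect : ∀ d N y z u → + (y ℕ.+ z ℕ.+ N) ≡ + 1 ℤ.+ u ℤ.* d →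
  ∃ λ t → + rising y N ≡ sign N ℤ.* + rising z N ℤ.+ t ℤ.* d
rising-reflect d zero    y z u e = + 0 , ≡.sym (≡.cong (λ t → + 1 ℤ.+ t) (ℤ.*-zeroˡ d))
rising-reflect d (suc N) y z u e with
  rising-reflect d N y (suc z) u (≡.trans (≡.cong +_ (lem y z N)) e)
  where
  lem : ∀ y z N → y ℕ.+ suc z ℕ.+ N ≡ y ℕ.+ z ℕ.+ suc N
  lem = ℕ-Solver.solve-∀
... | t , e′ = t ℤ.* (ℤ.- + z) ℤ.+ s ℤ.* R ℤ.* u ℤ.+ t ℤ.* u ℤ.* d , (begin
  + (rising y N ℕ.* (y ℕ.+ N))                    ≡⟨ ℤ.pos-* (rising y N) (y ℕ.+ N) ⟩
  + rising y N ℤ.* + (y ℕ.+ N)                    ≡⟨ ≡.cong₂ ℤ._*_ e′ y+N ⟩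
  (s ℤ.* R ℤ.+ t ℤ.* d) ℤ.* (ℤ.- + z ℤ.+ u ℤ.* d) ≡⟨ expand s R t d (+ z) u ⟩
  (ℤ.- + 1) ℤ.* s ℤ.* (+ z ℤ.* R) ℤ.+ (t ℤ.* (ℤ.- + z) ℤ.+ s ℤ.* R ℤ.* u ℤ.+ t ℤ.* u ℤ.* d) ℤ.* d
    ≡⟨ ≡.cong (λ r → (ℤ.- + 1) ℤ.* s ℤ.* r ℤ.+ (t ℤ.* (ℤ.- + z) ℤ.+ s ℤ.* R ℤ.* u ℤ.+ t ℤ.* u ℤ.* d) ℤ.* d)
         (≡.trans (≡.sym (ℤ.pos-* z _)) (≡.cong +_ (≡.sym (rising-sucˡ z N)))) ⟩
  sign (suc N) ℤ.* + rising z (suc N) ℤ.+ (t ℤ.* (ℤ.- + z) ℤ.+ s ℤ.* R ℤ.* u ℤ.+ t ℤ.* u ℤ.* d) ℤ.* d ∎)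
  where
  open ≡.≡-Reasoning
  s = sign N
  R = + rising (suc z) N
  expand : ∀ s R t d z u → (s ℤ.* R ℤ.+ t ℤ.* d) ℤ.* (ℤ.- z ℤ.+ u ℤ.* d)
    ≡ (ℤ.- + 1) ℤ.* s ℤ.* (z ℤ.* R) ℤ.+ (t ℤ.* (ℤ.- z) ℤ.+ s ℤ.* R ℤ.* u ℤ.+ t ℤ.* u ℤ.* d) ℤ.* d
  expand = solve-∀
  solve-y : ∀ y z N → y ℤ.+ N ≡ (y ℤ.+ z ℤ.+ (+ 1 ℤ.+ N)) ℤ.+ (ℤ.- + 1 ℤ.- z)
  solve-y = solve-∀
  cancel-1 : ∀ z w → (+ 1 ℤ.+ w) ℤ.+ (ℤ.- + 1 ℤ.- z) ≡ ℤ.- z ℤ.+ w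
  cancel-1 = solve-∀
  y+N : + (y ℕ.+ N) ≡ ℤ.- + z ℤ.+ u ℤ.* d
  y+N = ≡.trans (solve-y (+ y) (+ z) (+ N))
    (≡.trans (≡.cong (ℤ._+ (ℤ.- + 1 ℤ.- + z)) e) (cancel-1 (+ z) (u ℤ.* d)))

private
  complement₁ : ∀ k k′ β → k′ ℕ.+ (k ℕ.+ β ℕ.+ 1) ℕ.+ β ≡ 1 ℕ.+ (k ℕ.+ k′ ℕ.+ 2 ℕ.* β)
  complement₁ = ℕ-Solver.solve-∀
  complement₂ : ∀ k k′ β → k′ ℕ.+ β ℕ.+ 1 ℕ.+ k ℕ.+ β ≡ 1 ℕ.+ (k ℕ.+ k′ ℕ.+ 2 ℕ.* β)
  complement₂ = ℕ-Solver.solve-∀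

-- The factors correspond crosswise: (k′)_β to (k+β+1)_β, and (k′+β+1)_β to (k)_β. The sign (-1)^β
-- thus occurs twice. A congruence of integers is what is wanted, because at a root of unity of
-- order d the value `[N]` depends only on N modulo d.
rising²-reflect : ∀ d β k k′ u → + (k ℕ.+ k′ ℕ.+ 2 ℕ.* β) ≡ u ℤ.* d →
  ∃ λ t → + (rising k′ β ℕ.* rising (k′ ℕ.+ β ℕ.+ 1) β)
        ≡ + (rising k β ℕ.* rising (k ℕ.+ β ℕ.+ 1) β) ℤ.+ t ℤ.* d
rising²-reflect d β k k′ u e
  with t₁ , e₁ ← rising-reflect d β k′ (k ℕ.+ β ℕ.+ 1) u
         (≡.trans (≡.cong +_ (complement₁ k k′ β)) (≡.cong (λ z → + 1 ℤ.+ z) e))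
     | t₂ , e₂ ← rising-reflect d β (k′ ℕ.+ β ℕ.+ 1) k u
         (≡.trans (≡.cong +_ (complement₂ k k′ β)) (≡.cong (λ z → + 1 ℤ.+ z) e))
     = T , (begin
  + (rising k′ β ℕ.* rising (k′ ℕ.+ β ℕ.+ 1) β)      ≡⟨ ℤ.pos-* (rising k′ β) _ ⟩
  + rising k′ β ℤ.* + rising (k′ ℕ.+ β ℕ.+ 1) β      ≡⟨ ≡.cong₂ ℤ._*_ e₁ e₂ ⟩
  (s ℤ.* B ℤ.+ t₁ ℤ.* d) ℤ.* (s ℤ.* A ℤ.+ t₂ ℤ.* d)  ≡⟨ expand s A B t₁ t₂ d ⟩
  s ℤ.* s ℤ.* (A ℤ.* B) ℤ.+ T ℤ.* d                  ≡⟨ ≡.cong (λ z → z ℤ.* (A ℤ.* B) ℤ.+ T ℤ.* d) (sign² β) ⟩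
  + 1 ℤ.* (A ℤ.* B) ℤ.+ T ℤ.* d                      ≡⟨ ≡.cong (ℤ._+ T ℤ.* d) (≡.trans (ℤ.*-identityˡ _) (≡.sym (ℤ.pos-* (rising k β) _))) ⟩
  + (rising k β ℕ.* rising (k ℕ.+ β ℕ.+ 1) β) ℤ.+ T ℤ.* d ∎)
  where
  open ≡.≡-Reasoning
  s = sign β
  A = + rising k β
  B = + rising (k ℕ.+ β ℕ.+ 1) β
  T = s ℤ.* B ℤ.* t₂ ℤ.+ t₁ ℤ.* s ℤ.* A ℤ.+ t₁ ℤ.* t₂ ℤ.* d
  expand : ∀ s A B t₁ t₂ d → (s ℤ.* B ℤ.+ t₁ ℤ.* d) ℤ.* (s ℤ.* A ℤ.+ t₂ ℤ.* d)
    ≡ s ℤ.* s ℤ.* (A ℤ.* B) ℤ.+ (s ℤ.* B ℤ.* t₂ ℤ.+ t₁ ℤ.* s ℤ.* A ℤ.+ t₁ ℤ.* t₂ ℤ.* d) ℤ.* d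
  expand = solve-∀

∸-second-half : ∀ {β i} → β < i → i ≤ 2 ℕ.* β → i ℕ.∸ suc β < β
∸-second-half {β} {i} β<i i≤2β = ℕ.+-cancelˡ-< β (i ℕ.∸ suc β) β (≡.subst₂ _≤_
  (≡.sym (ℕ.m+[n∸m]≡n β<i)) (≡.cong (β ℕ.+_) (ℕ.+-identityʳ β)) i≤2β)

-- Here b = 2β, and the three summands on the left come from `[2(k+β)]`, from the explicit power of
-- q at `k′`, and from the weights. The first and the third add up to -(2k+b)(bαm+1), so everything
-- differs from the exponent at `k` by -(k+k′+b)(bαm+1).
exponent-balance : ∀ n b k k′ α m u d → k ℤ.+ k′ ℤ.+ b ≡ u ℤ.* d →
  ℤ.- (+ 2 ℤ.* k ℤ.+ b) ℤ.+ (n ℤ.- b ℤ.- k′) ℤ.* (b ℤ.* α ℤ.* m ℤ.+ + 1)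
    ℤ.+ ℤ.- (α ℤ.* m ℤ.* (b ℤ.* (+ 2 ℤ.* k ℤ.+ b)))
  ≡ (n ℤ.- b ℤ.- k) ℤ.* (b ℤ.* α ℤ.* m ℤ.+ + 1) ℤ.+ (ℤ.- u ℤ.* (b ℤ.* α ℤ.* m ℤ.+ + 1)) ℤ.* d
exponent-balance n b k k′ α m u d e = ≡.trans (collect n b k k′ α m)
  (≡.trans (≡.cong (λ z → (n ℤ.- b ℤ.- k) ℤ.* (b ℤ.* α ℤ.* m ℤ.+ + 1) ℤ.+ ℤ.- z ℤ.* (b ℤ.* α ℤ.* m ℤ.+ + 1)) e)
    (commute (b ℤ.* α ℤ.* m ℤ.+ + 1) ((n ℤ.- b ℤ.- k) ℤ.* (b ℤ.* α ℤ.* m ℤ.+ + 1)) u d))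
  where
  collect : ∀ n b k k′ α m →
    ℤ.- (+ 2 ℤ.* k ℤ.+ b) ℤ.+ (n ℤ.- b ℤ.- k′) ℤ.* (b ℤ.* α ℤ.* m ℤ.+ + 1)
      ℤ.+ ℤ.- (α ℤ.* m ℤ.* (b ℤ.* (+ 2 ℤ.* k ℤ.+ b)))
    ≡ (n ℤ.- b ℤ.- k) ℤ.* (b ℤ.* α ℤ.* m ℤ.+ + 1) ℤ.+ ℤ.- (k ℤ.+ k′ ℤ.+ b) ℤ.* (b ℤ.* α ℤ.* m ℤ.+ + 1)
  collect = solve-∀
  commute : ∀ E f u d → f ℤ.+ ℤ.- (u ℤ.* d) ℤ.* E ≡ f ℤ.+ (ℤ.- u ℤ.* E) ℤ.* d
  commute = solve-∀

-- Arithmetic at a primitive root of unity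

-- q behaves as a primitive root of unity of order p + 1.
record IsPrimitiveRoot
  (R : CommutativeRing 0ℓ 0ℓ) (q^ [_] : ℤ → CommutativeRing.Carrier R) (p : ℕ) : Set where
  open CommutativeRing R
  field
    isQNumbers : IsQNumbers R q^ [_]
    q^d≈1      : q^ (+ suc p) ≈ 1#
    [d]≈0      : [ + suc p ] ≈ 0#
    []-cancel  : ∀ {s} → suc s < suc p → ∀ c → c * [ + suc s ] ≈ 0# → c ≈ 0#
    2-cancel   : ∀ c → c + c ≈ 0# → c ≈ 0#

module PrimitiveRoot
  (R : CommutativeRing 0ℓ 0ℓ) (q^ [_] : ℤ → CommutativeRing.Carrier R) (p : ℕ)
  (isPrimitiveRoot : IsPrimitiveRoot R q^ [_] p)
  where

  open CommutativeRing R hiding (zero)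
  open RangeOperators R
  open IsPrimitiveRoot isPrimitiveRoot
  open QBinomials R q^ [_]
  open QNumberProperties R q^ [_] isQNumbers
  open import Algebra.Definitions.RawSemiring (Semiring.rawSemiring semiring) using (_^_)
  open import Algebra.Properties.Ring ring
    using (x[y-z]≈xy-xz; [y-z]x≈yx-zx; x≈y⇒x∙y⁻¹≈ε; x∙y⁻¹≈ε⇒x≈y; -0#≈0#; -‿distribˡ-*; -‿distribʳ-*)
  open import Algebra.Properties.CommutativeSemiring.Exp commutativeSemiring
    using (^-distrib-*; ^-congˡ)
  open import Algebra.Solver.Ring.NaturalCoefficients.Default commutativeSemiring
    using (solve; _:+_; _:*_; _:=_)
  open import Relation.Binary.Reasoning.Setoid setoid

  module Sum     = RangeProperties +-commutativeMonoid
  module Product = RangeProperties *-commutativeMonoid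
  open import Algebra.Properties.Semiring.Sum semiring using (*-distribˡ-sum)

  d : ℕ
  d = suc p

  0^ : ∀ {n} → n > 0 → 0# ^ n ≈ 0#
  0^ (s≤s _) = zeroˡ _

  q^-mod : ∀ {i} j t → i ≡ j ℤ.+ t ℤ.* + d → q^ i ≈ q^ j
  q^-mod {i} j t e = begin
    q^ i                  ≈⟨ q^-≡ e ⟩
    q^ (j ℤ.+ t ℤ.* + d)  ≈⟨ q^-+ j _ ⟨
    q^ j * q^ (t ℤ.* + d) ≈⟨ *-congˡ (q^-*≈1 q^d≈1 t) ⟩
    q^ j * 1#             ≈⟨ *-identityʳ _ ⟩
    q^ j                  ∎

  []-d*⁺ : ∀ n → [ + n ℤ.* + d ] ≈ 0#
  []-d*⁺ zero    = [0]
  []-d*⁺ (suc n) = begin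
    [ + suc n ℤ.* + d ]                      ≈⟨ []-≡ (ℤ.suc-* (+ n) (+ d)) ⟩
    [ + d ℤ.+ + n ℤ.* + d ]                  ≈⟨ []-+ (+ d) _ ⟨
    [ + d ] + q^ (+ d) * [ + n ℤ.* + d ]     ≈⟨ +-cong [d]≈0 (*-congˡ ([]-d*⁺ n)) ⟩
    0# + q^ (+ d) * 0#                       ≈⟨ +-identityˡ _ ⟩
    q^ (+ d) * 0#                            ≈⟨ zeroʳ _ ⟩
    0#                                       ∎

  []-d* : ∀ t → [ t ℤ.* + d ] ≈ 0#
  []-d* (+ n)    = []-d*⁺ n
  []-d* -[1+ n ] = begin
    [ ℤ.- i ]                 ≈⟨ []-neg i ⟩
    - (q^ (ℤ.- i) * [ i ])    ≈⟨ -‿cong (*-congˡ ([]-d*⁺ (suc n))) ⟩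
    - (q^ (ℤ.- i) * 0#)       ≈⟨ -‿cong (zeroʳ _) ⟩
    - 0#                      ≈⟨ -0#≈0# ⟩
    0#                        ∎
    where i = + suc n ℤ.* + d

  []-mod : ∀ {i} j t → i ≡ j ℤ.+ t ℤ.* + d → [ i ] ≈ [ j ]
  []-mod {i} j t e = begin
    [ i ]                          ≈⟨ []-≡ e ⟩
    [ j ℤ.+ t ℤ.* + d ]            ≈⟨ []-+ j _ ⟨
    [ j ] + q^ j * [ t ℤ.* + d ]   ≈⟨ +-congˡ (trans (*-congˡ ([]-d* t)) (zeroʳ _)) ⟩
    [ j ] + 0#                     ≈⟨ +-identityʳ _ ⟩
    [ j ]                          ∎

  []-cancelʳ : ∀ {s} → suc s < d → ∀ {a b} → a * [ + suc s ] ≈ b * [ + suc s ] → a ≈ b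
  []-cancelʳ s<d {a} {b} e = x∙y⁻¹≈ε⇒x≈y a b ([]-cancel s<d (a - b)
    (trans ([y-z]x≈yx-zx _ a b) (x≈y⇒x∙y⁻¹≈ε e)))

  factorial-cancelʳ : ∀ c → c < d → ∀ {a b} → a * factorial c ≈ b * factorial c → a ≈ b
  factorial-cancelʳ zero    _   e = trans (sym (*-identityʳ _)) (trans e (*-identityʳ _))
  factorial-cancelʳ (suc c) c<d e = factorial-cancelʳ c (ℕ.<-trans (ℕ.n<1+n c) c<d)
    ([]-cancelʳ c<d (trans (*-assoc _ _ _) (trans e (sym (*-assoc _ _ _)))))

  -- q-binomial coefficients at a root of unity

  binomial-d : ∀ {k} → suc k < d → binomial d (suc k) ≈ 0#
  binomial-d {k} k<d = []-cancel k<d _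
    (trans (binomial-sucˡʳ p k) (trans (*-congˡ [d]≈0) (zeroʳ _)))

  -- Row d of the triangle is 1, 0, ..., 0, 1. In the columns below d, Pascal's recursion started
  -- from this row sees only the first 1 and reproduces the original triangle.
  binomial-shift-< : ∀ N {k} → k < d → binomial (N ℕ.+ d) k ≈ binomial N k
  binomial-shift-< N       {zero}  _   = refl
  binomial-shift-< zero    {suc k} k<d = binomial-d k<d
  binomial-shift-< (suc N) {suc k} k<d = +-cong
    (binomial-shift-< N (ℕ.<-trans (ℕ.n<1+n k) k<d))
    (*-congˡ (binomial-shift-< N k<d))

  -- From row d on, the triangle is the superposition of two copies of itself, grown from the 1 in
  -- column 0 and the 1 in column d. The second copy obeys the same recursion because qᵈ = 1.
  binomial-shift-≥ : ∀ N k →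
    binomial (N ℕ.+ d) (k ℕ.+ d) ≈ binomial N (k ℕ.+ d) + binomial N k
  binomial-shift-≥ zero    zero    = trans (binomial-diagonal d) (sym (+-identityˡ _))
  binomial-shift-≥ zero    (suc k) =
    trans (binomial-> (s≤s (ℕ.m≤n+m d k))) (sym (+-identityˡ _))
  binomial-shift-≥ (suc N) zero    = begin
    binomial (N ℕ.+ d) p + q^ (+ d) * binomial (N ℕ.+ d) d
      ≈⟨ +-cong (binomial-shift-< N (ℕ.n<1+n p)) (*-congˡ (binomial-shift-≥ N 0)) ⟩
    b + q^ (+ d) * (B + 1#)
      ≈⟨ +-congˡ (distribˡ _ _ _) ⟩
    b + (q^ (+ d) * B + q^ (+ d) * 1#)
      ≈⟨ +-congˡ (+-congˡ (trans (*-congʳ q^d≈1) (*-identityˡ _))) ⟩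
    b + (q^ (+ d) * B + 1#)
      ≈⟨ +-assoc _ _ _ ⟨
    b + q^ (+ d) * B + 1# ∎
    where
    b = binomial N p
    B = binomial N d
  binomial-shift-≥ (suc N) (suc k) = begin
    binomial (N ℕ.+ d) (k ℕ.+ d) + Q′ * binomial (N ℕ.+ d) (suc k ℕ.+ d)
      ≈⟨ +-cong (binomial-shift-≥ N k) (*-congˡ (binomial-shift-≥ N (suc k))) ⟩
    (A + a) + Q′ * (B + b)
      ≈⟨ solve 5 (λ A a Q B b → (A :+ a) :+ Q :* (B :+ b) := (A :+ Q :* B) :+ (a :+ Q :* b)) refl A a Q′ B b ⟩
    (A + Q′ * B) + (a + Q′ * b)
      ≈⟨ +-congˡ (+-congˡ (*-congʳ (q^-mod (+ suc k) (+ 1) (lem (+ suc k) (+ d))))) ⟩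
    (A + Q′ * B) + (a + q^ (+ suc k) * b) ∎
    where
    A  = binomial N (k ℕ.+ d)
    a  = binomial N k
    B  = binomial N (suc k ℕ.+ d)
    b  = binomial N (suc k)
    Q′ = q^ (+ (suc k ℕ.+ d))
    lem : ∀ k d → k ℤ.+ d ≡ k ℤ.+ + 1 ℤ.* d
    lem = solve-∀

  private
    shift-suc : ∀ l a → l ℕ.+ suc a ℕ.* d ≡ l ℕ.+ a ℕ.* d ℕ.+ d
    shift-suc l a = ≡.trans (≡.cong (l ℕ.+_) (ℕ.+-comm d (a ℕ.* d))) (≡.sym (ℕ.+-assoc l (a ℕ.* d) d))

  -- The q-Lucas theorem, with binomial (a * d) (b * d) in place of the ordinary
  -- binomial coefficient to which it is equal here.
  lucas : ∀ a b {l s} → l < d → s < d →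
    binomial (l ℕ.+ a ℕ.* d) (s ℕ.+ b ℕ.* d) ≈ binomial (a ℕ.* d) (b ℕ.* d) * binomial l s
  lucas zero    zero    {l} {s} l<d s<d = trans
    (reflexive (≡.cong₂ binomial (ℕ.+-identityʳ l) (ℕ.+-identityʳ s))) (sym (*-identityˡ _))
  lucas zero    (suc b) {l} {s} l<d s<d = trans
    (binomial-> (ℕ.<-≤-trans (≡.subst (_< d) (≡.sym (ℕ.+-identityʳ l)) l<d)
      (ℕ.≤-trans (ℕ.m≤m+n d (b ℕ.* d)) (ℕ.m≤n+m _ s)))) (sym (zeroˡ _))
  lucas (suc a) zero    {l} {s} l<d s<d = begin
    binomial (l ℕ.+ suc a ℕ.* d) (s ℕ.+ 0)
      ≡⟨ ≡.cong (λ z → binomial z (s ℕ.+ 0)) (shift-suc l a) ⟩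
    binomial (l ℕ.+ a ℕ.* d ℕ.+ d) (s ℕ.+ 0)
      ≈⟨ binomial-shift-< (l ℕ.+ a ℕ.* d) (≡.subst (_< d) (≡.sym (ℕ.+-identityʳ s)) s<d) ⟩
    binomial (l ℕ.+ a ℕ.* d) (s ℕ.+ 0)
      ≈⟨ lucas a zero l<d s<d ⟩
    1# * binomial l s ∎
  lucas (suc a) (suc b) {l} {s} l<d s<d = begin
    binomial (l ℕ.+ suc a ℕ.* d) (s ℕ.+ suc b ℕ.* d)
      ≡⟨ ≡.cong₂ binomial (shift-suc l a) (shift-suc s b) ⟩
    binomial (l ℕ.+ a ℕ.* d ℕ.+ d) (s ℕ.+ b ℕ.* d ℕ.+ d)
      ≈⟨ binomial-shift-≥ (l ℕ.+ a ℕ.* d) (s ℕ.+ b ℕ.* d) ⟩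
    binomial (l ℕ.+ a ℕ.* d) (s ℕ.+ b ℕ.* d ℕ.+ d) + binomial (l ℕ.+ a ℕ.* d) (s ℕ.+ b ℕ.* d)
      ≡⟨ ≡.cong (λ z → binomial (l ℕ.+ a ℕ.* d) z + binomial (l ℕ.+ a ℕ.* d) (s ℕ.+ b ℕ.* d)) (shift-suc s b) ⟨
    binomial (l ℕ.+ a ℕ.* d) (s ℕ.+ suc b ℕ.* d) + binomial (l ℕ.+ a ℕ.* d) (s ℕ.+ b ℕ.* d)
      ≈⟨ +-cong (lucas a (suc b) l<d s<d) (lucas a b l<d s<d) ⟩
    binomial (a ℕ.* d) (suc b ℕ.* d) * binomial l s + binomial (a ℕ.* d) (b ℕ.* d) * binomial l s
      ≈⟨ distribʳ _ _ _ ⟨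
    (binomial (a ℕ.* d) (suc b ℕ.* d) + binomial (a ℕ.* d) (b ℕ.* d)) * binomial l s
      ≡⟨ ≡.cong (λ z → (binomial (a ℕ.* d) z + binomial (a ℕ.* d) (b ℕ.* d)) * binomial l s) (shift-suc 0 b) ⟩
    (binomial (a ℕ.* d) (b ℕ.* d ℕ.+ d) + binomial (a ℕ.* d) (b ℕ.* d)) * binomial l s
      ≈⟨ *-congʳ (binomial-shift-≥ (a ℕ.* d) (b ℕ.* d)) ⟨
    binomial (a ℕ.* d ℕ.+ d) (b ℕ.* d ℕ.+ d) * binomial l s
      ≡⟨ ≡.cong₂ (λ y z → binomial y z * binomial l s) (shift-suc 0 a) (shift-suc 0 b) ⟨
    binomial (suc a ℕ.* d) (suc b ℕ.* d) * binomial l s ∎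

  -- If l + s carries, both sides vanish.
  lucas-carry : ∀ c b {l s u} → l < p → u < d → u ≤ s → s ≤ suc u →
    binomial (l ℕ.+ s ℕ.+ c ℕ.* d) (u ℕ.+ b ℕ.* d) ≈ binomial (c ℕ.* d) (b ℕ.* d) * binomial (l ℕ.+ s) u
  lucas-carry c b {l} {s} {u} l<p u<d u≤s s≤1+u with ℕ.<-≤-connex (l ℕ.+ s) d
  ... | inj₁ l+s<d = lucas c b l+s<d u<d
  ... | inj₂ d≤l+s = begin
    binomial (l ℕ.+ s ℕ.+ c ℕ.* d) (u ℕ.+ b ℕ.* d)
      ≡⟨ ≡.cong (λ z → binomial z (u ℕ.+ b ℕ.* d)) (≡.trans (≡.cong (ℕ._+ c ℕ.* d) (≡.sym t+d)) (ℕ.+-assoc t d (c ℕ.* d))) ⟩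
    binomial (t ℕ.+ suc c ℕ.* d) (u ℕ.+ b ℕ.* d)
      ≈⟨ lucas (suc c) b (ℕ.<-trans t<u u<d) u<d ⟩
    binomial (suc c ℕ.* d) (b ℕ.* d) * binomial t u
      ≈⟨ trans (*-congˡ (binomial-> t<u)) (zeroʳ _) ⟩
    0#
      ≈⟨ trans (*-congˡ (trans (binomial-shift-< t u<d) (binomial-> t<u))) (zeroʳ _) ⟨
    binomial (c ℕ.* d) (b ℕ.* d) * binomial (t ℕ.+ d) u
      ≡⟨ ≡.cong (λ z → binomial (c ℕ.* d) (b ℕ.* d) * binomial z u) t+d ⟩
    binomial (c ℕ.* d) (b ℕ.* d) * binomial (l ℕ.+ s) u ∎
    where
    t = l ℕ.+ s ℕ.∸ d
    t+d : t ℕ.+ d ≡ l ℕ.+ s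
    t+d = ℕ.m∸n+n≡m d≤l+s
    t<u : t < u
    t<u = ℕ.+-cancelʳ-< d t u (ℕ.≤-<-trans (ℕ.≤-reflexive t+d) (ℕ.≤-<-trans (ℕ.+-monoʳ-≤ l s≤1+u)
      (≡.subst₂ _<_ (≡.sym (ℕ.+-suc l u)) (ℕ.+-comm d u) (ℕ.+-monoˡ-< u (s≤s l<p)))))

  -- Periodicity and reflection of the coefficients

  private
    collect-*d : ∀ l a s b d → l ℕ.+ a ℕ.* d ℕ.+ (s ℕ.+ b ℕ.* d) ≡ l ℕ.+ s ℕ.+ (a ℕ.+ b) ℕ.* d
    collect-*d = ℕ-Solver.solve-∀

  -- The residues `suc l` and `suc s` are positive, so passing to k - 1 and j - 1 borrows nothing,
  -- and both products acquire the same factor. That factor depends only on `a` and `b`, hence is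
  -- shared by a residue of k and its mirror image. The sum k + j may carry, whence `lucas-carry`.
  narayana-lucas : ∀ a b {l s} → suc l < p → suc s < d →
    narayana (suc l ℕ.+ a ℕ.* d) (suc s ℕ.+ b ℕ.* d)
      ≈ binomial (a ℕ.* d) (b ℕ.* d) * binomial ((a ℕ.+ b) ℕ.* d) (b ℕ.* d) * narayana (suc l) (suc s)
  narayana-lucas a b {l} {s} l<p s<d = begin
    narayana (suc l ℕ.+ a ℕ.* d) (suc s ℕ.+ b ℕ.* d)
      ≡⟨ ≡.cong (λ z → B₁ * binomial z (suc s ℕ.+ b ℕ.* d) - B₂ * binomial z (s ℕ.+ b ℕ.* d))
           (collect-*d (suc l) a (suc s) b d) ⟩
    B₁ * binomial N (suc s ℕ.+ b ℕ.* d) - B₂ * binomial N (s ℕ.+ b ℕ.* d)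
      ≈⟨ +-cong
           (*-cong (lucas a b (ℕ.<-trans (ℕ.n<1+n l) l<d) s<d′) (lucas-carry (a ℕ.+ b) b l<p s<d ℕ.≤-refl (ℕ.n≤1+n _)))
           (-‿cong (*-cong (lucas a b l<d s<d) (lucas-carry (a ℕ.+ b) b l<p s<d′ (ℕ.n≤1+n s) ℕ.≤-refl))) ⟩
    (Λ * b₁) * (M * c₁) - (Λ * b₂) * (M * c₂)
      ≈⟨ +-cong (regroup* b₁ c₁) (-‿cong (regroup* b₂ c₂)) ⟩
    Λ * M * (b₁ * c₁) - Λ * M * (b₂ * c₂)
      ≈⟨ x[y-z]≈xy-xz (Λ * M) (b₁ * c₁) (b₂ * c₂) ⟨
    Λ * M * narayana (suc l) (suc s) ∎
    where
    s<d′ = ℕ.<-trans (ℕ.n<1+n s) s<d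
    l<d  = ℕ.<-trans l<p (ℕ.n<1+n p)
    N  = suc l ℕ.+ suc s ℕ.+ (a ℕ.+ b) ℕ.* d
    B₁ = binomial (l ℕ.+ a ℕ.* d) (s ℕ.+ b ℕ.* d)
    B₂ = binomial (suc l ℕ.+ a ℕ.* d) (suc s ℕ.+ b ℕ.* d)
    Λ  = binomial (a ℕ.* d) (b ℕ.* d)
    M  = binomial ((a ℕ.+ b) ℕ.* d) (b ℕ.* d)
    b₁ = binomial l s
    b₂ = binomial (suc l) (suc s)
    c₁ = binomial (suc l ℕ.+ suc s) (suc s)
    c₂ = binomial (suc l ℕ.+ suc s) s
    regroup* : ∀ b c → (Λ * b) * (M * c) ≈ Λ * M * (b * c)
    regroup* b c = solve 4 (λ Λ M b c → (Λ :* b) :* (M :* c) := Λ :* M :* (b :* c)) refl Λ M b c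

  -- The last digit of j - 1 in base d is `p`. It exceeds the last digit `l` of k - 1 and the last
  -- digit `suc l` of k + j, so the q-Lucas theorem kills one factor in each product.
  narayana-d∣j : ∀ a b {l} → suc l < p → narayana (suc l ℕ.+ a ℕ.* d) (suc b ℕ.* d) ≈ 0#
  narayana-d∣j a b {l} l<p = begin
    B₁ * X - Y * binomial (suc l ℕ.+ a ℕ.* d ℕ.+ suc b ℕ.* d) (p ℕ.+ b ℕ.* d)
      ≈⟨ +-cong (trans (*-congʳ B₁≈0) (zeroˡ _)) (-‿cong (trans (*-congˡ B₂≈0) (zeroʳ _))) ⟩
    0# - 0#    ≈⟨ -‿inverseʳ 0# ⟩
    0#         ∎
    where
    p<d = ℕ.n<1+n p
    B₁ = binomial (l ℕ.+ a ℕ.* d) (p ℕ.+ b ℕ.* d)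
    X  = binomial (suc l ℕ.+ a ℕ.* d ℕ.+ suc b ℕ.* d) (suc b ℕ.* d)
    Y  = binomial (suc l ℕ.+ a ℕ.* d) (suc b ℕ.* d)
    l<p′ = ℕ.<-trans (ℕ.n<1+n l) l<p
    B₁≈0 : B₁ ≈ 0#
    B₁≈0 = trans (lucas a b (ℕ.<-trans l<p′ p<d) p<d) (trans (*-congˡ (binomial-> l<p′)) (zeroʳ _))
    B₂≈0 : binomial (suc l ℕ.+ a ℕ.* d ℕ.+ suc b ℕ.* d) (p ℕ.+ b ℕ.* d) ≈ 0#
    B₂≈0 = trans
      (reflexive (≡.cong (λ z → binomial z (p ℕ.+ b ℕ.* d))
        (≡.trans (ℕ.+-assoc (suc l) (a ℕ.* d) (suc b ℕ.* d))
          (≡.cong (suc l ℕ.+_) (≡.sym (ℕ.*-distribʳ-+ d a (suc b)))))))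
      (trans (lucas (a ℕ.+ suc b) b (ℕ.<-trans l<p p<d) p<d) (trans (*-congˡ (binomial-> l<p)) (zeroʳ _)))

  pairs-mod : ∀ {κ} κ′ t c → κ ≡ κ′ ℤ.+ t ℤ.* + d → pairs κ c ≈ pairs κ′ c
  pairs-mod {κ} κ′ t zero    e = refl
  pairs-mod {κ} κ′ t (suc c) e = *-cong (pairs-mod κ′ t c e)
    (*-cong ([]-mod _ t (≡.trans (≡.cong (ℤ._+ ℤ.- + suc c) e) (lem κ′ (t ℤ.* + d) (ℤ.- + suc c))))
            ([]-mod _ t (≡.trans (≡.cong (ℤ._+ + (2 ℕ.+ c)) e) (lem κ′ (t ℤ.* + d) (+ (2 ℕ.+ c))))))
    where
    lem : ∀ a b c → a ℤ.+ b ℤ.+ c ≡ a ℤ.+ c ℤ.+ b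
    lem = solve-∀

  -- Modulo d, `suc l′` is -1 - `suc l`, so `narayana-pairs` and `pairs-reflect` compare the two
  -- sides multiplied by `g`. This `g` does not involve l, and it is cancellable because all its
  -- q-integers have index at most c + 1 < d.
  narayana-reflect : ∀ {l l′ c} → suc l ℕ.+ suc l′ ≡ p → suc c < d →
    narayana (suc l′) (suc c) ≈ q^ (ℤ.- ((+ 2 ℤ.* + suc l ℤ.+ + 1) ℤ.* + suc c)) * narayana (suc l) (suc c)
  narayana-reflect {l} {l′} {c} e c<d = cancel (begin
    narayana (suc l′) (suc c) * g
      ≈⟨ narayana-pairs l′ c ⟩
    q^ (+ suc l′) * [ + 1 ] * pairs (+ suc l′) c
      ≈⟨ *-cong (*-congʳ (q^-mod (ℤ.- (+ 1 ℤ.+ + suc l)) (+ 1) l′≡)) (pairs-mod (ℤ.- (+ 1 ℤ.+ + suc l)) (+ 1) c l′≡) ⟩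
    q^ (ℤ.- (+ 1 ℤ.+ + suc l)) * [ + 1 ] * pairs (ℤ.- (+ 1 ℤ.+ + suc l)) c
      ≈⟨ *-congˡ (pairs-reflect (+ suc l) c) ⟩
    q^ (ℤ.- (+ 1 ℤ.+ + suc l)) * [ + 1 ] * (Q * P)
      ≈⟨ solve 4 (λ a o Q P → a :* o :* (Q :* P) := (a :* Q) :* (o :* P)) refl (q^ (ℤ.- (+ 1 ℤ.+ + suc l))) [ + 1 ] Q P ⟩
    (q^ (ℤ.- (+ 1 ℤ.+ + suc l)) * Q) * ([ + 1 ] * P)
      ≈⟨ *-congʳ (trans (q^-+ _ _) (trans (q^-≡ (exponent (+ suc l) (+ c))) (sym (q^-+ _ _)))) ⟩
    (Q′ * q^ (+ suc l)) * ([ + 1 ] * P)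
      ≈⟨ solve 4 (λ a o Q P → (Q :* a) :* (o :* P) := Q :* (a :* o :* P)) refl (q^ (+ suc l)) [ + 1 ] Q′ P ⟩
    Q′ * (q^ (+ suc l) * [ + 1 ] * P)
      ≈⟨ *-congˡ (narayana-pairs l c) ⟨
    Q′ * (narayana (suc l) (suc c) * g)
      ≈⟨ *-assoc _ _ _ ⟨
    Q′ * narayana (suc l) (suc c) * g ∎)
    where
    g  = [ + suc c ] * (factorial c * factorial c)
    Q  = q^ (ℤ.- ((+ 2 ℤ.* + suc l ℤ.+ + 1) ℤ.* + c))
    Q′ = q^ (ℤ.- ((+ 2 ℤ.* + suc l ℤ.+ + 1) ℤ.* + suc c))
    P  = pairs (+ suc l) c
    c<d′ = ℕ.<-trans (ℕ.n<1+n c) c<d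
    cancel : ∀ {a b} → a * g ≈ b * g → a ≈ b
    cancel {a} {b} h = []-cancelʳ c<d (factorial-cancelʳ c c<d′ (factorial-cancelʳ c c<d′
      (trans (regroup* a) (trans h (sym (regroup* b))))))
      where
      regroup* : ∀ a → a * [ + suc c ] * factorial c * factorial c ≈ a * g
      regroup* a = solve 3 (λ a s f → a :* s :* f :* f := a :* (s :* (f :* f))) refl a [ + suc c ] (factorial c)
    exponent : ∀ l c → ℤ.- (+ 1 ℤ.+ l) ℤ.+ ℤ.- ((+ 2 ℤ.* l ℤ.+ + 1) ℤ.* c)
      ≡ ℤ.- ((+ 2 ℤ.* l ℤ.+ + 1) ℤ.* (+ 1 ℤ.+ c)) ℤ.+ l
    exponent = solve-∀
    lem : ∀ l l′ → l′ ≡ ℤ.- (+ 1 ℤ.+ l) ℤ.+ + 1 ℤ.* (+ 1 ℤ.+ (l ℤ.+ l′))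
    lem = solve-∀
    l′≡ : + suc l′ ≡ ℤ.- (+ 1 ℤ.+ + suc l) ℤ.+ + 1 ℤ.* + d
    l′≡ = ≡.trans (lem (+ suc l) (+ suc l′)) (≡.cong (λ z → ℤ.- (+ 1 ℤ.+ + suc l) ℤ.+ + 1 ℤ.* (+ suc z)) e)

  twisted : ℕ → ℕ → Carrier
  twisted k j = q^ (twist k j) * narayana k j

  twisted-^ : ∀ α k j → q^ (+ α ℤ.* twist k j) * narayana k j ^ α ≈ twisted k j ^ α
  twisted-^ α k j = trans (*-congʳ (sym (q^-^ (twist k j) α))) (sym (^-distrib-* _ _ α))

  -- The unit on the right is free of j, which is the purpose of `twist`. When d divides the second
  -- index both sides are 0; otherwise both share the Lucas factor `Λ`, and the residues are
  -- reflected.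
  twisted-reflect : ∀ a {l l′} → suc l ℕ.+ suc l′ ≡ p → ∀ j →
    twisted (suc l′ ℕ.+ a ℕ.* d) (suc j)
      ≈ q^ (ℤ.- (+ 2 ℤ.* + (suc l ℕ.+ a ℕ.* d) ℤ.+ + 1)) * twisted (suc l ℕ.+ a ℕ.* d) (suc j)
  twisted-reflect a {l} {l′} e j = go (suc j % d) (suc j / d) (m%n<n (suc j) d) (m≡m%n+[m/n]*n (suc j) d)
    where
    k  = suc l ℕ.+ a ℕ.* d
    k′ = suc l′ ℕ.+ a ℕ.* d
    l<p : suc l < p
    l<p = ≡.subst (suc l <_) e (ℕ.m<m+n (suc l) (s≤s z≤n))
    l′<p : suc l′ < p
    l′<p = ≡.subst (suc l′ <_) e (ℕ.m<n+m (suc l′) (s≤s z≤n))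
    go : ∀ s b → s < d → suc j ≡ s ℕ.+ b ℕ.* d →
      twisted k′ (suc j) ≈ q^ (ℤ.- (+ 2 ℤ.* + k ℤ.+ + 1)) * twisted k (suc j)
    go zero    (suc b) _   h = begin
      q^ (twist k′ (suc j)) * narayana k′ (suc j)
        ≈⟨ trans (*-congˡ (vanish l′<p)) (zeroʳ _) ⟩
      0#
        ≈⟨ trans (*-congˡ (trans (*-congˡ (vanish l<p)) (zeroʳ _))) (zeroʳ _) ⟨
      q^ (ℤ.- (+ 2 ℤ.* + k ℤ.+ + 1)) * twisted k (suc j) ∎
      where
      vanish : ∀ {l} → suc l < p → narayana (suc l ℕ.+ a ℕ.* d) (suc j) ≈ 0#
      vanish {l} l<p = trans (reflexive (≡.cong (narayana (suc l ℕ.+ a ℕ.* d)) h)) (narayana-d∣j a b l<p)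
    go (suc s) b       s<d h = begin
      q^ (twist k′ (suc j)) * narayana k′ (suc j)
        ≈⟨ *-congˡ (trans (split l′<p) (*-congˡ (narayana-reflect e s<d))) ⟩
      q^ (twist k′ (suc j)) * (Λ * (Q * narayana (suc l) (suc s)))
        ≈⟨ solve 4 (λ t Λ Q n → t :* (Λ :* (Q :* n)) := (t :* Q) :* (Λ :* n)) refl
             (q^ (twist k′ (suc j))) Λ Q (narayana (suc l) (suc s)) ⟩
      (q^ (twist k′ (suc j)) * Q) * (Λ * narayana (suc l) (suc s))
        ≈⟨ *-cong (trans (q^-+ _ _) (trans (q^-mod _ T exponent) (sym (q^-+ _ _)))) (sym (split l<p)) ⟩
      (Q′ * q^ (twist k (suc j))) * narayana k (suc j)
        ≈⟨ *-assoc _ _ _ ⟩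
      Q′ * twisted k (suc j) ∎
      where
      Λ  = binomial (a ℕ.* d) (b ℕ.* d) * binomial ((a ℕ.+ b) ℕ.* d) (b ℕ.* d)
      Q  = q^ (ℤ.- ((+ 2 ℤ.* + suc l ℤ.+ + 1) ℤ.* + suc s))
      Q′ = q^ (ℤ.- (+ 2 ℤ.* + k ℤ.+ + 1))
      split : ∀ {l} → suc l < p → narayana (suc l ℕ.+ a ℕ.* d) (suc j) ≈ Λ * narayana (suc l) (suc s)
      split {l} l<p = trans (reflexive (≡.cong (narayana (suc l ℕ.+ a ℕ.* d)) h)) (narayana-lucas a b l<p s<d)
      -- `T` is the discrepancy between the two exponents divided by d, after `k`, `k′` and `j` are
      -- expressed through their residues. The triangular number in `twist` occurs on both sides and
      -- cancels.
      T = (+ 2 ℤ.* + suc l ℤ.+ + 1) ℤ.* + b ℤ.- + j ℤ.+ + 2 ℤ.* + a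
      identity : ∀ c l a b s δ →
        (c ℤ.- (+ 1 ℤ.+ (δ ℤ.- + 1 ℤ.- l ℤ.+ a ℤ.* δ)) ℤ.* (s ℤ.+ b ℤ.* δ ℤ.- + 1)) ℤ.+ ℤ.- ((+ 2 ℤ.* l ℤ.+ + 1) ℤ.* s)
        ≡ (ℤ.- (+ 2 ℤ.* (l ℤ.+ a ℤ.* δ) ℤ.+ + 1) ℤ.+ (c ℤ.- (+ 1 ℤ.+ (l ℤ.+ a ℤ.* δ)) ℤ.* (s ℤ.+ b ℤ.* δ ℤ.- + 1)))
          ℤ.+ ((+ 2 ℤ.* l ℤ.+ + 1) ℤ.* b ℤ.- (s ℤ.+ b ℤ.* δ ℤ.- + 1) ℤ.+ + 2 ℤ.* a) ℤ.* δ
      identity = solve-∀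
      substituted : ∀ c l a b s δ {κ κ′ j} →
        κ ≡ l ℤ.+ a ℤ.* δ → κ′ ≡ δ ℤ.- + 1 ℤ.- l ℤ.+ a ℤ.* δ → j ≡ s ℤ.+ b ℤ.* δ ℤ.- + 1 →
        (c ℤ.- (+ 1 ℤ.+ κ′) ℤ.* j) ℤ.+ ℤ.- ((+ 2 ℤ.* l ℤ.+ + 1) ℤ.* s)
        ≡ (ℤ.- (+ 2 ℤ.* κ ℤ.+ + 1) ℤ.+ (c ℤ.- (+ 1 ℤ.+ κ) ℤ.* j))
          ℤ.+ ((+ 2 ℤ.* l ℤ.+ + 1) ℤ.* b ℤ.- j ℤ.+ + 2 ℤ.* a) ℤ.* δ
      substituted c l a b s δ ≡.refl ≡.refl ≡.refl = identity c l a b s δ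
      pos-+* : ∀ l a → + (l ℕ.+ a ℕ.* d) ≡ + l ℤ.+ + a ℤ.* + d
      pos-+* l a = ≡.cong (λ z → + l ℤ.+ z) (ℤ.pos-* a d)
      complement : ∀ l l′ → l′ ≡ (+ 1 ℤ.+ (l ℤ.+ l′)) ℤ.- + 1 ℤ.- l
      complement = solve-∀
      predecessor : ∀ j → j ≡ (+ 1 ℤ.+ j) ℤ.- + 1
      predecessor = solve-∀
      l′≡ : + suc l′ ≡ + d ℤ.- + 1 ℤ.- + suc l
      l′≡ = ≡.trans (complement (+ suc l) (+ suc l′)) (≡.cong (λ z → + suc z ℤ.- + 1 ℤ.- + suc l) e)
      exponent : twist k′ (suc j) ℤ.+ ℤ.- ((+ 2 ℤ.* + suc l ℤ.+ + 1) ℤ.* + suc s)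
        ≡ (ℤ.- (+ 2 ℤ.* + k ℤ.+ + 1) ℤ.+ twist k (suc j)) ℤ.+ T ℤ.* + d
      exponent = ≡.trans
        (≡.cong (λ z → + (suc (suc j) C 2) ℤ.- z ℤ.+ ℤ.- ((+ 2 ℤ.* + suc l ℤ.+ + 1) ℤ.* + suc s)) (ℤ.pos-* (suc k′) j))
        (≡.trans
          (substituted (+ (suc (suc j) C 2)) (+ suc l) (+ a) (+ b) (+ suc s) (+ d) (pos-+* (suc l) a)
            (≡.trans (pos-+* (suc l′) a) (≡.cong (ℤ._+ + a ℤ.* + d) l′≡))
            (≡.trans (predecessor (+ j)) (≡.cong (ℤ._- + 1) (≡.trans (≡.cong +_ h) (pos-+* (suc s) b)))))
          (≡.cong (λ z → ℤ.- (+ 2 ℤ.* + k ℤ.+ + 1) ℤ.+ (+ (suc (suc j) C 2) ℤ.- z) ℤ.+ T ℤ.* + d)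
            (≡.sym (ℤ.pos-* (suc k) j))))

  narayana-> : ∀ {k j} → suc k < suc j → narayana (suc k) (suc j) ≈ 0#
  narayana-> {k} {j} (s≤s k<j) = begin
    binomial k j * binomial (suc k ℕ.+ suc j) (suc j) - binomial (suc k) (suc j) * binomial (suc k ℕ.+ suc j) j
      ≈⟨ +-cong (trans (*-congʳ (binomial-> k<j)) (zeroˡ _))
                (-‿cong (trans (*-congʳ (binomial-> (s≤s k<j))) (zeroˡ _))) ⟩
    0# - 0#   ≈⟨ -‿inverseʳ 0# ⟩
    0#        ∎

  -- Reflection of the weights

  module _ (x : Carrier) where

    -- The weights at `k` and at its mirror image have different numbers of terms; padding gives
    -- both the length k + k′. The added terms vanish because `narayana` does for j > k and α > 0.
    weight-extend : ∀ {α} → α > 0 → ∀ k t →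
      weight x α (suc k) ≈ ∑[ j < suc k ℕ.+ t ] twisted (suc k) (suc j) ^ α * x ^ j
    weight-extend {α} α>0 k t = begin
      weight x α (suc k)
        ≈⟨ Sum.range-cong (suc k) (λ {j} _ → *-congʳ {x ^ j} (twisted-^ α (suc k) (suc j))) ⟩
      (∑[ j < suc k ] f j)
        ≈⟨ +-identityʳ _ ⟨
      (∑[ j < suc k ] f j) + 0#
        ≈⟨ +-congˡ (Sum.range-ε t (λ {j} _ → vanish (ℕ.m≤m+n (suc k) j))) ⟨
      (∑[ j < suc k ] f j) + (∑[ j < t ] f (suc k ℕ.+ j))
        ≈⟨ Sum.range-+ (suc k) t f ⟨
      (∑[ j < suc k ℕ.+ t ] f j) ∎
      where
      f : ℕ → Carrier
      f j = twisted (suc k) (suc j) ^ α * x ^ j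
      vanish : ∀ {j} → suc k ≤ j → f j ≈ 0#
      vanish {j} k≤j = trans
        (*-congʳ (trans (^-congˡ α (trans (*-congˡ (narayana-> (s≤s k≤j))) (zeroʳ _))) (0^ α>0)))
        (zeroˡ _)

    weight-reflect : ∀ {α} → α > 0 → ∀ a {l l′} → suc l ℕ.+ suc l′ ≡ p →
      weight x α (suc l′ ℕ.+ a ℕ.* d)
        ≈ q^ (ℤ.- (+ 2 ℤ.* + (suc l ℕ.+ a ℕ.* d) ℤ.+ + 1)) ^ α * weight x α (suc l ℕ.+ a ℕ.* d)
    weight-reflect {α} α>0 a {l} {l′} e = begin
      weight x α k′
        ≈⟨ weight-extend α>0 (l′ ℕ.+ a ℕ.* d) k ⟩
      (∑[ j < k′ ℕ.+ k ] twisted k′ (suc j) ^ α * x ^ j)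
        ≈⟨ Sum.range-cong (k′ ℕ.+ k) (λ {j} _ → trans (*-congʳ {x ^ j}
             (trans (^-congˡ α (twisted-reflect a e j)) (^-distrib-* _ _ α))) (*-assoc _ _ _)) ⟩
      (∑[ j < k′ ℕ.+ k ] Q ^ α * (twisted k (suc j) ^ α * x ^ j))
        ≈⟨ *-distribˡ-sum {k′ ℕ.+ k} (Q ^ α) (λ j → twisted k (suc (toℕ j)) ^ α * x ^ toℕ j) ⟨
      Q ^ α * (∑[ j < k′ ℕ.+ k ] twisted k (suc j) ^ α * x ^ j)
        ≡⟨ ≡.cong (λ K → Q ^ α * (∑[ j < K ] twisted k (suc j) ^ α * x ^ j)) (ℕ.+-comm k′ k) ⟩
      Q ^ α * (∑[ j < k ℕ.+ k′ ] twisted k (suc j) ^ α * x ^ j)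
        ≈⟨ *-congˡ (weight-extend α>0 (l ℕ.+ a ℕ.* d) k′) ⟨
      Q ^ α * weight x α k ∎
      where
      k  = suc l ℕ.+ a ℕ.* d
      k′ = suc l′ ℕ.+ a ℕ.* d
      Q  = q^ (ℤ.- (+ 2 ℤ.* + k ℤ.+ + 1))

  []-multiple : ∀ {N} M → N ≡ M ℕ.* d → [ + N ] ≈ 0#
  []-multiple M e = trans ([]-≡ (≡.trans (≡.cong +_ e) (ℤ.pos-* M d))) ([]-d* (+ M))

  -- The c consecutive odd numbers from 2κ + 1 on have the sum c(2κ + c).
  ∏-q^ : ∀ α m κ c →
    (∏[ i < c ] (q^ (ℤ.- (+ 2 ℤ.* (κ ℤ.+ + i) ℤ.+ + 1)) ^ α) ^ m)
      ≈ q^ (ℤ.- (+ α ℤ.* + m ℤ.* (+ c ℤ.* (+ 2 ℤ.* κ ℤ.+ + c))))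
  ∏-q^ α m κ zero    = sym (trans (q^-≡ (lem (+ α) (+ m) κ)) q^0)
    where
    lem : ∀ α m κ → ℤ.- (α ℤ.* m ℤ.* (+ 0 ℤ.* (+ 2 ℤ.* κ ℤ.+ + 0))) ≡ + 0
    lem = solve-∀
  ∏-q^ α m κ (suc c) = begin
    (q^ (ℤ.- (+ 2 ℤ.* (κ ℤ.+ + 0) ℤ.+ + 1)) ^ α) ^ m
      * (∏[ i < c ] (q^ (ℤ.- (+ 2 ℤ.* (κ ℤ.+ + suc i) ℤ.+ + 1)) ^ α) ^ m)
      ≈⟨ *-cong
           (trans (^-congˡ m (q^-^ _ α)) (q^-^ _ m))
           (Product.range-cong c λ {i} _ → ^-congˡ m (^-congˡ α (q^-≡
             (≡.cong (λ z → ℤ.- (+ 2 ℤ.* z ℤ.+ + 1)) (≡.sym (ℤ.+-assoc κ (+ 1) (+ i))))))) ⟩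
    q^ (+ m ℤ.* (+ α ℤ.* ℤ.- (+ 2 ℤ.* (κ ℤ.+ + 0) ℤ.+ + 1)))
      * (∏[ i < c ] (q^ (ℤ.- (+ 2 ℤ.* (κ ℤ.+ + 1 ℤ.+ + i) ℤ.+ + 1)) ^ α) ^ m)
      ≈⟨ *-congˡ (∏-q^ α m (κ ℤ.+ + 1) c) ⟩
    q^ (+ m ℤ.* (+ α ℤ.* ℤ.- (+ 2 ℤ.* (κ ℤ.+ + 0) ℤ.+ + 1)))
      * q^ (ℤ.- (+ α ℤ.* + m ℤ.* (+ c ℤ.* (+ 2 ℤ.* (κ ℤ.+ + 1) ℤ.+ + c))))
      ≈⟨ trans (q^-+ _ _) (q^-≡ (lem (+ α) (+ m) κ (+ c))) ⟩
    q^ (ℤ.- (+ α ℤ.* + m ℤ.* (+ suc c ℤ.* (+ 2 ℤ.* κ ℤ.+ + suc c)))) ∎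
    where
    lem : ∀ α m κ c →
      m ℤ.* (α ℤ.* ℤ.- (+ 2 ℤ.* (κ ℤ.+ + 0) ℤ.+ + 1)) ℤ.+ ℤ.- (α ℤ.* m ℤ.* (c ℤ.* (+ 2 ℤ.* (κ ℤ.+ + 1) ℤ.+ c)))
      ≡ ℤ.- (α ℤ.* m ℤ.* ((+ 1 ℤ.+ c) ℤ.* (+ 2 ℤ.* κ ℤ.+ (+ 1 ℤ.+ c))))
    lem = solve-∀

  -- Vanishing and antisymmetry of the summands

  module _ (x : Carrier) {α : ℕ} (α>0 : α > 0) (β m n : ℕ) {r : ℕ} (r>0 : r > 0) where

    private
      size : ℕ → Carrier
      size k = [ + (rising k β ℕ.* rising (k ℕ.+ β ℕ.+ 1) β) ]
      centre : ℕ → ℤ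
      centre k = + (2 ℕ.* (k ℕ.+ β))
      exponent : ℕ → ℤ
      exponent k = (+ n ℤ.- + (2 ℕ.* β) ℤ.- + k) ℤ.* + (2 ℕ.* β ℕ.* α ℕ.* m ℕ.+ 1)
      weights : ℕ → Carrier
      weights k = ∏[ i < 2 ℕ.* β ] weight x α (k ℕ.+ i) ^ m

    size≈0⇒summand≈0 : ∀ k → size k ≈ 0# → summand x α β m n r k ≈ 0#
    size≈0⇒summand≈0 k h = trans (*-congʳ (trans (*-congʳ (trans (*-congʳ
      (trans (^-congˡ r h) (0^ r>0))) (zeroˡ _))) (zeroˡ _))) (zeroˡ _)

    -- The index i = β is covered by `[2(k+β)]`, smaller ones by the first rising factorial and
    -- larger ones by the second. For the remaining k, no k + i with i < 2β is congruent to 0 or -1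
    -- modulo d, and those are the residues that `weight-reflect` excludes.
    summand-vanish : ∀ k {i} t → i ≤ 2 ℕ.* β → k ℕ.+ i ≡ t ℕ.* d → summand x α β m n r k ≈ 0#
    summand-vanish k {i} t i≤2β e with ℕ.<-cmp i β
    ... | tri≈ _ ≡.refl _ = trans (*-congʳ (trans (*-congʳ (trans (*-congˡ
            ([]-multiple (2 ℕ.* t) (≡.trans (≡.cong (2 ℕ.*_) e) (≡.sym (ℕ.*-assoc 2 t d)))))
            (zeroʳ _))) (zeroˡ _))) (zeroˡ _)
    ... | tri< i<β _ _ with c , f ← rising-factor k β i<β =
      size≈0⇒summand≈0 k ([]-multiple (c ℕ.* t ℕ.* B)
        (≡.trans (≡.cong (ℕ._* B) (≡.trans f (≡.cong (c ℕ.*_) e))) (lem c t d B)))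
      where
      B = rising (k ℕ.+ β ℕ.+ 1) β
      lem : ∀ c t d B → c ℕ.* (t ℕ.* d) ℕ.* B ≡ c ℕ.* t ℕ.* B ℕ.* d
      lem = ℕ-Solver.solve-∀
    ... | tri> _ _ i>β with c , f ← rising-factor (k ℕ.+ β ℕ.+ 1) β (∸-second-half i>β i≤2β) =
      size≈0⇒summand≈0 k ([]-multiple (A ℕ.* (c ℕ.* t))
        (≡.trans (≡.cong (A ℕ.*_) (≡.trans f (≡.cong (c ℕ.*_) (≡.trans k+i e)))) (lem A c t d)))
      where
      A = rising k β
      split : suc β ℕ.+ (i ℕ.∸ suc β) ≡ i
      split = ℕ.m+[n∸m]≡n i>β
      k+i : k ℕ.+ β ℕ.+ 1 ℕ.+ (i ℕ.∸ suc β) ≡ k ℕ.+ i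
      k+i = ≡.trans (regroup k β (i ℕ.∸ suc β)) (≡.cong (k ℕ.+_) split)
        where
        regroup : ∀ k β j → k ℕ.+ β ℕ.+ 1 ℕ.+ j ≡ k ℕ.+ (1 ℕ.+ β ℕ.+ j)
        regroup = ℕ-Solver.solve-∀
      lem : ∀ A c t d → A ℕ.* (c ℕ.* (t ℕ.* d)) ≡ A ℕ.* (c ℕ.* t) ℕ.* d
      lem = ℕ-Solver.solve-∀

    module _ (a : ℕ) {l l′ : ℕ} (e : suc l ℕ.+ suc l′ ℕ.+ 2 ℕ.* β ≡ d) where

      private
        k k′ : ℕ
        k  = suc l ℕ.+ a ℕ.* d
        k′ = suc l′ ℕ.+ a ℕ.* d
        V : ℤ
        V = ℤ.- (+ α ℤ.* + m ℤ.* (+ (2 ℕ.* β) ℤ.* (+ 2 ℤ.* + k ℤ.+ + (2 ℕ.* β))))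
        k+k′+2β : + k ℤ.+ + k′ ℤ.+ + (2 ℕ.* β) ≡ (+ 1 ℤ.+ + 2 ℤ.* + a) ℤ.* + d
        k+k′+2β = ≡.trans (≡.cong +_ (≡.trans (regroup (suc l) (suc l′) (a ℕ.* d) (2 ℕ.* β)) (≡.cong (ℕ._+ 2 ℕ.* (a ℕ.* d)) e)))
          (≡.trans (≡.cong (λ z → + d ℤ.+ z) (≡.trans (ℤ.pos-* 2 (a ℕ.* d)) (≡.cong (λ z → + 2 ℤ.* z) (ℤ.pos-* a d))))
            (lem (+ d) (+ a)))
          where
          regroup : ∀ l l′ ad b → l ℕ.+ ad ℕ.+ (l′ ℕ.+ ad) ℕ.+ b ≡ l ℕ.+ l′ ℕ.+ b ℕ.+ 2 ℕ.* ad
          regroup = ℕ-Solver.solve-∀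
          lem : ∀ d a → d ℤ.+ + 2 ℤ.* (a ℤ.* d) ≡ (+ 1 ℤ.+ + 2 ℤ.* a) ℤ.* d
          lem = solve-∀

      size-reflect : size k′ ≈ size k
      size-reflect = []-mod (+ (rising k β ℕ.* rising (k ℕ.+ β ℕ.+ 1) β)) (proj₁ reflected) (proj₂ reflected)
        where reflected = rising²-reflect (+ d) β k k′ (+ 1 ℤ.+ + 2 ℤ.* + a) k+k′+2β

      centre-mod : centre k′ ≡ ℤ.- centre k ℤ.+ (+ 2 ℤ.* (+ 1 ℤ.+ + 2 ℤ.* + a)) ℤ.* + d
      centre-mod = begin-≡
        where
        lem : ∀ k k′ β → + 2 ℤ.* (k′ ℤ.+ β) ≡ ℤ.- (+ 2 ℤ.* (k ℤ.+ β)) ℤ.+ + 2 ℤ.* (k ℤ.+ k′ ℤ.+ + 2 ℤ.* β)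
        lem = solve-∀
        begin-≡ = ≡.trans (ℤ.pos-* 2 (k′ ℕ.+ β)) (≡.trans (lem (+ k) (+ k′) (+ β))
          (≡.cong₂ (λ y z → ℤ.- y ℤ.+ z) (≡.sym (ℤ.pos-* 2 (k ℕ.+ β)))
            (≡.trans (≡.cong (λ z → + 2 ℤ.* z) (≡.trans (≡.cong (λ z → + k ℤ.+ + k′ ℤ.+ z) (≡.sym (ℤ.pos-* 2 β))) k+k′+2β))
              (≡.sym (ℤ.*-assoc (+ 2) (+ 1 ℤ.+ + 2 ℤ.* + a) (+ d))))))

      -- The indices k + i and k′ + (2β-1-i) add up to -1 modulo d, so the product at `k′` is
      -- matched, read backwards, with the product at `k`.
      weights-reflect : weights k′ ≈ q^ V * weights k
      weights-reflect = begin
        weights k′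
          ≈⟨ Product.range-reverse (2 ℕ.* β) (λ i → weight x α (k′ ℕ.+ i) ^ m) ⟩
        (∏[ i < 2 ℕ.* β ] weight x α (k′ ℕ.+ (2 ℕ.* β ℕ.∸ suc i)) ^ m)
          ≈⟨ Product.range-cong (2 ℕ.* β)
               {λ i → weight x α (k′ ℕ.+ (2 ℕ.* β ℕ.∸ suc i)) ^ m} {λ i → (f i ^ α) ^ m * weight x α (k ℕ.+ i) ^ m}
               (λ {i} i<2β → trans (^-congˡ m (reflect i<2β)) (^-distrib-* (f i ^ α) (weight x α (k ℕ.+ i)) m)) ⟩
        (∏[ i < 2 ℕ.* β ] (f i ^ α) ^ m * weight x α (k ℕ.+ i) ^ m)
          ≈⟨ Product.range-∙ (2 ℕ.* β) (λ i → (f i ^ α) ^ m) (λ i → weight x α (k ℕ.+ i) ^ m) ⟩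
        (∏[ i < 2 ℕ.* β ] (f i ^ α) ^ m) * weights k
          ≈⟨ *-congʳ (∏-q^ α m (+ k) (2 ℕ.* β)) ⟩
        q^ V * weights k ∎
        where
        f : ℕ → Carrier
        f i = q^ (ℤ.- (+ 2 ℤ.* (+ k ℤ.+ + i) ℤ.+ + 1))
        shift : ∀ l a i → suc (l ℕ.+ i) ℕ.+ a ≡ suc l ℕ.+ a ℕ.+ i
        shift = ℕ-Solver.solve-∀
        reflect : ∀ {i} → i < 2 ℕ.* β →
          weight x α (k′ ℕ.+ (2 ℕ.* β ℕ.∸ suc i)) ≈ f i ^ α * weight x α (k ℕ.+ i)
        reflect {i} i<2β = ≡.subst₂
          (λ y z → weight x α y ≈ q^ (ℤ.- (+ 2 ℤ.* + z ℤ.+ + 1)) ^ α * weight x α z)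
          (shift l′ (a ℕ.* d) j) (shift l (a ℕ.* d) i)
          (weight-reflect x α>0 a {l ℕ.+ i} {l′ ℕ.+ j} (ℕ.suc-injective (≡.trans (regroup l l′ i j)
            (≡.trans (≡.cong (suc l ℕ.+ suc l′ ℕ.+_) (ℕ.m+[n∸m]≡n i<2β)) e))))
          where
          j = 2 ℕ.* β ℕ.∸ suc i
          regroup : ∀ l l′ i j → 1 ℕ.+ (1 ℕ.+ (l ℕ.+ i) ℕ.+ (1 ℕ.+ (l′ ℕ.+ j))) ≡ 1 ℕ.+ l ℕ.+ (1 ℕ.+ l′) ℕ.+ (1 ℕ.+ i ℕ.+ j)
          regroup = ℕ-Solver.solve-∀

      exponent-mod : ∃ λ t → ℤ.- centre k ℤ.+ exponent k′ ℤ.+ V ≡ exponent k ℤ.+ t ℤ.* + d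
      exponent-mod = T , ≡.trans
        (≡.cong₂ (λ y z → ℤ.- y ℤ.+ (+ n ℤ.- + (2 ℕ.* β) ℤ.- + k′) ℤ.* z ℤ.+ V) centre≡ E≡)
        (≡.trans
          (exponent-balance (+ n) (+ (2 ℕ.* β)) (+ k) (+ k′) (+ α) (+ m) (+ 1 ℤ.+ + 2 ℤ.* + a) (+ d) k+k′+2β)
          (≡.cong (λ z → (+ n ℤ.- + (2 ℕ.* β) ℤ.- + k) ℤ.* z ℤ.+ T ℤ.* + d) (≡.sym E≡)))
        where
        T = ℤ.- (+ 1 ℤ.+ + 2 ℤ.* + a) ℤ.* (+ (2 ℕ.* β) ℤ.* + α ℤ.* + m ℤ.+ + 1)
        centre≡ : centre k ≡ + 2 ℤ.* + k ℤ.+ + (2 ℕ.* β)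
        centre≡ = ≡.trans (≡.cong +_ (ℕ.*-distribˡ-+ 2 k β)) (≡.cong (ℤ._+ + (2 ℕ.* β)) (ℤ.pos-* 2 k))
        E≡ : + (2 ℕ.* β ℕ.* α ℕ.* m ℕ.+ 1) ≡ + (2 ℕ.* β) ℤ.* + α ℤ.* + m ℤ.+ + 1
        E≡ = ≡.cong (ℤ._+ + 1) (≡.trans (ℤ.pos-* (2 ℕ.* β ℕ.* α) m) (≡.cong (ℤ._* + m) (ℤ.pos-* (2 ℕ.* β) α)))

      -- The sign comes from `[2(k+β)]` alone, whose argument is negated modulo d. The powers of q
      -- recombine by `exponent-mod`.
      summand-antisym : summand x α β m n r k′ ≈ - summand x α β m n r k
      summand-antisym = begin
        size k′ ^ r * [ centre k′ ] * q^ (exponent k′) * weights k′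
          ≈⟨ *-cong (*-congʳ (*-cong (^-congˡ r size-reflect) centre-reflect)) weights-reflect ⟩
        S * (- (u * Z)) * E * (v * W)
          ≈⟨ *-congʳ (*-congʳ (-‿distribʳ-* S (u * Z))) ⟨
        - (S * (u * Z)) * E * (v * W)
          ≈⟨ *-congʳ (-‿distribˡ-* _ E) ⟨
        - (S * (u * Z) * E) * (v * W)
          ≈⟨ -‿distribˡ-* _ (v * W) ⟨
        - (S * (u * Z) * E * (v * W))
          ≈⟨ -‿cong (solve 6 (λ S u Z E v W → S :* (u :* Z) :* E :* (v :* W) := S :* Z :* (u :* E :* v) :* W)
               refl S u Z E v W) ⟩
        - (S * Z * (u * E * v) * W)
          ≈⟨ -‿cong (*-congʳ (*-congˡ (trans (trans (*-congʳ (q^-+ _ _)) (q^-+ _ _)) (q^-mod (exponent k) (proj₁ exponent-mod) (proj₂ exponent-mod))))) ⟩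
        - (S * Z * q^ (exponent k) * W) ∎
        where
        S = size k ^ r
        Z = [ centre k ]
        E = q^ (exponent k′)
        W = weights k
        u = q^ (ℤ.- centre k)
        v = q^ V
        centre-reflect : [ centre k′ ] ≈ - (u * Z)
        centre-reflect = trans ([]-mod (ℤ.- centre k) (+ 2 ℤ.* (+ 1 ℤ.+ + 2 ℤ.* + a)) centre-mod) ([]-neg (centre k))

    block-sum : ∀ a → (∑[ i < d ] summand x α β m n r (i ℕ.+ a ℕ.* d)) ≈ 0#
    block-sum a with ℕ.<-≤-connex (2 ℕ.* β) d
    -- The window k, ..., k + 2β is longer than d here, so every term vanishes; `d ∸ i` is the
    -- distance to the next multiple of d.
    ... | inj₂ d≤2β = Sum.range-ε d λ {i} i<d → summand-vanish (i ℕ.+ a ℕ.* d) {d ℕ.∸ i} (suc a)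
      (ℕ.≤-trans (ℕ.m∸n≤m d i) d≤2β) (complete a i d (ℕ.<⇒≤ i<d))
      where
      complete : ∀ a i d → i ≤ d → i ℕ.+ a ℕ.* d ℕ.+ (d ℕ.∸ i) ≡ suc a ℕ.* d
      complete a i d i≤d = ≡.trans (regroup i (a ℕ.* d) (d ℕ.∸ i)) (≡.cong (ℕ._+ a ℕ.* d) (ℕ.m+[n∸m]≡n i≤d))
        where
        regroup : ∀ i b j → i ℕ.+ b ℕ.+ j ≡ i ℕ.+ j ℕ.+ b
        regroup = ℕ-Solver.solve-∀
    ... | inj₁ 2β<d = begin
      (∑[ i < d ] f i)
        ≡⟨ ≡.cong (λ z → ∑[ i < z ] f i) d≡ ⟩
      (∑[ i < suc e ℕ.+ 2 ℕ.* β ] f i)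
        ≈⟨ Sum.range-+ (suc e) (2 ℕ.* β) f ⟩
      (f 0 + (∑[ i < e ] f (suc i))) + (∑[ i < 2 ℕ.* β ] f (suc e ℕ.+ i))
        ≈⟨ +-cong (+-cong first middle) last ⟩
      (0# + 0#) + 0#
        ≈⟨ trans (+-identityʳ _) (+-identityʳ _) ⟩
      0# ∎
      where
      f : ℕ → Carrier
      f i = summand x α β m n r (i ℕ.+ a ℕ.* d)
      -- The residue 0 and the last 2β residues are killed. The residues 1, ..., e are left, and the
      -- reflection exchanges l with e + 1 - l.
      e : ℕ
      e = p ℕ.∸ 2 ℕ.* β
      e+2β : e ℕ.+ 2 ℕ.* β ≡ p
      e+2β = ℕ.m∸n+n≡m (ℕ.≤-pred 2β<d)
      d≡ : d ≡ suc e ℕ.+ 2 ℕ.* β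
      d≡ = ≡.cong suc (≡.sym e+2β)
      first : f 0 ≈ 0#
      first = summand-vanish (a ℕ.* d) {0} a z≤n (ℕ.+-identityʳ _)
      last : (∑[ i < 2 ℕ.* β ] f (suc e ℕ.+ i)) ≈ 0#
      last = Sum.range-ε (2 ℕ.* β) λ {i} i<2β →
        summand-vanish (suc e ℕ.+ i ℕ.+ a ℕ.* d) {2 ℕ.* β ℕ.∸ i} (suc a) (ℕ.m∸n≤m _ i)
          (≡.trans (regroup (suc e) i (a ℕ.* d) (2 ℕ.* β ℕ.∸ i))
            (≡.trans (≡.cong (λ z → suc e ℕ.+ z ℕ.+ a ℕ.* d) (ℕ.m+[n∸m]≡n (ℕ.<⇒≤ i<2β)))
              (≡.cong (ℕ._+ a ℕ.* d) (≡.sym d≡))))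
        where
        regroup : ∀ e i b j → e ℕ.+ i ℕ.+ b ℕ.+ j ≡ e ℕ.+ (i ℕ.+ j) ℕ.+ b
        regroup = ℕ-Solver.solve-∀
      opposite-sum : ∀ {i} → i < e → f (suc (e ℕ.∸ suc i)) + f (suc i) ≈ 0#
      opposite-sum {i} i<e = trans
        (+-congʳ (summand-antisym a {i} {e ℕ.∸ suc i} (≡.trans (regroup i (e ℕ.∸ suc i) (2 ℕ.* β))
          (≡.trans (≡.cong (λ z → suc z ℕ.+ 2 ℕ.* β) (ℕ.m+[n∸m]≡n i<e)) (≡.sym d≡)))))
        (-‿inverseˡ _)
        where
        regroup : ∀ i j b → 1 ℕ.+ i ℕ.+ (1 ℕ.+ j) ℕ.+ b ≡ 1 ℕ.+ (1 ℕ.+ i ℕ.+ j) ℕ.+ b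
        regroup = ℕ-Solver.solve-∀
      -- For odd e the reflection has a fixed point, so the sum is added to its own reverse instead
      -- of being split into pairs; cancelling 2 deals with the fixed term as well.
      middle : (∑[ i < e ] f (suc i)) ≈ 0#
      middle = 2-cancel _ (begin
        (∑[ i < e ] f (suc i)) + (∑[ i < e ] f (suc i))
          ≈⟨ +-congʳ (Sum.range-reverse e (f ∘ suc)) ⟩
        (∑[ i < e ] f (suc (e ℕ.∸ suc i))) + (∑[ i < e ] f (suc i))
          ≈⟨ Sum.range-∙ e (λ i → f (suc (e ℕ.∸ suc i))) (f ∘ suc) ⟨
        (∑[ i < e ] f (suc (e ℕ.∸ suc i)) + f (suc i))
          ≈⟨ Sum.range-ε e opposite-sum ⟩
        0# ∎)

    summand-sum : ∀ A → (∑[ k < A ℕ.* d ] summand x α β m n r k) ≈ 0#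
    summand-sum A = Sum.range-blocks A d (summand x α β m n r) block-sum

-- Ideals and quotient rings

module _ (R : CommutativeRing 0ℓ 0ℓ) where

  open CommutativeRing R

  record IsIdeal (I : Carrier → Set) : Set where
    field
      I-resp-≈ : ∀ {a b} → a ≈ b → I a → I b
      I-0      : I 0#
      I-+      : ∀ {a b} → I a → I b → I (a + b)
      I-*      : ∀ a {b} → I b → I (a * b)

  open import Relation.Binary.Reasoning.Setoid setoid

  telescope : ∀ a b c → (a - b) + (b - c) ≈ a - c
  telescope a b c = begin
    (a - b) + (b - c)     ≈⟨ +-assoc a (- b) (b - c) ⟩
    a + (- b + (b - c))   ≈⟨ +-congˡ (+-assoc (- b) b (- c)) ⟨
    a + ((- b + b) - c)   ≈⟨ +-congˡ (+-congʳ (-‿inverseˡ b)) ⟩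
    a + (0# - c)          ≈⟨ +-congˡ (+-identityˡ (- c)) ⟩
    a - c                 ∎

module QuotientRing
  (R : CommutativeRing 0ℓ 0ℓ) (I : CommutativeRing.Carrier R → Set) (isIdeal : IsIdeal R I)
  where

  open CommutativeRing R
  open IsIdeal isIdeal
  open import Algebra.Properties.Ring ring
    using (-1*x≈-x; x≈y⇒x∙y⁻¹≈ε; ⁻¹-anti-homo-//; -0#≈0#; x[y-z]≈xy-xz; [y-z]x≈yx-zx)
  open import Algebra.Properties.AbelianGroup +-abelianGroup using (⁻¹-∙-comm)
  open import Algebra.Properties.CommutativeSemigroup
    (CommutativeMonoid.commutativeSemigroup +-commutativeMonoid) using (interchange)
  open import Relation.Binary.Reasoning.Setoid setoid

  infix 4 _≋_
  -- A record rather than a synonym of `I (a - b)`, so that `a` and `b` can be recovered by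
  -- unification. The quotient keeps the carrier and the operations of `R`; only the equality
  -- changes.
  record _≋_ (a b : Carrier) : Set where
    constructor congruent
    field difference : I (a - b)
  open _≋_ public

  ≈⇒≋ : ∀ {a b} → a ≈ b → a ≋ b
  ≈⇒≋ e = congruent (I-resp-≈ (sym (x≈y⇒x∙y⁻¹≈ε e)) I-0)

  private
    I-neg : ∀ {a} → I a → I (- a)
    I-neg i = I-resp-≈ (-1*x≈-x _) (I-* (- 1#) i)

    ≋-sym : ∀ {a b} → a ≋ b → b ≋ a
    ≋-sym {a} {b} (congruent i) = congruent (I-resp-≈ (⁻¹-anti-homo-// a b) (I-neg i))

    ≋-trans : ∀ {a b c} → a ≋ b → b ≋ c → a ≋ c
    ≋-trans {a} {b} {c} (congruent i) (congruent j) = congruent (I-resp-≈ (telescope R a b c) (I-+ i j))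

    +-cong′ : ∀ {a b c d} → a ≋ b → c ≋ d → a + c ≋ b + d
    +-cong′ {a} {b} {c} {d} (congruent i) (congruent j) = congruent (I-resp-≈ (begin
      (a - b) + (c - d)      ≈⟨ interchange a (- b) c (- d) ⟩
      (a + c) + (- b - d)    ≈⟨ +-congˡ (⁻¹-∙-comm b d) ⟩
      (a + c) - (b + d)      ∎) (I-+ i j))

    *-cong′ : ∀ {a b c d} → a ≋ b → c ≋ d → a * c ≋ b * d
    *-cong′ {a} {b} {c} {d} (congruent i) (congruent j) = congruent (I-resp-≈ (begin
      c * (a - b) + b * (c - d)            ≈⟨ +-cong (*-comm c (a - b)) (x[y-z]≈xy-xz b c d) ⟩
      (a - b) * c + (b * c - b * d)        ≈⟨ +-congʳ ([y-z]x≈yx-zx c a b) ⟩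
      (a * c - b * c) + (b * c - b * d)    ≈⟨ telescope R (a * c) (b * c) (b * d) ⟩
      a * c - b * d                        ∎) (I-+ (I-* c i) (I-* b j)))

    neg-cong : ∀ {a b} → a ≋ b → - a ≋ - b
    neg-cong {a} {b} (congruent i) = congruent (I-resp-≈ (sym (⁻¹-∙-comm a (- b))) (I-neg i))

  commutativeRing : CommutativeRing 0ℓ 0ℓ
  commutativeRing = record
    { Carrier = Carrier ; _≈_ = _≋_ ; _+_ = _+_ ; _*_ = _*_ ; -_ = -_ ; 0# = 0# ; 1# = 1#
    ; isCommutativeRing = record
      { isRing = record
        { +-isAbelianGroup = record
          { isGroup = record
            { isMonoid = record
              { isSemigroup = record
                { isMagma = record
                  { isEquivalence = record { refl = ≈⇒≋ refl ; sym = ≋-sym ; trans = ≋-trans }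
                  ; ∙-cong = +-cong′ }
                ; assoc = λ a b c → ≈⇒≋ (+-assoc a b c) }
              ; identity = (≈⇒≋ ∘ +-identityˡ) , (≈⇒≋ ∘ +-identityʳ) }
            ; inverse = (≈⇒≋ ∘ -‿inverseˡ) , (≈⇒≋ ∘ -‿inverseʳ)
            ; ⁻¹-cong = neg-cong }
          ; comm = λ a b → ≈⇒≋ (+-comm a b) }
        ; *-cong = *-cong′
        ; *-assoc = λ a b c → ≈⇒≋ (*-assoc a b c)
        ; *-identity = (≈⇒≋ ∘ *-identityˡ) , (≈⇒≋ ∘ *-identityʳ)
        ; distrib = (λ a b c → ≈⇒≋ (distribˡ a b c)) , (λ a b c → ≈⇒≋ (distribʳ a b c)) }
      ; *-comm = λ a b → ≈⇒≋ (*-comm a b) } }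

  ≋0⇒I : ∀ {a} → a ≋ 0# → I a
  ≋0⇒I (congruent i) = I-resp-≈ (trans (+-congˡ -0#≈0#) (+-identityʳ _)) i

  I⇒≋0 : ∀ {a} → I a → a ≋ 0#
  I⇒≋0 i = congruent (I-resp-≈ (sym (trans (+-congˡ -0#≈0#) (+-identityʳ _))) i)

module PrincipalQuotient (R : CommutativeRing 0ℓ 0ℓ) (a : CommutativeRing.Carrier R) where

  open CommutativeRing R
  open import Algebra.Properties.Semiring.Divisibility semiring

  ∣-+ : ∀ {F G} → a ∣ F → a ∣ G → a ∣ F + G
  ∣-+ (c , e) (c′ , e′) = c + c′ , trans (distribʳ _ _ _) (+-cong e e′)

  isIdeal : IsIdeal R (a ∣_)
  isIdeal = record { I-resp-≈ = ∣ʳ-respʳ-≈ ; I-0 = a ∣0 ; I-+ = ∣-+ ; I-* = λ c → x∣ʳy⇒x∣ʳzy c }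

  open QuotientRing R (a ∣_) isIdeal public

-- From vanishing at roots of unity to divisibility by [n]

module _ (P : CommutativeRing 0ℓ 0ℓ) (q^ [_] : ℤ → CommutativeRing.Carrier P) where

  open CommutativeRing P
  open import Algebra.Definitions.RawMagma *-rawMagma using (_∣_)
  open import Algebra.Definitions.RawMonoid +-rawMonoid using () renaming (_×_ to _·_)

  -- The field `torsion-free` excludes additive torsion in P / (1 - qᵈ). It serves to halve an
  -- element that vanishes at a root of unity, and to cancel the integer d / gcd(s, d).
  record IsTorsionFreeQNumbers : Set where
    field
      isQNumbers   : IsQNumbers P q^ [_]
      []-*         : ∀ N → [ N ] * (1# - q^ (+ 1)) ≈ 1# - q^ N
      1-q-cancel   : ∀ c → c * (1# - q^ (+ 1)) ≈ 0# → c ≈ 0#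
      torsion-free : ∀ p t F → 1# - q^ (+ suc p) ∣ suc t · F → 1# - q^ (+ suc p) ∣ F

module Cyclotomic
  (P : CommutativeRing 0ℓ 0ℓ) (q^ [_] : ℤ → CommutativeRing.Carrier P)
  (isTorsionFreeQNumbers : IsTorsionFreeQNumbers P q^ [_])
  where

  open CommutativeRing P hiding (zero)
  open IsTorsionFreeQNumbers isTorsionFreeQNumbers
  open IsQNumbers isQNumbers
  open import Algebra.Definitions.RawMonoid +-rawMonoid using () renaming (_×_ to _·_)
  open import Algebra.Properties.Semiring.Divisibility semiring
    using (_∣_; _∣ʳ_; _,_; ∣ʳ-respʳ-≈; _∣0; x∣ʳy⇒x∣ʳzy)
  open import Algebra.Properties.Ring ring
    using (x≈y⇒x∙y⁻¹≈ε; x∙y⁻¹≈ε⇒x≈y; [y-z]x≈yx-zx; x[y-z]≈xy-xz; -1*x≈-x; ⁻¹-anti-homo-//)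
  open import Algebra.Properties.CommutativeSemigroup
    (CommutativeMonoid.commutativeSemigroup *-commutativeMonoid) using (x∙yz≈y∙xz)
  open import Relation.Binary.Reasoning.Setoid setoid

  1-q^ : ℕ → Carrier
  1-q^ n = 1# - q^ (+ n)

  -- F becomes zero when q is specialised to a primitive d-th root of unity:
  -- the d-th cyclotomic polynomial is 1 - qᵈ stripped of its common factors
  -- with the 1 - qˢ for 0 < s < d.
  data Vanishes (d : ℕ) : Carrier → Set where
    multiple : ∀ {F} → 1-q^ d ∣ F → Vanishes d F
    cancel   : ∀ {F s} → suc s < d → Vanishes d (1-q^ (suc s) * F) → Vanishes d F

  module _ {d : ℕ} where

    vanishes-resp : ∀ {F G} → F ≈ G → Vanishes d F → Vanishes d G
    vanishes-resp e (multiple h) = multiple (∣ʳ-respʳ-≈ e h)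
    vanishes-resp e (cancel l v) = cancel l (vanishes-resp (*-congˡ e) v)

    vanishes-* : ∀ H {F} → Vanishes d F → Vanishes d (H * F)
    vanishes-* H (multiple h) = multiple (x∣ʳy⇒x∣ʳzy H h)
    vanishes-* H (cancel l v) = cancel l (vanishes-resp (x∙yz≈y∙xz _ _ _) (vanishes-* H v))

    vanishes-+-multiple : ∀ {F G} → Vanishes d F → 1-q^ d ∣ G → Vanishes d (F + G)
    vanishes-+-multiple (multiple h) h′ = multiple (PrincipalQuotient.∣-+ P _ h h′)
    vanishes-+-multiple (cancel l v) h  =
      cancel l (vanishes-resp (sym (distribˡ _ _ _)) (vanishes-+-multiple v (x∣ʳy⇒x∣ʳzy _ h)))

    -- The two derivations may cancel different products of factors 1 - qˢ. The sum cancels both: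
    -- first those of `G`, by which `F` is multiplied along the way, then those of `F`.
    vanishes-+ : ∀ {F G} → Vanishes d F → Vanishes d G → Vanishes d (F + G)
    vanishes-+ v (multiple h) = vanishes-+-multiple v h
    vanishes-+ v (cancel l w) =
      cancel l (vanishes-resp (sym (distribˡ _ _ _)) (vanishes-+ (vanishes-* _ v) w))

  vanishes-½ : ∀ {p F G} → F ≈ G + G → Vanishes (suc p) F → Vanishes (suc p) G
  vanishes-½ {p} {F} {G} e (multiple h) =
    multiple (torsion-free p 1 G (∣ʳ-respʳ-≈ (trans e (+-congˡ (sym (+-identityʳ G)))) h))
  vanishes-½ e (cancel l v)             = cancel l (vanishes-½ (trans (*-congˡ e) (distribˡ _ _ _)) v)

  vanishes-isIdeal : ∀ d → IsIdeal P (Vanishes d)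
  vanishes-isIdeal d = record
    { I-resp-≈ = vanishes-resp ; I-0 = multiple (_ ∣0) ; I-+ = vanishes-+ ; I-* = vanishes-* }

  module Root (p : ℕ) = QuotientRing P (Vanishes (suc p)) (vanishes-isIdeal (suc p))

  isPrimitiveRoot : ∀ p → 0 < p → IsPrimitiveRoot (Root.commutativeRing p) q^ [_] p
  isPrimitiveRoot p 0<p = record
    { isQNumbers = record
      { q^0  = ≈⇒≋ q^0
      ; q^-+ = λ i j → ≈⇒≋ (q^-+ i j)
      ; []-+ = λ i j → ≈⇒≋ ([]-+ i j) }
    ; q^d≈1     = congruent (multiple (- 1# , trans (-1*x≈-x _) (⁻¹-anti-homo-// 1# _)))
    -- `[d]` times 1 - q is 1 - qᵈ, and cancelling 1 - q is permitted only for 1 < d.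
    ; [d]≈0     = I⇒≋0 (cancel (s≤s 0<p) (multiple (1# ,
        trans (*-identityˡ _) (trans (sym ([]-* (+ suc p))) (*-comm _ _)))))
    ; []-cancel = λ {s} s<d c h → I⇒≋0 (cancel s<d (vanishes-resp (begin
        1-q^ 1 * (c * [ + suc s ])    ≈⟨ x∙yz≈y∙xz _ c _ ⟩
        c * (1-q^ 1 * [ + suc s ])    ≈⟨ *-congˡ (trans (*-comm _ _) ([]-* (+ suc s))) ⟩
        c * 1-q^ (suc s)              ≈⟨ *-comm _ _ ⟩
        1-q^ (suc s) * c              ∎) (vanishes-* (1-q^ 1) (≋0⇒I h))))
    ; 2-cancel  = λ c h → I⇒≋0 (vanishes-½ refl (≋0⇒I h)) }
    where open Root p

  module _ {p : ℕ} where

    private d = suc p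
    private module Q = PrincipalQuotient P (1-q^ d)
    private module Qᴿ = CommutativeRing Q.commutativeRing

    -- Modulo 1 - qᵈ, both q^ s and q^ d fix F, hence so does q^ e; as F is a
    -- multiple of 1 - qᵉ, say (1 - qᵉ) G, this gives (d / e) F = (1 - qᵈ) G = 0.
    cancel-1-q^ : ∀ {s F} → 1-q^ (gcd s d) ∣ F → 1-q^ d ∣ 1-q^ s * F → 1-q^ d ∣ F
    cancel-1-q^ {s} {F} (G , G*≈F) h with gcd[m,n]∣n s d
    ... | divides (suc t) d≡ = torsion-free p t F (Q.≋0⇒I t·F≋0)
      where
      open Q using (_≋_; ≈⇒≋)
      e = gcd s d
      fixed-by-s : q^ (+ s) * F ≋ F
      fixed-by-s = Qᴿ.sym (Qᴿ.trans (≈⇒≋ (sym (*-identityˡ F)))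
        (Q.congruent (∣ʳ-respʳ-≈ ([y-z]x≈yx-zx F 1# _) h)))
      fixed-by-d : q^ (+ d) * F ≋ F
      fixed-by-d = Qᴿ.sym (Qᴿ.trans (≈⇒≋ (sym (*-identityˡ F)))
        (Q.congruent (∣ʳ-respʳ-≈ ([y-z]x≈yx-zx F 1# _) (F , *-comm _ _))))
      fixed-by-multiple : ∀ {a} → q^ (+ a) * F ≋ F → ∀ n → q^ (+ (n ℕ.* a)) * F ≋ F
      fixed-by-multiple     fix zero    = ≈⇒≋ (trans (*-congʳ q^0) (*-identityˡ F))
      fixed-by-multiple {a} fix (suc n) = Qᴿ.trans
        (≈⇒≋ (trans (*-congʳ (sym (q^-+ (+ a) (+ (n ℕ.* a))))) (*-assoc _ _ _)))
        (Qᴿ.trans (Qᴿ.*-congˡ (fixed-by-multiple fix n)) fix)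
      combine : ∀ {a b c} → a ℕ.+ b ≡ c → q^ (+ b) * F ≋ F → q^ (+ c) * F ≋ F → q^ (+ a) * F ≋ F
      combine {a} {b} ≡.refl fix-b fix-c = Qᴿ.trans (Qᴿ.*-congˡ (Qᴿ.sym fix-b))
        (Qᴿ.trans (≈⇒≋ (trans (sym (*-assoc _ _ _)) (*-congʳ (q^-+ (+ a) (+ b))))) fix-c)
      fixed-by-e : q^ (+ e) * F ≋ F
      fixed-by-e with Bézout.identity (gcd-GCD s d)
      ... | Bézout.+- x y eq = combine eq (fixed-by-multiple fixed-by-d y) (fixed-by-multiple fixed-by-s x)
      ... | Bézout.-+ x y eq = combine eq (fixed-by-multiple fixed-by-s x) (fixed-by-multiple fixed-by-d y)
      geometric : ∀ n → n · F ≋ G * 1-q^ (n ℕ.* e)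
      geometric zero    = ≈⇒≋ (sym (trans (*-congˡ (x≈y⇒x∙y⁻¹≈ε (sym q^0))) (zeroʳ G)))
      geometric (suc n) = Qᴿ.trans
        (Qᴿ.+-cong (Qᴿ.sym (fixed-by-multiple fixed-by-e n)) (geometric n))
        (≈⇒≋ (begin
          u * F + G * (1# - u)                          ≈⟨ +-cong (*-congˡ (sym G*≈F)) (x[y-z]≈xy-xz G 1# u) ⟩
          u * (G * (1# - v)) + (G * 1# - G * u)         ≈⟨ +-congʳ (trans (x∙yz≈y∙xz u G _) (*-congˡ (x[y-z]≈xy-xz u 1# v))) ⟩
          G * (u * 1# - u * v) + (G * 1# - G * u)       ≈⟨ +-congʳ (*-congˡ (+-cong (*-identityʳ u) (-‿cong (trans (*-comm u v) (q^-+ _ _))))) ⟩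
          G * (u - w) + (G * 1# - G * u)                ≈⟨ +-comm _ _ ⟩
          (G * 1# - G * u) + G * (u - w)                ≈⟨ +-congʳ (x[y-z]≈xy-xz G 1# u) ⟨
          G * (1# - u) + G * (u - w)                    ≈⟨ distribˡ G _ _ ⟨
          G * ((1# - u) + (u - w))                      ≈⟨ *-congˡ (telescope P 1# u w) ⟩
          G * (1# - w)                                  ∎))
        where
        u = q^ (+ (n ℕ.* e))
        v = q^ (+ e)
        w = q^ (+ (e ℕ.+ n ℕ.* e))
      t·F≋0 : suc t · F ≋ 0#
      t·F≋0 = Qᴿ.trans (geometric (suc t))
        (Q.I⇒≋0 (G , reflexive (≡.cong (λ z → G * 1-q^ z) d≡)))

    -- The cancellations recorded in `Vanishes` are undone one by one. For a factor 1 - qˢ,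
    -- `cancel-1-q^` asks for divisibility by 1 - qᵉ with e = gcd(s, d), a proper divisor of d
    -- because s < d. The hypothesis on proper divisors survives multiplication, so it holds in the
    -- recursive call.
    vanishes⇒∣ : ∀ {F} → (∀ {e} → 0 < e → e < d → e ∣ℕ d → 1-q^ e ∣ F) → Vanishes d F → 1-q^ d ∣ F
    vanishes⇒∣ proper (multiple h)         = h
    vanishes⇒∣ {F} proper (cancel {s = s} s<d v) = cancel-1-q^
      (proper {gcd (suc s) d} (ℕ.n≢0⇒n>0 (ℕ.1+n≢0 ∘ gcd[m,n]≡0⇒m≡0 {suc s} {d})) (ℕ.≤-<-trans (∣⇒≤ (gcd[m,n]∣m (suc s) d)) s<d) (gcd[m,n]∣n (suc s) d))
      (vanishes⇒∣ (λ 0<e e<d e∣d → x∣ʳy⇒x∣ʳzy _ (proper 0<e e<d e∣d)) v)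

  -- Nothing is assumed about d = 1, so the factor 1 - q is what starts the induction. At n it turns
  -- divisibility by 1 - qⁿ into divisibility by `[n]`, on cancelling 1 - q.
  []∣ : ∀ {n} → n > 0 → ∀ S → (∀ p → 0 < p → suc p ∣ℕ n → Vanishes (suc p) S) → [ + n ] ∣ S
  []∣ {n} n>0 S vanishes = c , x∙y⁻¹≈ε⇒x≈y _ _ (1-q-cancel _ (begin
    (c * [ + n ] - S) * 1-q^ 1                 ≈⟨ [y-z]x≈yx-zx (1-q^ 1) (c * [ + n ]) S ⟩
    c * [ + n ] * 1-q^ 1 - S * 1-q^ 1          ≈⟨ +-congʳ (trans (*-assoc _ _ _) (*-congˡ ([]-* (+ n)))) ⟩
    c * 1-q^ n - S * 1-q^ 1                    ≈⟨ +-congʳ c* ⟩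
    1-q^ 1 * S - S * 1-q^ 1                    ≈⟨ x≈y⇒x∙y⁻¹≈ε (*-comm _ _) ⟩
    0#                                         ∎))
    where
    Goal : ℕ → Set
    Goal e = 0 < e → e ∣ℕ n → 1-q^ e ∣ 1-q^ 1 * S
    step : ∀ e → (∀ {e′} → e′ < e → Goal e′) → Goal e
    step 1             rec _ _   = S , *-comm _ _
    step (suc (suc p)) rec _ e∣n = vanishes⇒∣
      (λ 0<e′ e′<e e′∣e → rec e′<e 0<e′ (∣ℕ-trans e′∣e e∣n))
      (vanishes-* (1-q^ 1) (vanishes (suc p) (s≤s z≤n) e∣n))
    n-divides : 1-q^ n ∣ 1-q^ 1 * S
    n-divides = <-rec Goal step n n>0 (divides 1 (≡.sym (ℕ.*-identityˡ n)))
    c = _∣ʳ_.quotient n-divides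
    c* : c * 1-q^ n ≈ 1-q^ 1 * S
    c* = _∣ʳ_.equality n-divides

-- Torsion-freeness of ℤ[q,q⁻¹] modulo 1 - qᵈ

remainder-unique : ∀ {d r r′} → r < d → r′ < d → ∀ t → + r ≡ + r′ ℤ.+ t ℤ.* + d → r ≡ r′
remainder-unique {d} {r} {r′} r<d r′<d (+ zero) e = ℤ.+-injective (≡.trans e (ℤ.+-identityʳ (+ r′)))
remainder-unique {d} {r} {r′} r<d r′<d (+ suc n) e = contradiction r<d (ℕ.≤⇒≯ (≡.subst (d ≤_)
  (≡.sym (ℤ.+-injective (≡.trans e (≡.cong (λ z → + r′ ℤ.+ z) (≡.sym (ℤ.pos-* (suc n) d))))))
  (ℕ.≤-trans (ℕ.m≤m+n d (n ℕ.* d)) (ℕ.m≤n+m (suc n ℕ.* d) r′))))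
remainder-unique {d} {r} {r′} r<d r′<d -[1+ n ] e = contradiction r′<d (ℕ.≤⇒≯ (≡.subst (d ≤_)
  (≡.sym (ℤ.+-injective (≡.trans (move (+ r) (+ r′) (+ suc n) (+ d) e) (≡.cong (λ z → + r ℤ.+ z) (≡.sym (ℤ.pos-* (suc n) d))))))
  (ℕ.≤-trans (ℕ.m≤m+n d (n ℕ.* d)) (ℕ.m≤n+m (suc n ℕ.* d) r))))
  where
  move : ∀ r r′ n d → r ≡ r′ ℤ.+ ℤ.- n ℤ.* d → r′ ≡ r ℤ.+ n ℤ.* d
  move ._ r′ n d ≡.refl = lem r′ n d
    where
    lem : ∀ r′ n d → r′ ≡ r′ ℤ.+ ℤ.- n ℤ.* d ℤ.+ n ℤ.* d
    lem = solve-∀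

[i+d]%d≡i%d : ∀ i p → (i ℤ.+ + suc p) %ℕ suc p ≡ i %ℕ suc p
[i+d]%d≡i%d i p = remainder-unique (n%ℕd<d (i ℤ.+ + d) d) (n%ℕd<d i d) (i /ℕ d ℤ.+ + 1 ℤ.- (i ℤ.+ + d) /ℕ d)
  (combine i (+ (i %ℕ d)) (i /ℕ d) (+ ((i ℤ.+ + d) %ℕ d)) ((i ℤ.+ + d) /ℕ d) (+ d)
    (a≡a%ℕn+[a/ℕn]*n i d) (a≡a%ℕn+[a/ℕn]*n (i ℤ.+ + d) d))
  where
  d = suc p
  combine : ∀ i r t r′ t′ d → i ≡ r ℤ.+ t ℤ.* d → i ℤ.+ d ≡ r′ ℤ.+ t′ ℤ.* d →
    r′ ≡ r ℤ.+ (t ℤ.+ + 1 ℤ.- t′) ℤ.* d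
  combine ._ r t r′ t′ d ≡.refl e = ≡.trans (lem r′ (t′ ℤ.* d))
    (≡.trans (≡.cong (ℤ._- t′ ℤ.* d) (≡.sym e)) (lem′ r t t′ d))
    where
    lem : ∀ a b → a ≡ a ℤ.+ b ℤ.- b
    lem = solve-∀
    lem′ : ∀ r t t′ d → r ℤ.+ t ℤ.* d ℤ.+ d ℤ.- t′ ℤ.* d ≡ r ℤ.+ (t ℤ.+ + 1 ℤ.- t′) ℤ.* d
    lem′ = solve-∀

module LaurentTorsion (p : ℕ) where


  open Laurent hiding (zero)
  open import Algebra.Definitions.RawMonoid +-rawMonoid using () renaming (_×_ to _·_)
  open import Algebra.Properties.Semiring.Divisibility semiring using (∣ʳ-refl)

  d : ℕ
  d = suc p

  -- The representative in the span of 1, q, ..., q^p. The quotient by 1 - qᵈ is free on these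
  -- powers, which is why it has no torsion.
  fold : Carrier → Carrier
  fold = map λ (c , h) → c , + (h %ℕ d)

  eval-fold : ∀ F f → eval (fold F) f ≡ eval F (λ h → f (+ (h %ℕ d)))
  eval-fold []            f = ≡.refl
  eval-fold ((c , h) ∷ F) f = ≡.cong (λ z → c ℤ.* f (+ (h %ℕ d)) ℤ.+ z) (eval-fold F f)

  eval-0 : ∀ F {f} → (∀ h → f h ≡ + 0) → eval F f ≡ + 0
  eval-0 []            e = ≡.refl
  eval-0 ((c , h) ∷ F) e = ≡.cong₂ ℤ._+_ (≡.trans (≡.cong (c ℤ.*_) (e h)) (ℤ.*-zeroʳ c)) (eval-0 F e)

  eval-· : ∀ n F f → eval (n · F) f ≡ + n ℤ.* eval F f
  eval-· zero    F f = ≡.refl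
  eval-· (suc n) F f = ≡.trans (eval-+ F (n · F) f)
    (≡.trans (≡.cong (λ z → eval F f ℤ.+ z) (eval-· n F f)) (≡.sym (ℤ.suc-* (+ n) (eval F f))))

  -- Evaluating `fold F` at any function amounts to evaluating `F` at a d-periodic one, and
  -- d-periodic functions annihilate the multiples of 1 - qᵈ. So t + 1 times the value is 0 in ℤ,
  -- and t + 1 cancels.
  fold≈0 : ∀ t {F G} → G * (1# - q^ (+ d)) ≈ suc t · F → fold F ≈ 0#
  fold≈0 t {F} {G} e = eval-≈ λ f →
    ≡.trans (eval-fold F f) (periodic⇒0 (λ h → f (+ (h %ℕ d))) (λ h → ≡.cong (λ r → f (+ r)) ([i+d]%d≡i%d h p)))
    where
    periodic⇒0 : ∀ f → (∀ h → f (h ℤ.+ + d) ≡ f h) → eval F f ≡ + 0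
    periodic⇒0 f per = ℤ.*-cancelˡ-≡ (+ suc t) (eval F f) (+ 0) (≡.trans
      (≡.sym (eval-· (suc t) F f)) (≡.trans (≡.sym (≈-eval e f)) (≡.trans
      (eval-* G (1# - q^ (+ d)) f) (≡.trans (eval-0 G λ g → ≡.trans
        (≡.cong₂ (λ y z → + 1 ℤ.* f y ℤ.+ (ℤ.- + 1 ℤ.* z ℤ.+ + 0)) (ℤ.+-identityʳ g) (per g)) (lem (f g)))
      (≡.sym (ℤ.*-zeroʳ (+ suc t)))))))
      where
      lem : ∀ y → + 1 ℤ.* y ℤ.+ (ℤ.- + 1 ℤ.* y ℤ.+ + 0) ≡ + 0
      lem = solve-∀

  module Q = PrincipalQuotient ℤ[q,q⁻¹] (1# - q^ (+ d))
  open Q using (_≋_; ≈⇒≋)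
  private
    module Qᴿ = CommutativeRing Q.commutativeRing

    q^d≋1 : q^ (+ d) ≋ 1#
    q^d≋1 = Qᴿ.sym {1#} {q^ (+ d)} (Q.congruent ∣ʳ-refl)

    isQNumbers : IsQNumbers Q.commutativeRing q^ [_]
    isQNumbers = record
      { q^0  = Qᴿ.refl {1#}
      ; q^-+ = λ i j → Qᴿ.refl {q^ (i ℤ.+ j)}
      ; []-+ = λ i j → ≈⇒≋ ([]-+ i j) }

    fold-monomial : ∀ c h → monomial c h ≋ monomial c (+ (h %ℕ d))
    fold-monomial c h = Qᴿ.trans {monomial c h} {m * u} {m}
      (Qᴿ.reflexive (≡.cong₂ monomial (≡.sym (ℤ.*-identityʳ c)) (a≡a%ℕn+[a/ℕn]*n h d)))
      (Qᴿ.trans {m * u} {m * 1#} {m}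
        (Qᴿ.*-congˡ {m} {u} {1#} (QNumberProperties.q^-*≈1 Q.commutativeRing q^ [_] isQNumbers q^d≋1 (h /ℕ d)))
        (Qᴿ.*-identityʳ m))
      where
      m = monomial c (+ (h %ℕ d))
      u = q^ (h /ℕ d ℤ.* + d)

  fold-≋ : ∀ F → F ≋ fold F
  fold-≋ []            = Qᴿ.refl {[]}
  fold-≋ ((c , h) ∷ F) = Qᴿ.+-cong {monomial c h} {monomial c (+ (h %ℕ d))} {F} {fold F}
    (fold-monomial c h) (fold-≋ F)

-- Torsion-freeness of ℤ[q,q⁻¹][x] modulo 1 - qᵈ

module PolynomialTorsion where

  open Polynomial hiding (zero)
  open import Algebra.Definitions.RawMonoid +-rawMonoid using () renaming (_×_ to _·_)
  open import Algebra.Definitions.RawMonoid Laurent.+-rawMonoid using () renaming (_×_ to _·ᴸ_)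
  open import Algebra.Definitions.RawMagma *-rawMagma using (_,_)
  open import Algebra.Definitions.RawMagma Laurent.*-rawMagma using () renaming (_,_ to _,ᴸ_)
  private module L = Laurent

  monomial-cong : ∀ {a b} i → a L.≈ b → monomial a i ≈ monomial b i
  monomial-cong {a} {b} i e = coeffs λ h → L.+-congʳ {[]} (choose (does (i ℕ.≟ h)))
    where
    choose : ∀ t → (if t then a else L.0#) L.≈ (if t then b else L.0#)
    choose true  = e
    choose false = L.refl {[]}

  -- One term on the left and two on the right: different formal sums with equal coefficients. The
  -- same holds of `1-q̂^` below.
  monomial-+ : ∀ a b i → monomial (a L.+ b) i ≈ monomial a i + monomial b i
  monomial-+ a b i = coeffs λ h → L.reflexive (choose (does (i ℕ.≟ h)))
    where
    choose : ∀ t → (if t then a L.+ b else L.0#) L.+ L.0#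
      ≡ (if t then a else L.0#) L.+ ((if t then b else L.0#) L.+ L.0#)
    choose true  = ++-assoc a b []
    choose false = ≡.refl

  coeff-+ : ∀ F G i → coeff (F + G) i ≡ coeff F i L.+ coeff G i
  coeff-+ []            G i = ≡.refl
  coeff-+ ((c , g) ∷ F) G i = ≡.trans
    (≡.cong ((if does (g ℕ.≟ i) then c else L.0#) L.+_) (coeff-+ F G i))
    (≡.sym (++-assoc (if does (g ℕ.≟ i) then c else L.0#) (coeff F i) (coeff G i)))

  coeff-· : ∀ n F i → coeff (n · F) i ≡ n ·ᴸ coeff F i
  coeff-· zero    F i = ≡.refl
  coeff-· (suc n) F i = ≡.trans (coeff-+ F (n · F) i) (≡.cong (coeff F i L.+_) (coeff-· n F i))

  coeff-*-const : ∀ F u i → coeff (F * const u) i L.≈ coeff F i L.* u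
  coeff-*-const []            u i = L.refl {[]}
  coeff-*-const ((c , g) ∷ F) u i rewrite ℕ.+-identityʳ g = L.trans
    {(if t then c L.* u else L.0#) L.+ coeff (F * const u) i}
    {(if t then c else L.0#) L.* u L.+ coeff F i L.* u}
    {((if t then c else L.0#) L.+ coeff F i) L.* u}
    (L.+-cong {if t then c L.* u else L.0#} {(if t then c else L.0#) L.* u} {coeff (F * const u) i} {coeff F i L.* u}
      (L.reflexive (choose t)) (coeff-*-const F u i))
    (L.sym {((if t then c else L.0#) L.+ coeff F i) L.* u} (L.distribʳ u (if t then c else L.0#) (coeff F i)))
    where
    t = does (g ℕ.≟ i)
    choose : ∀ t → (if t then c L.* u else L.0#) ≡ (if t then c else L.0#) L.* u
    choose true  = ≡.refl
    choose false = ≡.refl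

  q̂^ : ℤ → Carrier
  q̂^ i = const (L.q^ i)

  1-q̂^ : ∀ i → const (L.1# L.- L.q^ i) ≈ 1# - q̂^ i
  1-q̂^ i = monomial-+ L.1# (L.- L.q^ i) 0

  coeff-*-1-q̂^ : ∀ G n i → coeff (G * (1# - q̂^ n)) i L.≈ coeff G i L.* (L.1# L.- L.q^ n)
  coeff-*-1-q̂^ G n i = L.trans {coeff (G * (1# - q̂^ n)) i} {coeff (G * const u) i} {coeff G i L.* u}
    (coeff-≈ (*-congˡ {G} {1# - q̂^ n} {const u} (sym {const u} {1# - q̂^ n} (1-q̂^ n))) i)
    (coeff-*-const G u i)
    where u = L.1# L.- L.q^ n

  1-q-cancel : ∀ c → c * (1# - q̂^ (+ 1)) ≈ 0# → c ≈ 0#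
  1-q-cancel c e = coeffs λ i → IsGenericPower.1-q^-cancel L.generic 0 (coeff c i)
    (L.trans {coeff c i L.* (L.1# L.- L.q^ (+ 1))} {coeff (c * (1# - q̂^ (+ 1))) i} {[]}
      (L.sym {coeff (c * (1# - q̂^ (+ 1))) i} (coeff-*-1-q̂^ c (+ 1) i)) (coeff-≈ e i))

  module _ (p : ℕ) where

    open LaurentTorsion p
    private
      module Q̂ = PrincipalQuotient ℤ[q,q⁻¹][x] (1# - q̂^ (+ d))
      module Q̂ᴿ = CommutativeRing Q̂.commutativeRing

    foldᴾ : Carrier → Carrier
    foldᴾ = map λ (c , i) → fold c , i

    coeff-foldᴾ : ∀ F i → coeff (foldᴾ F) i ≡ fold (coeff F i)
    coeff-foldᴾ []            i = ≡.refl
    coeff-foldᴾ ((c , g) ∷ F) i = ≡.trans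
      (≡.cong₂ L._+_ (choose (does (g ℕ.≟ i))) (coeff-foldᴾ F i))
      (≡.sym (map-++ _ (if does (g ℕ.≟ i) then c else L.0#) (coeff F i)))
      where
      choose : ∀ t → (if t then fold c else L.0#) ≡ fold (if t then c else L.0#)
      choose true  = ≡.refl
      choose false = ≡.refl

    monomial-≋ : ∀ {a b} i → a Q.≋ b → monomial a i Q̂.≋ monomial b i
    monomial-≋ {a} {b} i (Q.congruent (g ,ᴸ e)) = Q̂.congruent (monomial g i , (begin
      monomial g i * (1# - q̂^ (+ d))    ≈⟨ *-congˡ {monomial g i} {1# - q̂^ (+ d)} {const u} (sym {const u} {1# - q̂^ (+ d)} (1-q̂^ (+ d))) ⟩
      monomial g i * const u            ≡⟨ ≡.cong (monomial (g L.* u)) (ℕ.+-identityʳ i) ⟩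
      monomial (g L.* u) i              ≈⟨ monomial-cong i e ⟩
      monomial (a L.- b) i              ≈⟨ monomial-+ a (L.- b) i ⟩
      monomial a i - monomial b i       ∎))
      where
      open import Relation.Binary.Reasoning.Setoid setoid
      u = L.1# L.- L.q^ (+ d)

    foldᴾ-≋ : ∀ F → F Q̂.≋ foldᴾ F
    foldᴾ-≋ []            = Q̂ᴿ.refl {[]}
    foldᴾ-≋ ((c , i) ∷ F) = Q̂ᴿ.+-cong {monomial c i} {monomial (fold c) i} {F} {foldᴾ F}
      (monomial-≋ i (fold-≋ c)) (foldᴾ-≋ F)

    -- Multiplication by 1 - qᵈ acts on each coefficient in x separately, so `fold≈0` applies to
    -- every coefficient and `foldᴾ F`, to which `F` is congruent, is 0.
    torsion-free : ∀ t F → 1# - q̂^ (+ d) ∣ suc t · F → 1# - q̂^ (+ d) ∣ F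
    torsion-free t F (G , e) = Q̂.≋0⇒I (Q̂ᴿ.trans {F} {foldᴾ F} {0#} (foldᴾ-≋ F)
      (Q̂.≈⇒≋ {foldᴾ F} {0#} (coeffs λ i → ≡.subst (L._≈ L.0#) (≡.sym (coeff-foldᴾ F i))
        (fold≈0 t {coeff F i} {coeff G i} (L.trans {coeff G i L.* u} {coeff (G * (1# - q̂^ (+ d))) i} {suc t ·ᴸ coeff F i}
          (L.sym {coeff (G * (1# - q̂^ (+ d))) i} (coeff-*-1-q̂^ G (+ d) i))
          (≡.subst (coeff (G * (1# - q̂^ (+ d))) i L.≈_) (coeff-· (suc t) F i) (coeff-≈ e i)))))))
      where u = L.1# L.- L.q^ (+ d)

-- Divisibility of the sum over an abstract ring

module QDivisibility
  (P : CommutativeRing 0ℓ 0ℓ) (q^ [_] : ℤ → CommutativeRing.Carrier P)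
  (isTorsionFreeQNumbers : IsTorsionFreeQNumbers P q^ [_])
  where

  open CommutativeRing P
  open RangeOperators P
  open QBinomials P q^ [_]
  open Cyclotomic P q^ [_] isTorsionFreeQNumbers
  open import Algebra.Definitions.RawMagma *-rawMagma using (_∣_)
  open import Algebra.Definitions.RawSemiring (Semiring.rawSemiring semiring) using (_^_)

  -- The two sides differ in the equality carried by the ring from which powers,
  -- binomials and sums are computed.
  module Reduction (p : ℕ) where

    open Root p using (_≋_)
    private
      module R = CommutativeRing (Root.commutativeRing p)
      module T = QBinomials (Root.commutativeRing p) q^ [_]
    open import Algebra.Definitions.RawSemiring (Semiring.rawSemiring R.semiring) using () renaming (_^_ to _^ᴿ_)

    ^-reduce : ∀ {a b} n → a ≋ b → a ^ n ≋ b ^ᴿ n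
    ^-reduce zero    e = R.refl
    ^-reduce (suc n) e = R.*-cong e (^-reduce n e)

    binomial-reduce : ∀ N k → binomial N k ≋ T.binomial N k
    binomial-reduce N       zero    = R.refl
    binomial-reduce zero    (suc k) = R.refl
    binomial-reduce (suc N) (suc k) = R.+-cong (binomial-reduce N k) (R.*-congˡ (binomial-reduce N (suc k)))

    narayana-reduce : ∀ k j → narayana k j ≋ T.narayana k j
    narayana-reduce k j = R.+-cong
      (R.*-cong (binomial-reduce (k ℕ.∸ 1) (j ℕ.∸ 1)) (binomial-reduce (k ℕ.+ j) j))
      (R.-‿cong (R.*-cong (binomial-reduce k j) (binomial-reduce (k ℕ.+ j) (j ℕ.∸ 1))))

    weight-reduce : ∀ x α k → weight x α k ≋ T.weight x α k
    weight-reduce x α k = RangeProperties.range-cong R.+-commutativeMonoid k λ {j} _ →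
      R.*-cong (R.*-congˡ {q^ (+ α ℤ.* twist k (suc j))} (^-reduce α (narayana-reduce k (suc j)))) (^-reduce j R.refl)

    summand-reduce : ∀ x α β m n r k → summand x α β m n r k ≋ T.summand x α β m n r k
    summand-reduce x α β m n r k = R.*-cong
      (R.*-congʳ (R.*-congʳ (^-reduce r R.refl)))
      (RangeProperties.range-cong R.*-commutativeMonoid (2 ℕ.* β) λ {i} _ → ^-reduce m (weight-reduce x α (k ℕ.+ i)))

  [n]∣∑summand : ∀ x {α} → α > 0 → ∀ β m {n} → n > 0 → ∀ {r} → r > 0 →
    [ + n ] ∣ (∑[ k < n ] summand x α β m n r k)
  [n]∣∑summand x {α} α>0 β m {n} n>0 {r} r>0 = []∣ n>0 _ vanishes
    where
    vanishes : ∀ p → 0 < p → suc p ∣ℕ n → Vanishes (suc p) (∑[ k < n ] summand x α β m n r k)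
    vanishes p 0<p (divides A n≡) = ≡.subst
      (λ N → Vanishes (suc p) (∑[ k < N ] summand x α β m n r k)) (≡.sym n≡)
      (Root.≋0⇒I p (CommutativeRing.trans (Root.commutativeRing p)
        (RangeProperties.range-cong (CommutativeRing.+-commutativeMonoid (Root.commutativeRing p)) (A ℕ.* suc p)
          λ {k} _ → Reduction.summand-reduce p x α β m n r k)
        (PrimitiveRoot.summand-sum (Root.commutativeRing p) q^ [_] p (isPrimitiveRoot p 0<p)
          x α>0 β m n r>0 A)))

-- Passage to the definitions of the statement

module Transport where

  open Polynomial hiding (zero)
  open PolynomialTorsion using (q̂^; monomial-cong; monomial-+; 1-q̂^; 1-q-cancel; torsion-free)
  private module L = Laurent
  open import Relation.Binary.Reasoning.Setoid setoid
  open import Algebra.Properties.Semiring.Exp semiring using (^-congˡ)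

  ⟦_⟧ : ℤ → Carrier
  ⟦ N ⟧ = const L.[ N ]

  isTorsionFreeQNumbers : IsTorsionFreeQNumbers ℤ[q,q⁻¹][x] q̂^ ⟦_⟧
  isTorsionFreeQNumbers = record
    { isQNumbers   = record
      { q^0  = refl {1#}
      ; q^-+ = λ i j → refl {q̂^ (i ℤ.+ j)}
      ; []-+ = λ i j → begin
          ⟦ i ⟧ + q̂^ i * ⟦ j ⟧            ≈⟨ monomial-+ L.[ i ] (L.q^ i L.* L.[ j ]) 0 ⟨
          const (L.[ i ] L.+ L.q^ i L.* L.[ j ]) ≈⟨ monomial-cong 0 (L.[]-+ i j) ⟩
          ⟦ i ℤ.+ j ⟧                     ∎ }
    ; []-*         = λ N → begin
        ⟦ N ⟧ * (1# - q̂^ (+ 1))    ≈⟨ *-congˡ {⟦ N ⟧} {1# - q̂^ (+ 1)} {const (L.1# L.- L.q^ (+ 1))} (sym {const (L.1# L.- L.q^ (+ 1))} {1# - q̂^ (+ 1)} (1-q̂^ (+ 1))) ⟩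
        const (L.[ N ] L.* (L.1# L.- L.q^ (+ 1)))   ≈⟨ monomial-cong 0 (L.quotient-* (L.1-q∣1-q^ N)) ⟩
        const (L.1# L.- L.q^ N)    ≈⟨ 1-q̂^ N ⟩
        1# - q̂^ N                  ∎
    ; 1-q-cancel   = 1-q-cancel
    ; torsion-free = torsion-free }

  open QBinomials ℤ[q,q⁻¹][x] q̂^ ⟦_⟧

  const-^ : ∀ c n → const (c L.^ n) ≈ const c ^ n
  const-^ c zero    = refl {1#}
  const-^ c (suc n) = *-congˡ {const c} {const (c L.^ n)} {const c ^ n} (const-^ c n)

  -- The quotient `[ N choose + k ]` unfolds to Pascal's recursion, from which its divisibility was
  -- proved, so both sides follow the same cases.
  const-binomial : ∀ N k → const L.[ N choose + k ] ≈ binomial N k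
  const-binomial N       zero    = refl {1#}
  -- `const` of zero is a term with zero coefficient while `0#` is the empty sum, so the two agree
  -- only coefficient by coefficient.
  const-binomial zero    (suc k) = coeffs λ { zero → L.refl {[]} ; (suc _) → L.refl {[]} }
  const-binomial (suc N) (suc k) = begin
    const (L.[ N choose + k ] L.+ L.q^ (+ suc k) L.* L.[ N choose + suc k ])
      ≈⟨ monomial-+ L.[ N choose + k ] (L.q^ (+ suc k) L.* L.[ N choose + suc k ]) 0 ⟩
    const L.[ N choose + k ] + q̂^ (+ suc k) * const L.[ N choose + suc k ]
      ≈⟨ +-cong {const L.[ N choose + k ]} {binomial N k} {q̂^ (+ suc k) * const L.[ N choose + suc k ]} {q̂^ (+ suc k) * binomial N (suc k)}
           (const-binomial N k)
           (*-congˡ {q̂^ (+ suc k)} {const L.[ N choose + suc k ]} {binomial N (suc k)} (const-binomial N (suc k))) ⟩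
    binomial N k + q̂^ (+ suc k) * binomial N (suc k) ∎

  module _ (k j : ℕ) where

    private
      a b c e : L.Carrier
      a = L.[ k ℕ.∸ 1 choose + (j ℕ.∸ 1) ]
      b = L.[ k ℕ.+ j choose + j ]
      c = L.[ k choose + j ]
      e = L.[ k ℕ.+ j choose + (j ℕ.∸ 1) ]

    const-narayana : const (a L.* b L.- c L.* e) ≈ narayana k j
    const-narayana = trans {const (a L.* b L.- c L.* e)} {const a * const b - const c * const e} {narayana k j}
      (monomial-+ (a L.* b) (L.- (c L.* e)) 0)
      (+-cong {const a * const b} { binomial (k ℕ.∸ 1) (j ℕ.∸ 1) * binomial (k ℕ.+ j) j}
        { - (const c * const e)} { - (binomial k j * binomial (k ℕ.+ j) (j ℕ.∸ 1))}
        (*-cong {const a} {binomial (k ℕ.∸ 1) (j ℕ.∸ 1)} {const b} {binomial (k ℕ.+ j) j}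
          (const-binomial (k ℕ.∸ 1) (j ℕ.∸ 1)) (const-binomial (k ℕ.+ j) j))
        (-‿cong {const c * const e} {binomial k j * binomial (k ℕ.+ j) (j ℕ.∸ 1)}
          (*-cong {const c} {binomial k j} {const e} {binomial (k ℕ.+ j) (j ℕ.∸ 1)}
            (const-binomial k j) (const-binomial (k ℕ.+ j) (j ℕ.∸ 1)))))

    const-coefficient : ∀ α → const (L.q^ (+ α ℤ.* twist k j) L.* (a L.* b L.- c L.* e) L.^ α)
      ≈ q̂^ (+ α ℤ.* twist k j) * narayana k j ^ α
    const-coefficient α = *-congˡ {q̂^ (+ α ℤ.* twist k j)} {const (D L.^ α)} {narayana k j ^ α}
      (trans {const (D L.^ α)} {const D ^ α} {narayana k j ^ α}
        (const-^ D α) (^-congˡ α const-narayana))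
      where D = a L.* b L.- c L.* e

  w≈weight : ∀ α k → w α k ≈ weight x α k
  w≈weight α k = RangeProperties.range-cong +-commutativeMonoid k
    λ {j} _ → *-congʳ {x ^ j} {_} {q̂^ (+ α ℤ.* twist k (suc j)) * narayana k (suc j) ^ α} (const-coefficient k (suc j) α)

open import Defs

theorem5 : (α β m n r : ℕ) → α > 0 → β > 0 → m > 0 → n > 0 → r > 0 →
    const [ + n ] ∣
    (∑[ k < n ]
    const [ + (rising k β ℕ.* rising (k ℕ.+ β ℕ.+ 1) β) ] ^ r
    * const [ + (2 ℕ.* (k ℕ.+ β)) ]
    * const (q^ ((+ n ℤ.- + (2 ℕ.* β) ℤ.- + k) ℤ.* + (2 ℕ.* β ℕ.* α ℕ.* m ℕ.+ 1)))
    * (∏[ i < 2 ℕ.* β ] w α (k ℕ.+ i) ^ m))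
theorem5 α β m n r α>0 _ _ n>0 r>0 = ∣ʳ-respʳ-≈
  -- `q̂^` and `⟦_⟧` are `const` applied to the originals, so `summand` at `P.x` unfolds to the
  -- stated term except for `weight` in place of `w`. Only the product is rewritten.
  (RangeProperties.range-cong P.+-commutativeMonoid n λ {k} _ →
    P.*-congˡ {size k * const [ + (2 ℕ.* (k ℕ.+ β)) ] * const (power k)}
      (RangeProperties.range-cong P.*-commutativeMonoid (2 ℕ.* β) λ {i} _ →
        ^-congˡ m (P.sym {w α (k ℕ.+ i)} (w≈weight α (k ℕ.+ i)))))
  (QDivisibility.[n]∣∑summand P.ℤ[q,q⁻¹][x] q̂^ ⟦_⟧ isTorsionFreeQNumbers P.x α>0 β m n>0 r>0)
  where
  module P = Polynomial
  open PolynomialTorsion using (q̂^)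
  open Transport
  open import Algebra.Properties.Semiring.Exp P.semiring using (^-congˡ)
  open import Algebra.Properties.Semiring.Divisibility P.semiring using (∣ʳ-respʳ-≈)
  size : ℕ → P.Carrier
  size k = const [ + (rising k β ℕ.* rising (k ℕ.+ β ℕ.+ 1) β) ] ^ r
  power : ℕ → _
  power k = q^ ((+ n ℤ.- + (2 ℕ.* β) ℤ.- + k) ℤ.* + (2 ℕ.* β ℕ.* α ℕ.* m ℕ.+ 1))
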